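{- Let $\mathfrak{g}$ be a Lie ring and $(\mathfrak{g},A)$ a $\mathfrak{g}$-module, with $\mathfrak{g}$, $A$ and the action definable in a finite-dimensional theory. Assume that $\mathfrak{g}$ is nilpotent and that the $0$th almost cohomology group $\widetilde{H}^0(\mathfrak{g},A)$ is finite. Then the $1$st almost cohomology group $\widetilde{H}^1(\mathfrak{g},A)$ is finite.
   Context: Finite-dimensional theory: a first-order theory $T$ with a function $\dim$ from the class of all interpretable sets in models of $T$ to $\omega\cup\{ -\infty\}$ such that, for every formula $\phi(x,y)$, all interpretable sets $X,Y$ and every interpretable function $f:X\to Y$: (Invariance) if $a,a'$ have the same type over $\emptyset$ then $\dim\phi(x,a)=\dim\phi(x,a')$; (Algebraicity) $\dim\emptyset=-\infty$, and $\dim X=0$ iff $X$ is finite (nonempty); (Union) $\dim(X\cup Y)=\max\{\dim X,\dim Y\}$; (Upper Fibration) if $\dim f^{ -1}(y)\ge k$ for all $y\in Y$ then $\dim X\ge\dim Y+k$; (Lower Fibration) if $\dim f^{ -1}(y)\le k$ for all $y\in Y$ then $\dim X\le \dim Y+k$. An object is definable in a finite-dimensional theory if it is definable in a model of such a theory. Lie ring: an abelian group $(\mathfrak{g},+)$ with a bilinear, antisymmetric bracket satisfying the Jacobi identity; for $g\in\mathfrak g$, $\mathrm{ad}_g(x)=[g,x]$. It is nilpotent if there is a chain of ideals $\mathfrak g=\mathfrak g_0\ge\mathfrak g_1\ge\dots\ge\mathfrak g_n=0$ with $[\mathfrak g,\mathfrak g_i]\le\mathfrak g_{i+1}$ for $i<n$.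 A $\mathfrak g$-module is an abelian group $A$ with a map $\mathfrak g\times A\to A$ inducing a homomorphism of Lie rings $\mathfrak g\to\mathrm{End}(A)$, where $\mathrm{End}(A)$ has bracket $fh-hf$. Almost cohomology. A partial homomorphism from $\mathfrak g$ to $A$ is a group homomorphism $f:\mathrm{Dom}(f)\to A$ with $\mathrm{Dom}(f)$ a subgroup of finite index in $(\mathfrak g,+)$. The sum $f+f_1$ is defined pointwise on $\mathrm{Dom}(f)\cap\mathrm{Dom}(f_1)$, and $-f$ pointwise on $\mathrm{Dom}(f)$. Write $f\sim f_1$ if $(f-f_1)(\mathrm{Dom}(f)\cap\mathrm{Dom}(f_1))$ is finite. Set $\widetilde C^0(\mathfrak g,A)=A$ and $\widetilde C^1(\mathfrak g,A)=\{\text{partial homomorphisms}\}/\sim$, which is a group under $+$. The differential $d:\widetilde C^0(\mathfrak g,A)\to\widetilde C^1(\mathfrak g,A)$ sends $a$ to the class of $d(a):g\mapsto g\cdot a$. For a partial homomorphism $f$ and $g\in\mathrm{Dom}(f)$, let $D^f_g=\{g'\in\mathrm{Dom}(f)\cap\mathrm{ad}_g^{ -1}(\mathrm{Dom}(f)) : f([g,g'])=g\cdot f(g')-g'\cdot f(g)\}$ and $D^f=\{g\in\mathrm{Dom}(f): D^f_g \text{ has finite index in }\mathfrak g\}$. Then $f$ is an almost derivation if $D^f$ has finite index in $\mathfrak g$; $\mathrm{AlmDer}(\mathfrak g,A)\le\widetilde C^1(\mathfrak g,A)$ is the subgroup of classes of almost derivations. Define $\widetilde H^0(\mathfrak g,A)=\ker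 d$ (equivalently, $\{a\in A:\mathfrak g\cdot a\text{ is finite}\}$) and $\widetilde H^1(\mathfrak g,A)=\mathrm{AlmDer}(\mathfrak g,A)/\mathrm{im}(d)$. -}

module Defs where

open import Algebra.Bundles using (AbelianGroup)
open import Algebra.Construct.Add.Identity using (liftOp)
open import Algebra.Core using (Op₁; Op₂)
open import Data.Empty.Polymorphic using (⊥)
open import Data.Fin.Base as Fin using (Fin; fromℕ; inject₁)
open import Data.List.Base using (List)
open import Data.List.Relation.Unary.All using (All)
open import Data.List.Relation.Unary.Any using (Any)
open import Data.Nat.Base as ℕ using (ℕ)
open import Data.Product.Base using (Σ; Σ-syntax; ∃; ∃₂; ∃-syntax; _×_; _,_; proj₁)
open import Data.Sum.Base using (_⊎_)
open import Data.Unit.Polymorphic using (⊤)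
open import Data.Vec.Base using (Vec; []; _∷_; _++_; lookup)
open import Function.Base using (_on_)
open import Function.Bundles using (_⇔_; Injection)
open import Level using (Level; suc; _⊔_)
open import Relation.Binary.Core using (Rel)
open import Relation.Binary.PropositionalEquality.Core using (_≡_)
open import Relation.Binary.PropositionalEquality.Properties using (setoid)
open import Relation.Binary.Structures using (IsEquivalence)
open import Relation.Nullary.Construct.Add.Infimum using (_₋; ⊥₋; [_])
open import Relation.Binary.Construct.Add.Infimum.NonStrict ℕ._≤_ using (_≤₋_)
open import Relation.Unary using (Pred; _∈_; _⊆_; _∩_; U; Empty; Satisfiable)

private
  variable
    a p r ℓ : Level
    k m n : ℕ

-- The quotient of P by _~_ is finite: finitely many elements of P
-- represent all of P.  With _~_ the ambient equality, P itself is finite.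

FiniteUpTo : {A : Set a} → Rel A r → Pred A p → Set (a ⊔ r ⊔ p)
FiniteUpTo {A = A} _~_ P =
  Σ[ xs ∈ List A ] All P xs × (∀ {x} → x ∈ P → Any (x ~_) xs)

record Signature (ℓ : Level) : Set (suc ℓ) where
  field
    FunSymbol : ℕ → Set ℓ
    RelSymbol : ℕ → Set ℓ

module _ (𝓛 : Signature ℓ) where
  open Signature 𝓛

  data Term (n : ℕ) : Set ℓ where
    var : Fin n → Term n
    app : FunSymbol k → Vec (Term n) k → Term n

  infix  7 _≐_
  infixr 6 _∧_
  infixr 5 _∨_
  infixr 4 _⟶_

  -- Formulas with free variables among Fin n; quantifiers bind variable 0.
  data Formula (n : ℕ) : Set ℓ where
    _≐_         : Term n → Term n → Formula n
    rel         : RelSymbol k → Vec (Term n) k → Formula n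
    false       : Formula n
    _∧_ _∨_ _⟶_ : Formula n → Formula n → Formula n
    all ex      : Formula (ℕ.suc n) → Formula n

  Theory : Set (suc ℓ)
  Theory = Pred (Formula 0) ℓ

  record Structure : Set (suc ℓ) where
    field
      ∣_∣    : Set ℓ
      point  : ∣_∣
      fun    : FunSymbol k → Vec ∣_∣ k → ∣_∣
      holds  : RelSymbol k → Vec ∣_∣ k → Set ℓ

open Structure public using (∣_∣)

module _ {𝓛 : Signature ℓ} (M : Structure 𝓛) where
  open Structure M using (fun; holds)

  mutual
    eval : Vec ∣ M ∣ n → Term 𝓛 n → ∣ M ∣
    eval ρ (var i)    = lookup ρ i
    eval ρ (app f ts) = fun f (evals ρ ts)

    evals : Vec ∣ M ∣ n → Vec (Term 𝓛 n) k → Vec ∣ M ∣ k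
    evals ρ []       = []
    evals ρ (t ∷ ts) = eval ρ t ∷ evals ρ ts

  Sat : Formula 𝓛 n → Vec ∣ M ∣ n → Set ℓ
  Sat (s ≐ t)    ρ = eval ρ s ≡ eval ρ t
  Sat (rel R ts) ρ = holds R (evals ρ ts)
  Sat false      ρ = ⊥
  Sat (φ ∧ ψ)    ρ = Sat φ ρ × Sat ψ ρ
  Sat (φ ∨ ψ)    ρ = Sat φ ρ ⊎ Sat ψ ρ
  Sat (φ ⟶ ψ)    ρ = Sat φ ρ → Sat ψ ρ
  Sat (all φ)    ρ = ∀ x → Sat φ (x ∷ ρ)
  Sat (ex φ)     ρ = ∃[ x ] Sat φ (x ∷ ρ)

record Model {𝓛 : Signature ℓ} (T : Theory 𝓛) : Set (suc ℓ) where
  field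
    structure : Structure 𝓛
    satisfies : ∀ σ → σ ∈ T → Sat structure σ []

-- The tuples v and w, possibly in different structures, have the same
-- type over ∅.
SameType : {𝓛 : Signature ℓ} (M N : Structure 𝓛) →
           Vec ∣ M ∣ k → Vec ∣ N ∣ k → Set ℓ
SameType {𝓛 = 𝓛} M N v w = ∀ (φ : Formula 𝓛 _) → Sat M φ v ⇔ Sat N φ w

module _ {𝓛 : Signature ℓ} (M : Structure 𝓛) where

  record Definable (n : ℕ) : Set ℓ where
    constructor definable
    field
      {#params} : ℕ
      formula   : Formula 𝓛 (n ℕ.+ #params)
      params    : Vec ∣ M ∣ #params

    ⟦_⟧ : Pred (Vec ∣ M ∣ n) ℓ
    ⟦_⟧ v = Sat M formula (v ++ params)

  open Definable public using (⟦_⟧)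

  IsDefinable : Pred (Vec ∣ M ∣ n) p → Set (ℓ ⊔ p)
  IsDefinable {n = n} P = Σ[ D ∈ Definable n ] ∀ v → v ∈ P ⇔ v ∈ ⟦ D ⟧

-- Parameter-free data of a family, indexed by k-tuples of parameters, of
-- n-ary definable sets with a relation intended as an equivalence on each.
record Scheme (𝓛 : Signature ℓ) (n k : ℕ) : Set ℓ where
  field
    domain   : Formula 𝓛 (n ℕ.+ k)
    relation : Formula 𝓛 ((n ℕ.+ n) ℕ.+ k)

module _ {𝓛 : Signature ℓ} (M : Structure 𝓛) where

  module _ (S : Scheme 𝓛 n k) (ps : Vec ∣ M ∣ k) where
    open Scheme S

    Dom[_,_] : Pred (Vec ∣ M ∣ n) ℓ
    Dom[_,_] v = Sat M domain (v ++ ps)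

    Eq[_,_] : Rel (Vec ∣ M ∣ n) ℓ
    Eq[_,_] v w = Sat M relation ((v ++ w) ++ ps)

  -- A definable set modulo a definable equivalence relation on it.
  -- Elements are handled through representatives.
  record Interpretable (n : ℕ) : Set ℓ where
    constructor interpretable
    field
      {#params}     : ℕ
      scheme        : Scheme 𝓛 n #params
      params        : Vec ∣ M ∣ #params

    Dom : Pred (Vec ∣ M ∣ n) ℓ
    Dom = Dom[ scheme , params ]

    Eq : Rel (Vec ∣ M ∣ n) ℓ
    Eq = Eq[ scheme , params ]

    field
      isEquivalence : IsEquivalence (Eq on proj₁ {B = Dom})

module _ {𝓛 : Signature ℓ} {M : Structure 𝓛} where
  open Interpretable using (Dom; Eq)

  infix 4 _⊑_

  -- X is a subset of Y, with the equality inherited from Y.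
  record _⊑_ (X Y : Interpretable M n) : Set ℓ where
    field
      dom : Dom X ⊆ Dom Y
      eq  : ∀ {v w} → v ∈ Dom X → w ∈ Dom X → Eq X v w ⇔ Eq Y v w

  -- Z presents the union of X and Y, the three being sets in one sort.
  record IsUnion (X Y Z : Interpretable M n) : Set ℓ where
    field
      left  : X ⊑ Z
      right : Y ⊑ Z
      cover : ∀ {v} → v ∈ Dom Z → v ∈ Dom X ⊎ v ∈ Dom Y

  record InterpretableFunction (X : Interpretable M m) (Y : Interpretable M n) :
                               Set ℓ where
    field
      graph : Definable M (m ℕ.+ n)

    Maps : Vec ∣ M ∣ m → Vec ∣ M ∣ n → Set ℓ
    Maps x y = (x ++ y) ∈ ⟦ graph ⟧

    field
      respects   : ∀ {x x′ y y′} →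
                   x ∈ Dom X → x′ ∈ Dom X → y ∈ Dom Y → y′ ∈ Dom Y →
                   Eq X x x′ → Eq Y y y′ → Maps x y → Maps x′ y′
      total      : ∀ {x} → x ∈ Dom X → ∃[ y ] y ∈ Dom Y × Maps x y
      functional : ∀ {x y y′} → x ∈ Dom X → y ∈ Dom Y → y′ ∈ Dom Y →
                   Maps x y → Maps x y′ → Eq Y y y′

  -- Z presents the fibre of f over the class of y.  Every fibre has a
  -- presentation: conjoin the graph of f, with y as extra parameters, to
  -- the domain of X.
  record IsFibre {X : Interpretable M m} {Y : Interpretable M n}
                 (f : InterpretableFunction X Y) (y : Vec ∣ M ∣ n)
                 (Z : Interpretable M m) : Set ℓ where
    open InterpretableFunction f using (Maps)
    field
      subset : Z ⊑ X
      member : ∀ {x} → x ∈ Dom X → x ∈ Dom Z ⇔ Maps x y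

  IsFinite : Interpretable M n → Set ℓ
  IsFinite X = FiniteUpTo (Eq X) (Dom X)

-- ω ∪ {-∞}
Dimension : Set
Dimension = ℕ ₋

max : Op₂ Dimension
max = liftOp ℕ._⊔_

infixl 6 _+₋_

_+₋_ : Dimension → ℕ → Dimension
⊥₋    +₋ k = ⊥₋
[ n ] +₋ k = [ n ℕ.+ k ]

-- dim is given on presentations.  That it depends only on the presented
-- set is the instance X ∪ X of union.
record FiniteDimensional {𝓛 : Signature ℓ} (T : Theory 𝓛) : Set (suc ℓ) where
  open Model
  open Interpretable using (Dom)
  field
    dim : (M : Model T) → Interpretable (structure M) n → Dimension

    invariance :
      (M N : Model T) (S : Scheme 𝓛 n k)
      (v : Vec ∣ structure M ∣ k) (w : Vec ∣ structure N ∣ k) →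
      SameType (structure M) (structure N) v w →
      ∀ e e′ → dim M (interpretable S v e) ≡ dim N (interpretable S w e′)

    empty : (M : Model T) (X : Interpretable (structure M) n) →
            Empty (Dom X) → dim M X ≡ ⊥₋

    algebraicity : (M : Model T) (X : Interpretable (structure M) n) →
                   dim M X ≡ [ 0 ] ⇔ (Satisfiable (Dom X) × IsFinite X)

    union : (M : Model T) (X Y Z : Interpretable (structure M) n) →
            IsUnion X Y Z → dim M Z ≡ max (dim M X) (dim M Y)

    upper-fibration :
      (M : Model T)
      (X : Interpretable (structure M) m) (Y : Interpretable (structure M) n)
      (f : InterpretableFunction X Y) (k : ℕ) →
      (∀ {y} → y ∈ Dom Y → ∀ Z → IsFibre f y Z → [ k ] ≤₋ dim M Z) →
      dim M Y +₋ k ≤₋ dim M X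

    lower-fibration :
      (M : Model T)
      (X : Interpretable (structure M) m) (Y : Interpretable (structure M) n)
      (f : InterpretableFunction X Y) (k : ℕ) →
      (∀ {y} → y ∈ Dom Y → ∀ Z → IsFibre f y Z → dim M Z ≤₋ [ k ]) →
      dim M X ≤₋ dim M Y +₋ k

record LieRing (ℓ : Level) : Set (suc ℓ) where
  field
    additiveGroup : AbelianGroup ℓ ℓ

  open AbelianGroup additiveGroup public
    using (Carrier; _≈_; _-_) renaming (_∙_ to infixl 6 _+_; ε to 0#; _⁻¹ to -_)

  field
    ⁅_,_⁆      : Op₂ Carrier
    ⁅⁆-cong    : ∀ {x x′ y y′} → x ≈ x′ → y ≈ y′ → ⁅ x , y ⁆ ≈ ⁅ x′ , y′ ⁆
    ⁅⁆-linearˡ : ∀ x y z → ⁅ x + y , z ⁆ ≈ ⁅ x , z ⁆ + ⁅ y , z ⁆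
    ⁅⁆-linearʳ : ∀ x y z → ⁅ x , y + z ⁆ ≈ ⁅ x , y ⁆ + ⁅ x , z ⁆
    antisym    : ∀ x y → ⁅ x , y ⁆ ≈ - ⁅ y , x ⁆
    jacobi     : ∀ x y z →
                 (⁅ x , ⁅ y , z ⁆ ⁆ + ⁅ y , ⁅ z , x ⁆ ⁆) + ⁅ z , ⁅ x , y ⁆ ⁆ ≈ 0#

record IsSubgroup (G : AbelianGroup ℓ ℓ) (H : Pred (AbelianGroup.Carrier G) ℓ) :
                  Set ℓ where
  open AbelianGroup G
  field
    respects  : ∀ {x y} → x ≈ y → x ∈ H → y ∈ H
    ε-closed  : ε ∈ H
    ∙-closed  : ∀ {x y} → x ∈ H → y ∈ H → x ∙ y ∈ H
    ⁻¹-closed : ∀ {x} → x ∈ H → x ⁻¹ ∈ H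

-- H need not be assumed a subgroup; finitely many translates of it cover G.
FiniteIndex : (G : AbelianGroup ℓ ℓ) → Pred (AbelianGroup.Carrier G) ℓ → Set ℓ
FiniteIndex G H = FiniteUpTo (λ x y → x - y ∈ H) U
  where open AbelianGroup G

module _ (𝔤 : LieRing ℓ) where
  open LieRing 𝔤

  record IsIdeal (I : Pred Carrier ℓ) : Set ℓ where
    field
      isSubgroup : IsSubgroup additiveGroup I
      ⁅⁆-closed  : ∀ x {y} → y ∈ I → ⁅ x , y ⁆ ∈ I

  record Nilpotent : Set (suc ℓ) where
    field
      length     : ℕ
      chain      : Fin (ℕ.suc length) → Pred Carrier ℓ
      ideal      : ∀ i → IsIdeal (chain i)
      top        : ∀ x → x ∈ chain Fin.zero
      descending : ∀ (i : Fin length) → chain (Fin.suc i) ⊆ chain (inject₁ i)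
      central    : ∀ (i : Fin length) x {y} →
                   y ∈ chain (inject₁ i) → ⁅ x , y ⁆ ∈ chain (Fin.suc i)
      bottom     : ∀ {x} → x ∈ chain (fromℕ length) → x ≈ 0#

record LieModule (𝔤 : LieRing ℓ) : Set (suc ℓ) where
  open LieRing 𝔤 using (⁅_,_⁆) renaming (Carrier to L; _≈_ to _≈ᴸ_; _+_ to _+ᴸ_)

  infixr 7 _·_

  field
    additiveGroup : AbelianGroup ℓ ℓ

  open AbelianGroup additiveGroup public
    using (Carrier; _≈_; _-_) renaming (_∙_ to infixl 6 _+_; ε to 0#; _⁻¹ to -_)

  field
    _·_      : L → Carrier → Carrier
    ·-cong   : ∀ {x y a b} → x ≈ᴸ y → a ≈ b → x · a ≈ y · b
    ·-distˡ  : ∀ x a b → x · (a + b) ≈ x · a + x · b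
    ·-distʳ  : ∀ x y a → (x +ᴸ y) · a ≈ x · a + y · a
    ·-⁅⁆     : ∀ x y a → ⁅ x , y ⁆ · a ≈ x · (y · a) - y · (x · a)

-- Up to an isomorphism of setoids, 𝔤 and A are definable sets of tuples on
-- which the graphs of +, of the bracket and of the action are definable.
record DefinableIn {𝓛 : Signature ℓ} (M : Structure 𝓛)
                   (𝔤 : LieRing ℓ) (A : LieModule 𝔤) : Set ℓ where
  private
    module L = LieRing 𝔤
    module A = LieModule A
  field
    {arityᴸ arityᴬ} : ℕ
    coordᴸ : Injection (AbelianGroup.setoid L.additiveGroup) (setoid (Vec ∣ M ∣ arityᴸ))
    coordᴬ : Injection (AbelianGroup.setoid A.additiveGroup) (setoid (Vec ∣ M ∣ arityᴬ))

  open Injection coordᴸ using () renaming (to to κᴸ)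
  open Injection coordᴬ using () renaming (to to κᴬ)

  field
    imageᴸ  : IsDefinable M λ v → ∃[ x ] v ≡ κᴸ x
    imageᴬ  : IsDefinable M λ v → ∃[ a ] v ≡ κᴬ a
    sumᴸ    : IsDefinable M λ v → ∃₂ λ x y → v ≡ (κᴸ x ++ κᴸ y) ++ κᴸ (x L.+ y)
    bracket : IsDefinable M λ v → ∃₂ λ x y → v ≡ (κᴸ x ++ κᴸ y) ++ κᴸ L.⁅ x , y ⁆
    sumᴬ    : IsDefinable M λ v → ∃₂ λ a b → v ≡ (κᴬ a ++ κᴬ b) ++ κᴬ (a A.+ b)
    action  : IsDefinable M λ v → ∃₂ λ x a → v ≡ (κᴸ x ++ κᴬ a) ++ κᴬ (x A.· a)

module AlmostCohomology (𝔤 : LieRing ℓ) (A : LieModule 𝔤) where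
  private
    module L = LieRing 𝔤
    module A = LieModule A
    open AbelianGroup A.additiveGroup using (∙-cong; ⁻¹-cong; refl; sym; trans)
    open import Algebra.Properties.AbelianGroup A.additiveGroup
      using (⁻¹-∙-comm)
    open import Algebra.Properties.CommutativeSemigroup
      (AbelianGroup.commutativeSemigroup A.additiveGroup) using (interchange)

  open L using (⁅_,_⁆)
  open A using (_≈_; _·_)

  -- A homomorphism to A from a subgroup of 𝔤 of arbitrary index, as a
  -- function on pairs of an element and a membership proof; cong makes the
  -- value independent of the proof.
  record SubgroupHom : Set (suc ℓ) where
    field
      Dom        : Pred L.Carrier ℓ
      isSubgroup : IsSubgroup L.additiveGroup Dom
      at         : ∀ x → x ∈ Dom → A.Carrier
      cong       : ∀ {x y} (p : x ∈ Dom) (q : y ∈ Dom) → x L.≈ y → at x p ≈ at y q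
      homo       : ∀ {x y} (p : x ∈ Dom) (q : y ∈ Dom) (r : x L.+ y ∈ Dom) →
                   at (x L.+ y) r ≈ at x p A.+ at y q

    Image : Pred A.Carrier ℓ
    Image a = ∃[ x ] Σ[ p ∈ x ∈ Dom ] a ≈ at x p

  open SubgroupHom

  IsPartialHom : SubgroupHom → Set ℓ
  IsPartialHom f = FiniteIndex L.additiveGroup (Dom f)

  infixl 6 _+ʰ_ _-ʰ_
  infix  8 -ʰ_
  infix  4 _∼_ _≈¹_

  _+ʰ_ : SubgroupHom → SubgroupHom → SubgroupHom
  f +ʰ g = record
    { Dom        = Dom f ∩ Dom g
    ; isSubgroup = record
      { respects  = λ e (p , q) → F.respects e p , G.respects e q
      ; ε-closed  = F.ε-closed , G.ε-closed
      ; ∙-closed  = λ (p , q) (p′ , q′) → F.∙-closed p p′ , G.∙-closed q q′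
      ; ⁻¹-closed = λ (p , q) → F.⁻¹-closed p , G.⁻¹-closed q
      }
    ; at         = λ x (p , q) → at f x p A.+ at g x q
    ; cong       = λ (p , q) (p′ , q′) e → ∙-cong (cong f p p′ e) (cong g q q′ e)
    ; homo       = λ (p , q) (p′ , q′) (p″ , q″) →
                     trans (∙-cong (homo f p p′ p″) (homo g q q′ q″))
                           (interchange _ _ _ _)
    }
    where
    module F = IsSubgroup (isSubgroup f)
    module G = IsSubgroup (isSubgroup g)

  -ʰ_ : SubgroupHom → SubgroupHom
  -ʰ f = record
    { Dom        = Dom f
    ; isSubgroup = isSubgroup f
    ; at         = λ x p → A.- at f x p
    ; cong       = λ p q e → ⁻¹-cong (cong f p q e)
    ; homo       = λ p q r → trans (⁻¹-cong (homo f p q r)) (sym (⁻¹-∙-comm _ _))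
    }

  _-ʰ_ : SubgroupHom → SubgroupHom → SubgroupHom
  f -ʰ g = f +ʰ (-ʰ g)

  _∼_ : SubgroupHom → SubgroupHom → Set ℓ
  f ∼ g = FiniteUpTo _≈_ (Image (f -ʰ g))

  d : A.Carrier → SubgroupHom
  d a = record
    { Dom        = λ _ → ⊤
    ; isSubgroup = _
    ; at         = λ x _ → x · a
    ; cong       = λ _ _ e → A.·-cong e refl
    ; homo       = λ _ _ _ → A.·-distʳ _ _ a
    }

  0ʰ : SubgroupHom
  0ʰ = record
    { Dom        = λ _ → ⊤
    ; isSubgroup = _
    ; at         = λ _ _ → A.0#
    ; cong       = λ _ _ _ → refl
    ; homo       = λ _ _ _ → sym (AbelianGroup.identityˡ A.additiveGroup _)
    }

  module _ (f : SubgroupHom) where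

    Dᶠ[_] : ∀ {x} → x ∈ Dom f → Pred L.Carrier ℓ
    Dᶠ[_] {x} p y =
      Σ[ q ∈ y ∈ Dom f ] Σ[ r ∈ ⁅ x , y ⁆ ∈ Dom f ]
        at f ⁅ x , y ⁆ r ≈ x · at f y q A.- y · at f x p

    Dᶠ : Pred L.Carrier ℓ
    Dᶠ x = Σ[ p ∈ x ∈ Dom f ] FiniteIndex L.additiveGroup Dᶠ[ p ]

    IsAlmostDerivation : Set ℓ
    IsAlmostDerivation = IsPartialHom f × FiniteIndex L.additiveGroup Dᶠ

  -- The kernel of d : A → C̃¹.
  H̃⁰ : Pred A.Carrier ℓ
  H̃⁰ a = d a ∼ 0ʰ

  H̃⁰-Finite : Set ℓ
  H̃⁰-Finite = FiniteUpTo _≈_ H̃⁰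

  -- The classes of f and g in C̃¹ agree modulo im d.
  _≈¹_ : SubgroupHom → SubgroupHom → Set ℓ
  f ≈¹ g = ∃[ a ] (f -ʰ g) ∼ d a

  -- Elements of H̃¹ are almost derivations up to _≈¹_; the passage to
  -- _∼_-classes is absorbed, _∼_ being contained in _≈¹_ (take a = 0).
  H̃¹-Finite : Set (suc ℓ)
  H̃¹-Finite = FiniteUpTo _≈¹_ IsAlmostDerivation

{-# OPTIONS --safe #-}

-- Split 𝔤-modules definable up to finite index until they are irreducible:
-- the long exact sequence of a section reduces the claim to its parts, and
-- their dimensions drop.  In an irreducible section B/C with H⁰ = 0,
-- nilpotency gives an infinite group Z of operators commuting with almost
-- all of 𝔤, and every z ∈ Z not killing B/C is injective, hence, counting
-- dimensions, has image of finite index.  An almost derivation f is then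
-- almost everywhere x ↦ z⁻¹·x·f(z), for any such z in its domain, so it is
-- described by the fraction f(z)/z.  As z cannot be fixed in advance, the
-- quotient of all fractions b/z by the inner derivations is bounded at
-- once: every class has full dimension, so there are finitely many.
module Submission where

open import Defs
open import Algebra.Bundles using (AbelianGroup)
import Algebra.Properties.AbelianGroup as AbelianGroupProperties
import Algebra.Properties.CommutativeSemigroup as CommutativeSemigroupProperties
import Algebra.Solver.CommutativeMonoid.Normal as CommutativeMonoidNormal
open import Axiom.ExcludedMiddle using (ExcludedMiddle)
import Data.Empty as Empty
open import Data.Fin.Base as Fin using (Fin; zero; suc; inject₁; fromℕ<; splitAt; _↑ˡ_; _↑ʳ_)
open import Data.Fin.Patterns
import Data.Fin.Properties as Fin
open import Data.List.Base as List using (List; []; _∷_)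
open import Data.List.Relation.Unary.All as All using (All; []; _∷_)
import Data.List.Relation.Unary.All.Properties as All
open import Data.List.Relation.Unary.Any as Any using (Any; here; there)
import Data.List.Relation.Unary.Any.Properties as Any
open import Data.Nat.Base as ℕ using (ℕ; _≤_; _<_; z≤n; s≤s; _⊔_)
import Data.Nat.Properties as ℕ
open import Data.Product.Base using (Σ-syntax; ∃₂; ∃-syntax; _×_; _,_; proj₁; proj₂)
open import Data.Sum.Base as Sum using (_⊎_; inj₁; inj₂; [_,_]′)
import Data.Unit.Polymorphic as Unit
open import Data.Vec.Base as Vec using (Vec; []; _∷_; lookup; _++_)
open import Data.Vec.Properties using (lookup-++ˡ; lookup-++ʳ; ++-injective)
open import Function.Base using (_∘_; id)
open import Function.Bundles using (_⇔_; mk⇔; Equivalence; Injection)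
open import Level as Level using (Level; Lift; lift; lower)
open import Relation.Binary.Construct.Add.Infimum.NonStrict ℕ._≤_ using (_≤₋_; ⊥₋≤_; [_])
open import Relation.Binary.Core using (Rel; REL)
open import Relation.Binary.PropositionalEquality as ≡ using (_≡_)
import Relation.Binary.Reasoning.Setoid as SetoidReasoning
open import Relation.Nullary using (¬_; yes; no; contradiction)
open import Relation.Nullary.Construct.Add.Infimum using (⊥₋; [_])
open import Relation.Nullary.Decidable using (decidable-stable)
open import Relation.Unary using (Pred; _∈_; _⊆_; _∩_; U; Satisfiable)

-- The obstacle is that the domain of an almost derivation is an arbitrary subgroup of finite index:
-- it need not be definable and may miss any given z. Almost derivations themselves therefore carry
-- no dimension, but pairs (z, b) do. The class of b/g contains all fractions (y - x·a)/x, where a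
-- runs through B/C and x through the elements of Z that do not kill B/C and over which b/g can be
-- rewritten as y/x. Rewriting is possible for all x in a subgroup of finite index in Z, because gB
-- has finite index in B; the x that kill B/C form a subgroup of infinite index, hence of smaller
-- dimension. So each class has at least the dimension dim Z + dim B/C, which also bounds the set of
-- all pairs, and fibration leaves dimension 0 for the quotient.

-- Finite quotients and excluded middle

module FiniteCovers (em : ∀ {p} → ExcludedMiddle p) where

  private
    variable
      a b p q r r′ s : Level

  classical : {P : Set p} → ¬ ¬ P → P
  classical = decidable-stable em

  by-cases : {P : Set p} {X : Set q} → (P → X) → (¬ P → X) → X
  by-cases {P = P} f g with em {P = P}
  ... | yes p = f p
  ... | no ¬p = g ¬p

  first-failure : (P : ℕ → Set p) → P 0 → ∀ n → ¬ P n → ∃[ k ] P k × ¬ P (ℕ.suc k)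
  first-failure P p₀ ℕ.zero    ¬p = contradiction p₀ ¬p
  first-failure P p₀ (ℕ.suc n) ¬p with em {P = P n}
  ... | yes q = n , q , ¬p
  ... | no ¬q = first-failure P p₀ n ¬q

  -- Representatives must lie in `P`, so each `z` in the list is traded for some element of `P`
  -- related to the class of `z`. Excluded middle decides whether there is one; a `z` without a
  -- partner is dropped.
  FiniteUpTo-transfer :
    {A : Set a} {B : Set b} {R : Rel A r} {P : Pred A p} {R′ : Rel B r′} {Q : Pred B q}
    (φ : REL A B s) → FiniteUpTo R′ Q →
    (∀ {x} → x ∈ P → ∃[ y ] y ∈ Q × φ x y) →
    (∀ {x x′ y y′ z} → x ∈ P → x′ ∈ P → y ∈ Q → y′ ∈ Q → z ∈ Q →
       φ x y → φ x′ y′ → R′ y z → R′ y′ z → R x x′) →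
    FiniteUpTo R P
  FiniteUpTo-transfer {A = A} {R = R} {P} {R′} {Q} φ (zs , zs∈Q , cover) total separate =
    let xs , xs∈P , cover′ = go zs zs∈Q
    in xs , xs∈P , λ x∈P → let y , y∈Q , xy = total x∈P in cover′ x∈P y∈Q xy (cover y∈Q)
    where
    go : ∀ zs → All Q zs → Σ[ xs ∈ List A ] All P xs ×
         (∀ {x y} → x ∈ P → y ∈ Q → φ x y → Any (R′ y) zs → Any (R x) xs)
    go [] _ = [] , [] , λ _ _ _ ()
    go (z ∷ zs) (z∈Q ∷ zs∈Q) with go zs zs∈Q | em {P = ∃₂ λ x y → x ∈ P × y ∈ Q × φ x y × R′ y z}
    ... | xs , xs∈P , c | yes (x′ , y′ , x′∈P , y′∈Q , x′y′ , y′z) =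
      x′ ∷ xs , x′∈P ∷ xs∈P , λ where
        x∈P y∈Q xy (here yz) → here (separate x∈P x′∈P y∈Q y′∈Q z∈Q xy x′y′ yz y′z)
        x∈P y∈Q xy (there i) → there (c x∈P y∈Q xy i)
    ... | xs , xs∈P , c | no none = xs , xs∈P , λ where
        x∈P y∈Q xy (here yz) → contradiction (_ , _ , x∈P , y∈Q , xy , yz) none
        x∈P y∈Q xy (there i) → c x∈P y∈Q xy i

FiniteUpTo-refine :
  ∀ {a b p q r s} {A : Set a} {B : Set b} {R : Rel A r} {P : Pred A p} {Q : Pred B q}
  (φ : REL A B s) (zs : List B) → All Q zs →
  (∀ {x} → x ∈ P → Any (φ x) zs) →
  (∀ {z} → z ∈ Q → FiniteUpTo R (λ x → x ∈ P × φ x z)) →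
  FiniteUpTo R P
FiniteUpTo-refine {A = A} {R = R} {P} {Q} φ zs zs∈Q cover finite =
  let xs , xs∈P , c = go zs zs∈Q in xs , xs∈P , λ x∈P → c x∈P (cover x∈P)
  where
  go : ∀ zs → All Q zs → Σ[ xs ∈ List A ] All P xs × (∀ {x} → x ∈ P → Any (φ x) zs → Any (R x) xs)
  go [] _ = [] , [] , λ _ ()
  go (z ∷ zs) (z∈Q ∷ zs∈Q) =
    let xs , xs∈P , c = finite z∈Q
        ys , ys∈P , d = go zs zs∈Q
    in xs List.++ ys , All.++⁺ (All.map proj₁ xs∈P) ys∈P , λ where
      x∈P (here xz) → Any.++⁺ˡ (c (x∈P , xz))
      x∈P (there i) → Any.++⁺ʳ xs (d x∈P i)

-- Equations in abelian groups

-- Moving the negated terms to the other side reduces equations of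
-- abelian groups to equations of commutative monoids.
module AbelianGroupSolver {c ℓ : Level} (G : AbelianGroup c ℓ) where
  open AbelianGroup G
  open CommutativeSemigroupProperties commutativeSemigroup using (interchange)
  private module N = CommutativeMonoidNormal commutativeMonoid
  open SetoidReasoning setoid

  infixl 6 _⊕_ _⊖_
  infix  8 ⊝_

  data Expr (n : ℕ) : Set where
    #_      : Fin n → Expr n
    𝟘       : Expr n
    _⊕_ _⊖_ : Expr n → Expr n → Expr n
    ⊝_      : Expr n → Expr n

  ⟪_⟫ : ∀ {n} → Expr n → Vec Carrier n → Carrier
  ⟪ # i ⟫   ρ = lookup ρ i
  ⟪ 𝟘 ⟫     ρ = ε
  ⟪ e ⊕ f ⟫ ρ = ⟪ e ⟫ ρ ∙ ⟪ f ⟫ ρ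
  ⟪ e ⊖ f ⟫ ρ = ⟪ e ⟫ ρ - ⟪ f ⟫ ρ
  ⟪ ⊝ e ⟫   ρ = ⟪ e ⟫ ρ ⁻¹

  mutual
    pos neg : ∀ {n} → Expr n → N.Expr n
    pos (# i)   = N.var i
    pos 𝟘       = N.id
    pos (e ⊕ f) = pos e N.⊕ pos f
    pos (e ⊖ f) = pos e N.⊕ neg f
    pos (⊝ e)   = neg e
    neg (# i)   = N.id
    neg 𝟘       = N.id
    neg (e ⊕ f) = neg e N.⊕ neg f
    neg (e ⊖ f) = neg e N.⊕ pos f
    neg (⊝ e)   = pos e

  split : ∀ {n} (e : Expr n) ρ → ⟪ e ⟫ ρ ∙ N.⟦ neg e ⟧ ρ ≈ N.⟦ pos e ⟧ ρ
  split (# i)   ρ = identityʳ _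
  split 𝟘       ρ = identityʳ _
  split (e ⊕ f) ρ = trans (interchange _ _ _ _) (∙-cong (split e ρ) (split f ρ))
  split (e ⊖ f) ρ = begin
    (⟪ e ⟫ ρ - ⟪ f ⟫ ρ) ∙ (N.⟦ neg e ⟧ ρ ∙ N.⟦ pos f ⟧ ρ)
      ≈⟨ interchange _ _ _ _ ⟩
    ⟪ e ⟫ ρ ∙ N.⟦ neg e ⟧ ρ ∙ (⟪ f ⟫ ρ ⁻¹ ∙ N.⟦ pos f ⟧ ρ)
      ≈⟨ ∙-cong (split e ρ) (trans (∙-congˡ (sym (split f ρ))) (cancel _ _)) ⟩
    N.⟦ pos e ⟧ ρ ∙ N.⟦ neg f ⟧ ρ ∎
    where
    cancel : ∀ x y → x ⁻¹ ∙ (x ∙ y) ≈ y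
    cancel x y = trans (sym (assoc _ _ _)) (trans (∙-congʳ (inverseˡ x)) (identityˡ y))
  split (⊝ e)   ρ = begin
    ⟪ e ⟫ ρ ⁻¹ ∙ N.⟦ pos e ⟧ ρ                  ≈⟨ ∙-congˡ (sym (split e ρ)) ⟩
    ⟪ e ⟫ ρ ⁻¹ ∙ (⟪ e ⟫ ρ ∙ N.⟦ neg e ⟧ ρ)      ≈⟨ assoc _ _ _ ⟨
    ⟪ e ⟫ ρ ⁻¹ ∙ ⟪ e ⟫ ρ ∙ N.⟦ neg e ⟧ ρ        ≈⟨ ∙-congʳ (inverseˡ _) ⟩
    ε ∙ N.⟦ neg e ⟧ ρ                           ≈⟨ identityˡ _ ⟩
    N.⟦ neg e ⟧ ρ                               ∎

  solve : ∀ {n} (ρ : Vec Carrier n) (e f : Expr n) →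
          N.normalise (pos e N.⊕ neg f) ≡ N.normalise (pos f N.⊕ neg e) →
          ⟪ e ⟫ ρ ≈ ⟪ f ⟫ ρ
  solve ρ e f eq = begin
    ⟪ e ⟫ ρ
      ≈⟨ add-sub _ _ ⟨
    (⟪ e ⟫ ρ ∙ N.⟦ neg e ⟧ ρ ∙ N.⟦ neg f ⟧ ρ) - (N.⟦ neg e ⟧ ρ ∙ N.⟦ neg f ⟧ ρ)
      ≈⟨ ∙-congʳ (∙-congʳ (split e ρ)) ⟩
    (N.⟦ pos e ⟧ ρ ∙ N.⟦ neg f ⟧ ρ) - (N.⟦ neg e ⟧ ρ ∙ N.⟦ neg f ⟧ ρ)
      ≈⟨ ∙-congʳ crossed ⟩
    (N.⟦ pos f ⟧ ρ ∙ N.⟦ neg e ⟧ ρ) - (N.⟦ neg e ⟧ ρ ∙ N.⟦ neg f ⟧ ρ)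
      ≈⟨ ∙-cong (∙-congʳ (sym (split f ρ))) (⁻¹-cong (comm _ _)) ⟩
    (⟪ f ⟫ ρ ∙ N.⟦ neg f ⟧ ρ ∙ N.⟦ neg e ⟧ ρ) - (N.⟦ neg f ⟧ ρ ∙ N.⟦ neg e ⟧ ρ)
      ≈⟨ add-sub _ _ ⟩
    ⟪ f ⟫ ρ ∎
    where
    add-sub : ∀ x {y} z → (x ∙ y ∙ z) - (y ∙ z) ≈ x
    add-sub x {y} z = begin
      (x ∙ y ∙ z) - (y ∙ z)  ≈⟨ ∙-congʳ (assoc _ _ _) ⟩
      (x ∙ (y ∙ z)) - (y ∙ z)  ≈⟨ assoc _ _ _ ⟩
      x ∙ (y ∙ z - (y ∙ z))  ≈⟨ ∙-congˡ (inverseʳ _) ⟩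
      x ∙ ε                  ≈⟨ identityʳ _ ⟩
      x                      ∎
    crossed : N.⟦ pos e ⟧ ρ ∙ N.⟦ neg f ⟧ ρ ≈ N.⟦ pos f ⟧ ρ ∙ N.⟦ neg e ⟧ ρ
    crossed = begin
      N.⟦ pos e N.⊕ neg f ⟧ ρ               ≈⟨ N.correct (pos e N.⊕ neg f) ρ ⟨
      N.⟦ N.normalise (pos e N.⊕ neg f) ⟧⇓ ρ ≡⟨ ≡.cong (λ v → N.⟦ v ⟧⇓ ρ) eq ⟩
      N.⟦ N.normalise (pos f N.⊕ neg e) ⟧⇓ ρ ≈⟨ N.correct (pos f N.⊕ neg e) ρ ⟩
      N.⟦ pos f N.⊕ neg e ⟧ ρ               ∎

-- Cosets and finite index

module Subgroups {ℓ : Level} (em : ∀ {p} → ExcludedMiddle p) (G : AbelianGroup ℓ ℓ) where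
  open AbelianGroup G
  open IsSubgroup
  open FiniteCovers em
  open AbelianGroupSolver G using (solve; #_; _⊕_; _⊖_; ⊝_)

  FiniteMod : ∀ {k} → Pred Carrier k → Pred Carrier ℓ → Set (ℓ Level.⊔ k)
  FiniteMod K H = FiniteUpTo (λ x y → x - y ∈ H) K

  module _ {H : Pred Carrier ℓ} (H≤G : IsSubgroup G H) where

    -‿closed : ∀ {x y} → x ∈ H → y ∈ H → x - y ∈ H
    -‿closed x∈H y∈H = ∙-closed H≤G x∈H (⁻¹-closed H≤G y∈H)

    -‿flip : ∀ {x y} → x - y ∈ H → y - x ∈ H
    -‿flip {x} {y} h = respects H≤G
      (solve (x ∷ y ∷ []) (⊝ (# zero ⊖ # suc zero)) (# suc zero ⊖ # zero) ≡.refl)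
      (⁻¹-closed H≤G h)

    -‿trans : ∀ {x y z} → x - y ∈ H → y - z ∈ H → x - z ∈ H
    -‿trans {x} {y} {z} h k = respects H≤G
      (solve (x ∷ y ∷ z ∷ []) ((# zero ⊖ # suc zero) ⊕ (# suc zero ⊖ # suc (suc zero)))
             (# zero ⊖ # suc (suc zero)) ≡.refl)
      (∙-closed H≤G h k)

    -‿refl : ∀ {x y} → x ≈ y → x - y ∈ H
    -‿refl {x} {y} e = respects H≤G (trans (sym (inverseʳ y)) (∙-congʳ (sym e))) (ε-closed H≤G)

    -‿member : ∀ {x y} → x - y ∈ H → y ∈ H → x ∈ H
    -‿member {x} {y} h k = respects H≤G
      (solve (x ∷ y ∷ []) ((# zero ⊖ # suc zero) ⊕ # suc zero) (# zero) ≡.refl)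
      (∙-closed H≤G h k)

  ∩-isSubgroup : ∀ {H K : Pred Carrier ℓ} → IsSubgroup G H → IsSubgroup G K → IsSubgroup G (H ∩ K)
  ∩-isSubgroup H K = record
    { respects  = λ e (p , q) → respects H e p , respects K e q
    ; ε-closed  = ε-closed H , ε-closed K
    ; ∙-closed  = λ (p , q) (p′ , q′) → ∙-closed H p p′ , ∙-closed K q q′
    ; ⁻¹-closed = λ (p , q) → ⁻¹-closed H p , ⁻¹-closed K q
    }

  FiniteMod-mono : ∀ {k} {K : Pred Carrier k} {H H′ : Pred Carrier ℓ} →
                   H ⊆ H′ → FiniteMod K H → FiniteMod K H′
  FiniteMod-mono H⊆H′ (xs , xs∈K , cover) = xs , xs∈K , λ x∈K → Any.map H⊆H′ (cover x∈K)

  module _ {k k′ : Level} {K : Pred Carrier k} {K′ : Pred Carrier k′} {H : Pred Carrier ℓ} where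

    -- The representatives for `K′` may lie outside `K`, so new ones have to be chosen in those
    -- cosets of `H` that meet `K`.
    FiniteMod-sub : IsSubgroup G H → K ⊆ K′ → FiniteMod K′ H → FiniteMod K H
    FiniteMod-sub H≤G K⊆K′ fin = FiniteUpTo-transfer _≡_ fin (λ x∈K → _ , K⊆K′ x∈K , ≡.refl)
      λ where _ _ _ _ _ ≡.refl ≡.refl h h′ → -‿trans H≤G h (-‿flip H≤G h′)

  FiniteMod-∩ : ∀ {k} {K : Pred Carrier k} {H H′ : Pred Carrier ℓ} →
                IsSubgroup G H → IsSubgroup G H′ →
                FiniteMod K H → FiniteMod K H′ → FiniteMod K (H ∩ H′)
  FiniteMod-∩ {H = H} H≤G H′≤G (xs , xs∈K , cover) fin =
    FiniteUpTo-refine (λ x z → x - z ∈ H) xs xs∈K cover λ _ →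
      FiniteUpTo-transfer _≡_ fin (λ (x∈K , _) → _ , x∈K , ≡.refl)
        λ where (_ , h) (_ , h′) _ _ _ ≡.refl ≡.refl k k′ →
                  -‿trans H≤G h (-‿flip H≤G h′) , -‿trans H′≤G k (-‿flip H′≤G k′)

module Preimages {ℓ : Level} (em : ∀ {p} → ExcludedMiddle p) (G G′ : AbelianGroup ℓ ℓ) where
  private
    module G = AbelianGroup G
    module G′ = AbelianGroup G′
    module S = Subgroups em G
    module S′ = Subgroups em G′
  open FiniteCovers em

  -- Instead of additivity of `θ`, only reflection of congruence on `K` is assumed: `θ` may be a
  -- homomorphism on `K` only, and only modulo `H′`.
  FiniteMod-preimage :
    ∀ {k k′} {K : Pred G.Carrier k} {K′ : Pred G′.Carrier k′}
    {H : Pred G.Carrier ℓ} {H′ : Pred G′.Carrier ℓ} → IsSubgroup G′ H′ →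
    (θ : G.Carrier → G′.Carrier) → (∀ {x} → x ∈ K → θ x ∈ K′) →
    (∀ {x y} → x ∈ K → y ∈ K → θ x G′.- θ y ∈ H′ → x G.- y ∈ H) →
    S′.FiniteMod K′ H′ → S.FiniteMod K H
  FiniteMod-preimage H′≤G′ θ maps reflect fin =
    FiniteUpTo-transfer (λ x y → θ x ≡ y) fin (λ x∈K → _ , maps x∈K , ≡.refl)
      λ where x∈K y∈K _ _ _ ≡.refl ≡.refl h h′ → reflect x∈K y∈K (S′.-‿trans H′≤G′ h (S′.-‿flip H′≤G′ h′))

-- Renaming of variables and definable sets of tuples

to : ∀ {a b} {A : Set a} {B : Set b} → A ⇔ B → A → B
to = Equivalence.to

from : ∀ {a b} {A : Set a} {B : Set b} → A ⇔ B → B → A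
from = Equivalence.from

copair : ∀ {a m k} {A : Set a} → (Fin m → A) → (Fin k → A) → Fin (m ℕ.+ k) → A
copair {m = m} σ τ i = [ σ , τ ]′ (splitAt m i)

lookup-copair : ∀ {a m k n} {A : Set a} (v : Vec A m) (w : Vec A k) (u : Vec A n)
                (σ : Fin m → Fin n) (τ : Fin k → Fin n) →
                (∀ i → lookup u (σ i) ≡ lookup v i) → (∀ i → lookup u (τ i) ≡ lookup w i) →
                ∀ i → lookup u (copair σ τ i) ≡ lookup (v ++ w) i
lookup-copair []      w u σ τ p q i       = q i
lookup-copair (x ∷ v) w u σ τ p q zero    = p zero
lookup-copair {m = ℕ.suc m} (x ∷ v) w u σ τ p q (suc i) with splitAt m i | lookup-copair v w u (σ ∘ suc) τ (p ∘ suc) q i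
... | inj₁ _ | e = e
... | inj₂ _ | e = e

module Renaming {ℓ : Level} {𝓛 : Signature ℓ} where

  private
    variable
      k m n : ℕ

  mutual
    renameᵗ : (Fin m → Fin n) → Term 𝓛 m → Term 𝓛 n
    renameᵗ σ (var i)    = var (σ i)
    renameᵗ σ (app f ts) = app f (renameᵗˢ σ ts)

    renameᵗˢ : (Fin m → Fin n) → Vec (Term 𝓛 m) k → Vec (Term 𝓛 n) k
    renameᵗˢ σ []       = []
    renameᵗˢ σ (t ∷ ts) = renameᵗ σ t ∷ renameᵗˢ σ ts

  under : (Fin m → Fin n) → Fin (ℕ.suc m) → Fin (ℕ.suc n)
  under σ zero    = zero
  under σ (suc i) = suc (σ i)

  rename : (Fin m → Fin n) → Formula 𝓛 m → Formula 𝓛 n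
  rename σ (s ≐ t)    = renameᵗ σ s ≐ renameᵗ σ t
  rename σ (rel R ts) = rel R (renameᵗˢ σ ts)
  rename σ false      = false
  rename σ (φ ∧ ψ)    = rename σ φ ∧ rename σ ψ
  rename σ (φ ∨ ψ)    = rename σ φ ∨ rename σ ψ
  rename σ (φ ⟶ ψ)    = rename σ φ ⟶ rename σ ψ
  rename σ (all φ)    = all (rename (under σ) φ)
  rename σ (ex φ)     = ex (rename (under σ) φ)

  module _ (M : Structure 𝓛) where

    Matches : (Fin m → Fin n) → Vec ∣ M ∣ m → Vec ∣ M ∣ n → Set ℓ
    Matches σ v w = ∀ i → lookup w (σ i) ≡ lookup v i

    mutual
      eval-rename : ∀ {σ : Fin m → Fin n} {v w} → Matches σ v w →
                    ∀ t → eval M w (renameᵗ σ t) ≡ eval M v t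
      eval-rename e (var i)    = e i
      eval-rename e (app f ts) = ≡.cong (Structure.fun M f) (evals-rename e ts)

      evals-rename : ∀ {σ : Fin m → Fin n} {v w} → Matches σ v w →
                     (ts : Vec (Term 𝓛 m) k) → evals M w (renameᵗˢ σ ts) ≡ evals M v ts
      evals-rename e []       = ≡.refl
      evals-rename e (t ∷ ts) = ≡.cong₂ _∷_ (eval-rename e t) (evals-rename e ts)

    matches-under : ∀ {σ : Fin m → Fin n} {v w} → Matches σ v w → ∀ x → Matches (under σ) (x ∷ v) (x ∷ w)
    matches-under e x zero    = ≡.refl
    matches-under e x (suc i) = e i

    Sat-rename : ∀ {σ : Fin m → Fin n} {v w} → Matches σ v w →
                 ∀ φ → Sat M φ v ⇔ Sat M (rename σ φ) w
    Sat-rename e (s ≐ t) = mk⇔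
      (λ p → ≡.trans (eval-rename e s) (≡.trans p (≡.sym (eval-rename e t))))
      (λ p → ≡.trans (≡.sym (eval-rename e s)) (≡.trans p (eval-rename e t)))
    Sat-rename e (rel R ts) = mk⇔
      (≡.subst (Structure.holds M R) (≡.sym (evals-rename e ts)))
      (≡.subst (Structure.holds M R) (evals-rename e ts))
    Sat-rename e false = mk⇔ id id
    Sat-rename e (φ ∧ ψ) = let f = Sat-rename e φ ; g = Sat-rename e ψ in
      mk⇔ (λ (p , q) → to f p , to g q) (λ (p , q) → from f p , from g q)
    Sat-rename e (φ ∨ ψ) = let f = Sat-rename e φ ; g = Sat-rename e ψ in
      mk⇔ (Sum.map (to f) (to g)) (Sum.map (from f) (from g))
    Sat-rename e (φ ⟶ ψ) = let f = Sat-rename e φ ; g = Sat-rename e ψ in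
      mk⇔ (λ h → to g ∘ h ∘ from f) (λ h → from g ∘ h ∘ to f)
    Sat-rename e (all φ) =
      mk⇔ (λ h x → to (Sat-rename (matches-under e x) φ) (h x))
          (λ h x → from (Sat-rename (matches-under e x) φ) (h x))
    Sat-rename e (ex φ) =
      mk⇔ (λ (x , h) → x , to (Sat-rename (matches-under e x) φ) h)
          (λ (x , h) → x , from (Sat-rename (matches-under e x) φ) h)

module DefinableSets {ℓ : Level} {𝓛 : Signature ℓ} (M : Structure 𝓛) where
  open Renaming {𝓛 = 𝓛}

  private
    variable
      k m n : ℕ

  Holds : (D : Definable M n) → Vec ∣ M ∣ n → Set ℓ
  Holds D v = v ∈ ⟦ D ⟧

  private
    lookup-↑ˡ : (v : Vec ∣ M ∣ n) (w : Vec ∣ M ∣ k) → Matches M (_↑ˡ k) v (v ++ w)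
    lookup-↑ˡ = lookup-++ˡ

    lookup-↑ʳ : (v : Vec ∣ M ∣ n) (w : Vec ∣ M ∣ k) → Matches M (n ↑ʳ_) w (v ++ w)
    lookup-↑ʳ = lookup-++ʳ

  module _ (n k m : ℕ) where

    widenˡ : Formula 𝓛 (n ℕ.+ k) → Formula 𝓛 (n ℕ.+ (k ℕ.+ m))
    widenˡ = rename (copair (_↑ˡ (k ℕ.+ m)) (λ i → n ↑ʳ (i ↑ˡ m)))

    Sat-widenˡ : ∀ (φ : Formula 𝓛 (n ℕ.+ k)) (v : Vec ∣ M ∣ n) ps (qs : Vec ∣ M ∣ m) →
                 Sat M φ (v ++ ps) ⇔ Sat M (widenˡ φ) (v ++ (ps ++ qs))
    Sat-widenˡ φ v ps qs = Sat-rename M (lookup-copair v ps (v ++ (ps ++ qs)) _ _ (lookup-↑ˡ v (ps ++ qs))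
      λ i → ≡.trans (lookup-↑ʳ v (ps ++ qs) _) (lookup-↑ˡ ps qs i)) φ

    widenʳ : Formula 𝓛 (n ℕ.+ k) → Formula 𝓛 (n ℕ.+ (m ℕ.+ k))
    widenʳ = rename (copair (_↑ˡ (m ℕ.+ k)) (λ i → n ↑ʳ (m ↑ʳ i)))

    Sat-widenʳ : ∀ (φ : Formula 𝓛 (n ℕ.+ k)) (v : Vec ∣ M ∣ n) (qs : Vec ∣ M ∣ m) ps →
                 Sat M φ (v ++ ps) ⇔ Sat M (widenʳ φ) (v ++ (qs ++ ps))
    Sat-widenʳ φ v qs ps = Sat-rename M (lookup-copair v ps (v ++ (qs ++ ps)) _ _ (lookup-↑ˡ v (qs ++ ps))
      λ i → ≡.trans (lookup-↑ʳ v (qs ++ ps) _) (lookup-↑ʳ qs ps i)) φ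

  record Joint (D D′ : Definable M n) : Set ℓ where
    field
      {#params} : ℕ
      φ ψ       : Formula 𝓛 (n ℕ.+ #params)
      params    : Vec ∣ M ∣ #params
      left      : ∀ v → Holds D v ⇔ Sat M φ (v ++ params)
      right     : ∀ v → Holds D′ v ⇔ Sat M ψ (v ++ params)

  joint : (D D′ : Definable M n) → Joint D D′
  joint {n} (definable {k} φ ps) (definable {m} ψ qs) = record
    { φ      = widenˡ n k m φ
    ; ψ      = widenʳ n m k ψ
    ; params = ps ++ qs
    ; left   = λ v → Sat-widenˡ n k m φ v ps qs
    ; right  = λ v → Sat-widenʳ n m k ψ v ps qs
    }

  module _ (D D′ : Definable M n) where
    open Joint (joint D D′)

    IsDefinable-∧ : IsDefinable M (λ v → Holds D v × Holds D′ v)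
    IsDefinable-∧ = definable {#params = #params} (φ ∧ ψ) params , λ v →
      mk⇔ (λ (p , q) → to (left v) p , to (right v) q) (λ (p , q) → from (left v) p , from (right v) q)

    IsDefinable-∨ : IsDefinable M (λ v → Holds D v ⊎ Holds D′ v)
    IsDefinable-∨ = definable {#params = #params} (φ ∨ ψ) params , λ v →
      mk⇔ (Sum.map (to (left v)) (to (right v))) (Sum.map (from (left v)) (from (right v)))

    IsDefinable-⇒ : IsDefinable M (λ v → Holds D v → Holds D′ v)
    IsDefinable-⇒ = definable {#params = #params} (φ ⟶ ψ) params , λ v →
      mk⇔ (λ h p → to (right v) (h (from (left v) p))) (λ h p → from (right v) (h (to (left v) p)))

  IsDefinable-⊥ : IsDefinable M {n = n} (λ _ → Lift ℓ Empty.⊥)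
  IsDefinable-⊥ = definable {#params = 0} false [] , λ _ → mk⇔ (λ ()) λ where (lift ())

  private
    ex₁ all₁ : Definable M (ℕ.suc n) → Definable M n
    ex₁ {n} D = definable {n = n} {#params = Definable.#params D} (ex (Definable.formula D)) (Definable.params D)
    all₁ {n} D = definable {n = n} {#params = Definable.#params D} (all (Definable.formula D)) (Definable.params D)

    Holds-ex₁ : (D : Definable M (ℕ.suc n)) (v : Vec ∣ M ∣ n) → (∃[ x ] Holds D (x ∷ v)) ⇔ Holds (ex₁ D) v
    Holds-ex₁ D v = mk⇔ id id

    Holds-all₁ : (D : Definable M (ℕ.suc n)) (v : Vec ∣ M ∣ n) → (∀ x → Holds D (x ∷ v)) ⇔ Holds (all₁ D) v
    Holds-all₁ D v = mk⇔ id id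

  IsDefinable-∃ : ∀ m (D : Definable M (m ℕ.+ n)) → IsDefinable M (λ v → Σ[ w ∈ Vec ∣ M ∣ m ] Holds D (w ++ v))
  IsDefinable-∃ ℕ.zero D = D , λ _ → mk⇔ (λ where ([] , p) → p) ([] ,_)
  IsDefinable-∃ {n} (ℕ.suc m) D = proj₁ rec , λ v → mk⇔
    (λ where (x ∷ w , p) → to (proj₂ rec v) (w , to (Holds-ex₁ D (w ++ v)) (x , p)))
    (λ p → let w , q = from (proj₂ rec v) p
               x , r = from (Holds-ex₁ D (w ++ v)) q
           in x ∷ w , r)
    where
    rec : IsDefinable M (λ v → Σ[ w ∈ Vec ∣ M ∣ m ] Holds (ex₁ D) (w ++ v))
    rec = IsDefinable-∃ {n} m (ex₁ D)

  IsDefinable-∀ : ∀ m (D : Definable M (m ℕ.+ n)) → IsDefinable M (λ v → (w : Vec ∣ M ∣ m) → Holds D (w ++ v))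
  IsDefinable-∀ ℕ.zero D = D , λ _ → mk⇔ (λ p → p []) λ where p [] → p
  IsDefinable-∀ {n} (ℕ.suc m) D = proj₁ rec , λ v → mk⇔
    (λ h → to (proj₂ rec v) λ w → to (Holds-all₁ D (w ++ v)) λ x → h (x ∷ w))
    (λ where p (x ∷ w) → from (Holds-all₁ D (w ++ v)) (from (proj₂ rec v) p w) x)
    where
    rec : IsDefinable M (λ v → (w : Vec ∣ M ∣ m) → Holds (all₁ D) (w ++ v))
    rec = IsDefinable-∀ {n} m (all₁ D)

  pullback : (Fin m → Fin n) → Definable M m → Definable M n
  pullback {n = n} σ (definable {k} φ ps) =
    definable {#params = k} (rename (copair (λ i → σ i ↑ˡ k) (n ↑ʳ_)) φ) ps

  Holds-pullback : ∀ {σ : Fin m → Fin n} (D : Definable M m) {v w} → Matches M σ v w →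
                   Holds D v ⇔ Holds (pullback σ D) w
  Holds-pullback {σ = σ} (definable {k} φ ps) {v} {w} e = Sat-rename M
    (lookup-copair v ps (w ++ ps) _ _ (λ i → ≡.trans (lookup-↑ˡ w ps (σ i)) (e i)) (lookup-↑ʳ w ps)) φ

  IsDefinable-fix : ∀ m (D : Definable M (m ℕ.+ n)) (w : Vec ∣ M ∣ n) →
                    IsDefinable M (λ (v : Vec ∣ M ∣ m) → Holds D (v ++ w))
  IsDefinable-fix {n} m (definable {k} φ ps) w =
    definable {#params = n ℕ.+ k}
      (rename (copair (copair (_↑ˡ (n ℕ.+ k)) (λ i → m ↑ʳ (i ↑ˡ k))) (λ i → m ↑ʳ (n ↑ʳ i))) φ) (w ++ ps) ,
    λ v → let u = v ++ (w ++ ps) in Sat-rename M (lookup-copair (v ++ w) ps u _ _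
      (lookup-copair v w u _ _ (lookup-↑ˡ v (w ++ ps))
         λ i → ≡.trans (lookup-↑ʳ v (w ++ ps) (i ↑ˡ k)) (lookup-↑ˡ w ps i))
      λ i → ≡.trans (lookup-↑ʳ v (w ++ ps) (n ↑ʳ i)) (lookup-↑ʳ w ps i)) φ

  IsDefinable-≡ : ∀ m (σ τ : Fin m → Fin n) →
                  IsDefinable M (λ v → ∀ i → lookup v (σ i) ≡ lookup v (τ i))
  -- Formulas have no constant for truth; `false ⟶ false` stands in for it.
  IsDefinable-≡ ℕ.zero σ τ = definable {#params = 0} (false ⟶ false) [] , λ _ → mk⇔ (λ _ x → x) (λ _ ())
  IsDefinable-≡ {n} (ℕ.suc m) σ τ =
    let D , e = IsDefinable-≡ m (σ ∘ suc) (τ ∘ suc)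
        D′ , e′ = IsDefinable-∧ D₀ D
    in D′ , λ v →
      mk⇔ (λ h → to (e′ v) (≡.trans (l v _) (≡.trans (h zero) (≡.sym (l v _))) , to (e v) (h ∘ suc)))
          λ p → let q , r = from (e′ v) p in λ where
            zero    → ≡.trans (≡.sym (l v _)) (≡.trans q (l v _))
            (suc i) → from (e v) r i
    where
    D₀ : Definable M n
    D₀ = definable {#params = 0} (var (σ zero ↑ˡ 0) ≐ var (τ zero ↑ˡ 0)) []
    l : ∀ (v : Vec ∣ M ∣ n) i → lookup (v ++ []) (i ↑ˡ 0) ≡ lookup v i
    l v i = lookup-++ˡ v [] i

-- Definable predicates on the groups

-- A many-sorted language whose sorts are the given groups, the elements of
-- which are coded by tuples of M.
module Coordinates
  {ℓ : Level} {𝓛 : Signature ℓ} (M : Structure 𝓛) (Sort : Set) (group : Sort → AbelianGroup ℓ ℓ)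
  (arity : Sort → ℕ)
  (coord : ∀ s → Injection (AbelianGroup.setoid (group s)) (≡.setoid (Vec ∣ M ∣ (arity s))))
  (image : ∀ s → IsDefinable M (λ v → ∃[ x ] v ≡ Injection.to (coord s) x))
  where

  open DefinableSets M
  open Renaming {𝓛 = 𝓛} using (Matches)

  infixr 5 _⊗_

  data Code : Set where
    base : Sort → Code
    _⊗_  : Code → Code → Code

  El : Code → Set ℓ
  El (base s) = AbelianGroup.Carrier (group s)
  El (a ⊗ b)  = El a × El b

  size : Code → ℕ
  size (base s) = arity s
  size (a ⊗ b)  = size a ℕ.+ size b

  Eqᴱ : ∀ a → Rel (El a) ℓ
  Eqᴱ (base s) x y                 = AbelianGroup._≈_ (group s) x y
  Eqᴱ (a ⊗ b)  (x , x′) (y , y′) = Eqᴱ a x y × Eqᴱ b x′ y′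

  flat : ∀ a → El a → Vec ∣ M ∣ (size a)
  flat (base s) x       = Injection.to (coord s) x
  flat (a ⊗ b)  (x , y) = flat a x ++ flat b y

  flat-cong : ∀ a {x y} → Eqᴱ a x y → flat a x ≡ flat a y
  flat-cong (base s) e       = Injection.cong (coord s) e
  flat-cong (a ⊗ b)  (e , f) = ≡.cong₂ _++_ (flat-cong a e) (flat-cong b f)

  flat-injective : ∀ a {x y} → flat a x ≡ flat a y → Eqᴱ a x y
  flat-injective (base s) e = Injection.injective (coord s) e
  flat-injective (a ⊗ b) {x , _} {y , _} e =
    let p , q = ++-injective (flat a x) (flat a y) e in flat-injective a p , flat-injective b q

  Eqᴱ-refl : ∀ a {x} → Eqᴱ a x x
  Eqᴱ-refl a = flat-injective a ≡.refl

  Eqᴱ-sym : ∀ a {x y} → Eqᴱ a x y → Eqᴱ a y x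
  Eqᴱ-sym a e = flat-injective a (≡.sym (flat-cong a e))

  -- `set` is constrained on codes of elements only. Connectives thus need no relativisation; the
  -- image of the coding is imposed at quantifiers and on the domains of interpretable sets.
  record Def (a : Code) (P : Pred (El a) ℓ) : Set ℓ where
    constructor def
    field
      set    : Definable M (size a)
      member : ∀ x → P x ⇔ Holds set (flat a x)

  open Def

  image-definable : ∀ a → IsDefinable M (λ v → ∃[ x ] v ≡ flat a x)
  image-definable (base s) = image s
  image-definable (a ⊗ b) = proj₁ E , λ v → mk⇔
      (λ where
        ((x , y) , ≡.refl) → to (proj₂ E v)
          ( to (Holds-pullback D (lookup-++ˡ (flat a x) (flat b y))) (to (e _) (x , ≡.refl))
          , to (Holds-pullback D′ (lookup-++ʳ (flat a x) (flat b y))) (to (e′ _) (y , ≡.refl))))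
      (λ p → let q , q′ = from (proj₂ E v) p in halves v q q′)
    where
    D  = proj₁ (image-definable a)
    D′ = proj₁ (image-definable b)
    e  = proj₂ (image-definable a)
    e′ = proj₂ (image-definable b)
    E  = IsDefinable-∧ (pullback (_↑ˡ size b) D) (pullback (size a ↑ʳ_) D′)
    halves : ∀ v → Holds (pullback (_↑ˡ size b) D) v → Holds (pullback (size a ↑ʳ_) D′) v →
             ∃[ z ] v ≡ flat (a ⊗ b) z
    halves v q q′ with Vec.splitAt (size a) v
    ... | u , w , ≡.refl =
      let x , p = from (e u) (from (Holds-pullback D (lookup-++ˡ u w)) q)
          y , p′ = from (e′ w) (from (Holds-pullback D′ (lookup-++ʳ u w)) q′)
      in (x , y) , ≡.cong₂ _++_ p p′

  private
    variable
      a b c Γ : Code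

  Def-respects : ∀ {a} {P : Pred (El a) ℓ} → Def a P → ∀ {x y} → Eqᴱ a x y → P x → P y
  Def-respects {a} D {x} {y} x≈y p =
    from (member D y) (≡.subst (Holds (set D)) (flat-cong a x≈y) (to (member D x) p))

  abstract
    Def-⇔ : ∀ {a} {P Q : Pred (El a) ℓ} → (∀ x → P x ⇔ Q x) → Def a P → Def a Q
    Def-⇔ h D .set = set D
    Def-⇔ h D .member x = mk⇔ (λ q → to (member D x) (from (h x) q)) (λ q → to (h x) (from (member D x) q))

  infixr 3 _∧ᴰ_
  infixr 2 _∨ᴰ_
  infixr 1 _⇒ᴰ_

  abstract
    _∧ᴰ_ : ∀ {a} {P Q : Pred (El a) ℓ} → Def a P → Def a Q → Def a (λ x → P x × Q x)
    D ∧ᴰ D′ = def (proj₁ E) λ x → mk⇔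
      (λ (p , q) → to (proj₂ E _) (to (member D x) p , to (member D′ x) q))
      (λ p → let q , r = from (proj₂ E _) p in from (member D x) q , from (member D′ x) r)
      where
      E : IsDefinable M (λ v → Holds (set D) v × Holds (set D′) v)
      E = IsDefinable-∧ (set D) (set D′)

    _∨ᴰ_ : ∀ {a} {P Q : Pred (El a) ℓ} → Def a P → Def a Q → Def a (λ x → P x ⊎ Q x)
    D ∨ᴰ D′ = def (proj₁ E) λ x → mk⇔
      (λ p → to (proj₂ E _) (Sum.map (to (member D x)) (to (member D′ x)) p))
      (λ p → Sum.map (from (member D x)) (from (member D′ x)) (from (proj₂ E _) p))
      where
      E : IsDefinable M (λ v → Holds (set D) v ⊎ Holds (set D′) v)
      E = IsDefinable-∨ (set D) (set D′)

    _⇒ᴰ_ : ∀ {a} {P Q : Pred (El a) ℓ} → Def a P → Def a Q → Def a (λ x → P x → Q x)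
    D ⇒ᴰ D′ = def (proj₁ E) λ x → mk⇔
      (λ h → to (proj₂ E _) λ p → to (member D′ x) (h (from (member D x) p)))
      (λ h p → from (member D′ x) (from (proj₂ E _) h (to (member D x) p)))
      where
      E : IsDefinable M (λ v → Holds (set D) v → Holds (set D′) v)
      E = IsDefinable-⇒ (set D) (set D′)

    ⊥ᴰ : Def a (λ _ → Lift ℓ Empty.⊥)
    ⊥ᴰ {a} = def (proj₁ (IsDefinable-⊥ {size a})) λ x → proj₂ (IsDefinable-⊥ {size a}) (flat a x)

    ¬ᴰ_ : ∀ {a} {P : Pred (El a) ℓ} → Def a P → Def a (λ x → ¬ P x)
    ¬ᴰ D = Def-⇔ (λ _ → mk⇔ (λ h p → lower (h p)) (λ h p → lift (h p))) (D ⇒ᴰ ⊥ᴰ)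

    ∃ᴰ : ∀ {a Γ} {P : Pred (El (a ⊗ Γ)) ℓ} → Def (a ⊗ Γ) P → Def Γ (λ ρ → ∃[ x ] P (x , ρ))
    ∃ᴰ {a} {Γ} {P} D = def (proj₁ F) λ ρ → mk⇔
        (λ (x , p) → to (proj₂ F _) (flat a x , to (proj₂ E _)
          (to (Holds-pullback (proj₁ I) (lookup-++ˡ (flat a x) (flat Γ ρ))) (to (proj₂ I _) (x , ≡.refl)) , to (member D (x , ρ)) p)))
        (λ p → let v , q = from (proj₂ F _) p
                   r , s = from (proj₂ E (v ++ flat Γ ρ)) q
                   x , h = from (proj₂ I v) (from (Holds-pullback (proj₁ I) {v} {v ++ flat Γ ρ} (lookup-++ˡ v (flat Γ ρ))) r)
               in x , from (member D (x , ρ)) (≡.subst (λ w → Holds (set D) (w ++ flat Γ ρ)) h s))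
      where
      I : IsDefinable M (λ v → ∃[ x ] v ≡ flat a x)
      I = image-definable a
      E : IsDefinable M (λ v → Holds (pullback (_↑ˡ size Γ) (proj₁ I)) v × Holds (set D) v)
      E = IsDefinable-∧ (pullback (_↑ˡ size Γ) (proj₁ I)) (set D)
      F : IsDefinable M (λ v → Σ[ w ∈ Vec ∣ M ∣ (size a) ] Holds (proj₁ E) (w ++ v))
      F = IsDefinable-∃ {size Γ} (size a) (proj₁ E)

    ∀ᴰ : ∀ {a Γ} {P : Pred (El (a ⊗ Γ)) ℓ} → Def (a ⊗ Γ) P → Def Γ (λ ρ → ∀ x → P (x , ρ))
    ∀ᴰ {a} {Γ} {P} D = def (proj₁ F) λ ρ → mk⇔
        (λ h → to (proj₂ F _) λ v → to (proj₂ E (v ++ flat Γ ρ)) λ q →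
           let x , eq = from (proj₂ I v) (from (Holds-pullback (proj₁ I) {v} {v ++ flat Γ ρ} (lookup-++ˡ v (flat Γ ρ))) q)
           in ≡.subst (λ w → Holds (set D) (w ++ flat Γ ρ)) (≡.sym eq) (to (member D (x , ρ)) (h x)))
        (λ p x → from (member D (x , ρ)) (from (proj₂ E _) (from (proj₂ F _) p (flat a x))
           (to (Holds-pullback (proj₁ I) (lookup-++ˡ (flat a x) (flat Γ ρ))) (to (proj₂ I _) (x , ≡.refl)))))
      where
      I : IsDefinable M (λ v → ∃[ x ] v ≡ flat a x)
      I = image-definable a
      E : IsDefinable M (λ v → Holds (pullback (_↑ˡ size Γ) (proj₁ I)) v → Holds (set D) v)
      E = IsDefinable-⇒ (pullback (_↑ˡ size Γ) (proj₁ I)) (set D)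
      F : IsDefinable M (λ v → (w : Vec ∣ M ∣ (size a)) → Holds (proj₁ E) (w ++ v))
      F = IsDefinable-∀ {size Γ} (size a) (proj₁ E)

    fixᴰ : ∀ {a b} {P : Pred (El (a ⊗ b)) ℓ} → Def (a ⊗ b) P → ∀ y → Def a (λ x → P (x , y))
    fixᴰ {a} {b} D y = def (proj₁ E) λ x → mk⇔
        (λ p → to (proj₂ E _) (to (member D (x , y)) p)) (λ p → from (member D (x , y)) (from (proj₂ E _) p))
      where
      E : IsDefinable M (λ (v : Vec ∣ M ∣ (size a)) → Holds (set D) (v ++ flat b y))
      E = IsDefinable-fix (size a) (set D) (flat b y)

  -- Maps that merely select coordinates act on formulas by renaming variables. General definable
  -- maps have to go through their graphs, at the price of a quantifier.
  record Projection (Γ a : Code) : Set ℓ where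
    field
      map     : El Γ → El a
      indices : Fin (size a) → Fin (size Γ)
      matches : ∀ ρ → Matches M indices (flat a (map ρ)) (flat Γ ρ)

  open Projection

  idᴾ : Projection Γ Γ
  idᴾ = record { map = id ; indices = id ; matches = λ _ _ → ≡.refl }

  fstᴾ : Projection Γ (a ⊗ b) → Projection Γ a
  fstᴾ {Γ} {a} {b} π = record
    { map     = λ ρ → proj₁ (map π ρ)
    ; indices = λ i → indices π (i ↑ˡ size b)
    ; matches = λ ρ i → ≡.trans (matches π ρ _) (lookup-++ˡ (flat a (proj₁ (map π ρ))) (flat b (proj₂ (map π ρ))) i)
    }

  sndᴾ : Projection Γ (a ⊗ b) → Projection Γ b
  sndᴾ {Γ} {a} {b} π = record
    { map     = λ ρ → proj₂ (map π ρ)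
    ; indices = λ i → indices π (size a ↑ʳ i)
    ; matches = λ ρ i → ≡.trans (matches π ρ _) (lookup-++ʳ (flat a (proj₁ (map π ρ))) (flat b (proj₂ (map π ρ))) i)
    }

  ⟨_,_⟩ᴾ : Projection Γ a → Projection Γ b → Projection Γ (a ⊗ b)
  ⟨_,_⟩ᴾ {Γ} {a} {b} π π′ = record
    { map     = λ ρ → map π ρ , map π′ ρ
    ; indices = copair (indices π) (indices π′)
    ; matches = λ ρ → lookup-copair (flat a (map π ρ)) (flat b (map π′ ρ)) (flat Γ ρ) _ _ (matches π ρ) (matches π′ ρ)
    }

  abstract
    projectᴰ : ∀ {a Γ} {P : Pred (El a) ℓ} (π : Projection Γ a) → Def a P → Def Γ (λ ρ → P (map π ρ))
    projectᴰ π D = def (pullback (indices π) (set D)) λ ρ → mk⇔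
      (λ p → to (Holds-pullback (set D) (matches π ρ)) (to (member D _) p))
      (λ p → from (member D _) (from (Holds-pullback (set D) (matches π ρ)) p))

    eqᴰ : Def (a ⊗ a) (λ (x , y) → Eqᴱ a x y)
    eqᴰ {a} = def (proj₁ E) λ (x , y) → mk⇔
        (λ p → to (proj₂ E _) λ i → ≡.trans (lookup-++ˡ (flat a x) (flat a y) i)
           (≡.trans (≡.cong (λ v → lookup v i) (flat-cong a p)) (≡.sym (lookup-++ʳ (flat a x) (flat a y) i))))
        (λ p → flat-injective a (ext (flat a x) (flat a y) λ i →
           ≡.trans (≡.sym (lookup-++ˡ (flat a x) (flat a y) i)) (≡.trans (from (proj₂ E _) p i) (lookup-++ʳ (flat a x) (flat a y) i))))
      where
      E : IsDefinable M (λ v → ∀ i → lookup v (i ↑ˡ size a) ≡ lookup v (size a ↑ʳ i))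
      E = IsDefinable-≡ (size a) (_↑ˡ size a) (size a ↑ʳ_)
      ext : ∀ {n} (v w : Vec ∣ M ∣ n) → (∀ i → lookup v i ≡ lookup w i) → v ≡ w
      ext []      []      h = ≡.refl
      ext (x ∷ v) (y ∷ w) h = ≡.cong₂ _∷_ (h zero) (ext v w (h ∘ suc))

  -- Definable maps serve as the terms of the language.
  Graph : (a b : Code) → (El a → El b) → Set ℓ
  Graph a b f = Def (b ⊗ a) (λ (y , x) → Eqᴱ b (f x) y)

  record Tm (Γ a : Code) : Set ℓ where
    constructor tm
    field
      val   : El Γ → El a
      graph : Graph Γ a val

  open Tm public

  atᴰ : ∀ {a Γ} {P : Pred (El a) ℓ} → Def a P → (t : Tm Γ a) → Def Γ (λ ρ → P (val t ρ))
  atᴰ {a} {Γ} D t = Def-⇔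
    (λ ρ → mk⇔ (λ (y , p , q) → Def-respects D (Eqᴱ-sym a p) q) (λ p → _ , Eqᴱ-refl a , p))
    (∃ᴰ (graph t ∧ᴰ projectᴰ (fstᴾ idᴾ) D))

  projection : Projection Γ a → Tm Γ a
  projection {Γ} {a} π = tm (map π) (projectᴰ ⟨ comp , fstᴾ idᴾ ⟩ᴾ eqᴰ)
    where
    comp : Projection (a ⊗ Γ) a
    comp = record
      { map     = λ (_ , ρ) → map π ρ
      ; indices = λ i → size a ↑ʳ indices π i
      ; matches = λ (y , ρ) i → ≡.trans (lookup-++ʳ (flat a y) (flat Γ ρ) _) (matches π ρ i)
      }

  constᵗ : El a → Tm Γ a
  constᵗ {a} x = tm (λ _ → x) (projectᴰ (fstᴾ idᴾ)
    (Def-⇔ (λ _ → mk⇔ (Eqᴱ-sym a) (Eqᴱ-sym a)) (fixᴰ eqᴰ x)))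

  ⟨_,_⟩ᵗ : Tm Γ a → Tm Γ b → Tm Γ (a ⊗ b)
  ⟨ t , u ⟩ᵗ = tm (λ ρ → val t ρ , val u ρ)
    ( projectᴰ ⟨ fstᴾ (fstᴾ idᴾ) , sndᴾ idᴾ ⟩ᴾ (graph t)
    ∧ᴰ projectᴰ ⟨ sndᴾ (fstᴾ idᴾ) , sndᴾ idᴾ ⟩ᴾ (graph u))

  mapᵗ : ∀ {a b Γ} {f : El a → El b} → Graph a b f → Tm Γ a → Tm Γ b
  mapᵗ {a} {b} {Γ} {f} g t = tm (λ ρ → f (val t ρ)) (Def-⇔
    (λ (z , ρ) → mk⇔ (λ (x , p , q) → Def-respects g (Eqᴱ-refl b , Eqᴱ-sym a p) q)
                     (λ p → _ , Eqᴱ-refl a , p))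
    (∃ᴰ ( projectᴰ ⟨ fstᴾ idᴾ , sndᴾ (sndᴾ idᴾ) ⟩ᴾ (graph t)
        ∧ᴰ projectᴰ ⟨ fstᴾ (sndᴾ idᴾ) , fstᴾ idᴾ ⟩ᴾ g)))

  weaken : Tm Γ a → Tm (b ⊗ Γ) a
  weaken t = tm (λ (_ , ρ) → val t ρ) (projectᴰ ⟨ fstᴾ idᴾ , sndᴾ (sndᴾ idᴾ) ⟩ᴾ (graph t))

  infix 4 _≈ᴰ_

  _≈ᴰ_ : (t u : Tm Γ a) → Def Γ (λ ρ → Eqᴱ a (val t ρ) (val u ρ))
  t ≈ᴰ u = atᴰ eqᴰ ⟨ t , u ⟩ᵗ

  opᴳ : (f : El a → El b → El c) →
        (∀ {x x′ y y′} → Eqᴱ a x x′ → Eqᴱ b y y′ → Eqᴱ c (f x y) (f x′ y′)) →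
        IsDefinable M (λ v → ∃₂ λ x y → v ≡ (flat a x ++ flat b y) ++ flat c (f x y)) →
        Graph (a ⊗ b) c (λ (x , y) → f x y)
  opᴳ {a} {b} {c} f f-cong (D , e) = projectᴰ ⟨ sndᴾ idᴾ , fstᴾ idᴾ ⟩ᴾ graphᴰ
    where
    graphᴰ : Def ((a ⊗ b) ⊗ c) (λ ((x , y) , z) → Eqᴱ c (f x y) z)
    graphᴰ = def D λ ((x , y) , z) → mk⇔
      (λ p → to (e _) (x , y , ≡.cong ((flat a x ++ flat b y) ++_) (≡.sym (flat-cong c p))))
      (λ p → let x′ , y′ , q = from (e _) p
                 q₁ , q₂ = ++-injective (flat a x ++ flat b y) (flat a x′ ++ flat b y′) q
                 r₁ , r₂ = ++-injective (flat a x) (flat a x′) q₁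
             in flat-injective c (≡.trans (flat-cong c (f-cong (flat-injective a r₁) (flat-injective b r₂))) (≡.sym q₂)))

-- Dimension of definable quotients

module Dimensions
  {ℓ : Level} {𝓛 : Signature ℓ} {T : Theory 𝓛} (em : ∀ {p} → ExcludedMiddle p)
  (FD : FiniteDimensional T) (M : Model T) (Sort : Set) (group : Sort → AbelianGroup ℓ ℓ)
  (arity : Sort → ℕ)
  (coord : ∀ s → Injection (AbelianGroup.setoid (group s)) (≡.setoid (Vec ∣ Model.structure M ∣ (arity s))))
  (image : ∀ s → IsDefinable (Model.structure M) (λ v → ∃[ x ] v ≡ Injection.to (coord s) x))
  where

  private
    𝑴 : Structure 𝓛
    𝑴 = Model.structure M

  open FiniteDimensional FD
  open DefinableSets 𝑴
  open Coordinates 𝑴 Sort group arity coord image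
  open FiniteCovers em
  open Def using (set)

  record DSet (code : Code) : Set (Level.suc ℓ) where
    field
      Mem     : Pred (El code) ℓ
      _~_     : Rel (El code) ℓ
      memᴰ    : Def code Mem
      ~ᴰ      : Def (code ⊗ code) (λ (x , y) → x ~ y)
      ~-refl  : ∀ {x} → x ∈ Mem → x ~ x
      ~-sym   : ∀ {x y} → x ∈ Mem → y ∈ Mem → x ~ y → y ~ x
      ~-trans : ∀ {x y z} → x ∈ Mem → y ∈ Mem → z ∈ Mem → x ~ y → y ~ z → x ~ z

    Finite : Set ℓ
    Finite = FiniteUpTo _~_ Mem

    Inhabited : Set ℓ
    Inhabited = Satisfiable Mem

  open DSet using (Mem; Finite; Inhabited; memᴰ; ~ᴰ; ~-refl; ~-sym; ~-trans)

  private
    variable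
      a b c : Code

  infix 4 _∋_~_

  _∋_~_ : (X : DSet a) → Rel (El a) ℓ
  X ∋ x ~ y = DSet._~_ X x y

  module Interpretation {a : Code} (X : DSet a) where
    private
      module X = DSet X
      width = size a
      dom = IsDefinable-∧ (proj₁ (image-definable a)) (set X.memᴰ)
      D = proj₁ dom
      E = set X.~ᴰ
      #D = Definable.#params D
      #E = Definable.#params E

      scheme : Scheme 𝓛 width (#D ℕ.+ #E)
      scheme = record
        { domain   = widenˡ width #D #E (Definable.formula D)
        ; relation = widenʳ (width ℕ.+ width) #E #D (Definable.formula E)
        }

      params : Vec ∣ 𝑴 ∣ (#D ℕ.+ #E)
      params = Definable.params D ++ Definable.params E

    ⌜_⌝ : El a → Vec ∣ 𝑴 ∣ width
    ⌜_⌝ = flat a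

    private
      isDom₀ : ∀ {x} → x ∈ X.Mem → ⌜ x ⌝ ∈ Dom[_,_] 𝑴 scheme params
      isDom₀ {x} p = to (Sat-widenˡ width #D #E (Definable.formula D) ⌜ x ⌝ _ (Definable.params E))
        (to (proj₂ dom ⌜ x ⌝) (to (proj₂ (image-definable a) _) (x , ≡.refl) , to (Def.member X.memᴰ x) p))

      fromDom₀ : ∀ v → v ∈ Dom[_,_] 𝑴 scheme params → ∃[ x ] x ∈ X.Mem × v ≡ ⌜ x ⌝
      fromDom₀ v p with from (proj₂ dom v) (from (Sat-widenˡ width #D #E (Definable.formula D) v _ (Definable.params E)) p)
      ... | q , r with from (proj₂ (image-definable a) v) q
      ... | x , ≡.refl = x , from (Def.member X.memᴰ x) r , ≡.refl

      isEq₀ : ∀ x y → (X ∋ x ~ y) ⇔ Eq[_,_] 𝑴 scheme params ⌜ x ⌝ ⌜ y ⌝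
      isEq₀ x y = mk⇔
        (λ p → to (Sat-widenʳ (width ℕ.+ width) #E #D (Definable.formula E) (⌜ x ⌝ ++ ⌜ y ⌝) (Definable.params D) _) (to (Def.member X.~ᴰ (x , y)) p))
        (λ p → from (Def.member X.~ᴰ (x , y)) (from (Sat-widenʳ (width ℕ.+ width) #E #D (Definable.formula E) (⌜ x ⌝ ++ ⌜ y ⌝) (Definable.params D) _) p))

      interp₀ : Interpretable 𝑴 width
      interp₀ = interpretable scheme params record
        { refl  = λ {(v , p)} → reflexive (fromDom₀ v p)
        ; sym   = λ {(v , p)} {(w , q)} → symmetric (fromDom₀ v p) (fromDom₀ w q)
        ; trans = λ {(v , p)} {(w , q)} {(u , r)} → transitive (fromDom₀ v p) (fromDom₀ w q) (fromDom₀ u r)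
        }
        where
        _≈_ : Rel (Vec ∣ 𝑴 ∣ width) ℓ
        _≈_ = Eq[_,_] 𝑴 scheme params
        reflexive : ∀ {v} → (∃[ x ] x ∈ X.Mem × v ≡ ⌜ x ⌝) → v ≈ v
        reflexive (x , p , ≡.refl) = to (isEq₀ x x) (X.~-refl p)
        symmetric : ∀ {v w} → (∃[ x ] x ∈ X.Mem × v ≡ ⌜ x ⌝) → (∃[ x ] x ∈ X.Mem × w ≡ ⌜ x ⌝) → v ≈ w → w ≈ v
        symmetric (x , p , ≡.refl) (y , q , ≡.refl) e = to (isEq₀ y x) (X.~-sym p q (from (isEq₀ x y) e))
        transitive : ∀ {v w u} → (∃[ x ] x ∈ X.Mem × v ≡ ⌜ x ⌝) → (∃[ x ] x ∈ X.Mem × w ≡ ⌜ x ⌝) →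
                     (∃[ x ] x ∈ X.Mem × u ≡ ⌜ x ⌝) → v ≈ w → w ≈ u → v ≈ u
        transitive (x , p , ≡.refl) (y , q , ≡.refl) (z , r , ≡.refl) e f =
          to (isEq₀ x z) (X.~-trans p q r (from (isEq₀ x y) e) (from (isEq₀ y z) f))

    -- Opaque, so that unification does not unfold satisfaction.
    abstract
      interp : Interpretable 𝑴 width
      interp = interp₀

      isDom : ∀ {x} → x ∈ X.Mem → ⌜ x ⌝ ∈ Interpretable.Dom interp
      isDom = isDom₀

      fromDom : ∀ v → v ∈ Interpretable.Dom interp → ∃[ x ] x ∈ X.Mem × v ≡ ⌜ x ⌝
      fromDom = fromDom₀

      isEq : ∀ x y → (X ∋ x ~ y) ⇔ Interpretable.Eq interp ⌜ x ⌝ ⌜ y ⌝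
      isEq = isEq₀

    IsFinite⇔Finite : IsFinite interp ⇔ X.Finite
    IsFinite⇔Finite = mk⇔
      (λ fin → FiniteUpTo-transfer (λ x v → v ≡ ⌜ x ⌝) fin (λ p → _ , isDom p , ≡.refl)
        λ { {x} {x′} {z = v} p q _ _ r ≡.refl ≡.refl e f → let z , s , h = fromDom v r in
            X.~-trans p s q (from (isEq x z) (≡.subst (Interpretable.Eq interp ⌜ x ⌝) h e))
              (X.~-sym q s (from (isEq x′ z) (≡.subst (Interpretable.Eq interp ⌜ x′ ⌝) h f))) })
      (λ fin → FiniteUpTo-transfer (λ v x → v ≡ ⌜ x ⌝) fin (λ {v} p → fromDom v p)
        λ where _ _ p q r ≡.refl ≡.refl e f → to (isEq _ _) (X.~-trans p r q e (X.~-sym q r f)))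

  open Interpretation

  dimᴰ : DSet a → Dimension
  dimᴰ X = dim M (interp X)

  max-idem : ∀ d → max d d ≡ d
  max-idem ⊥₋    = ≡.refl
  max-idem [ n ] = ≡.cong [_] (ℕ.⊔-idem n)

  dim-ext : ∀ {n} {X Y : Interpretable 𝑴 n} → X ⊑ Y →
            (∀ {v} → v ∈ Interpretable.Dom Y → v ∈ Interpretable.Dom X) → dim M Y ≡ dim M X
  dim-ext {X = X} {Y} X⊑Y Y⊆X = ≡.trans
    (union M X X Y record { left = X⊑Y ; right = X⊑Y ; cover = λ p → inj₁ (Y⊆X p) }) (max-idem _)

  -- A relation rather than a function: no definable choice of representatives of the classes in `Y`
  -- is at hand.
  record DMap (X : DSet a) (Y : DSet b) : Set (Level.suc ℓ) where
    field
      Rel_       : El a → El b → Set ℓ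
      relᴰ       : Def (a ⊗ b) (λ (x , y) → Rel_ x y)
      respects   : ∀ {x x′ y y′} → x ∈ Mem X → x′ ∈ Mem X → y ∈ Mem Y → y′ ∈ Mem Y →
                   X ∋ x ~ x′ → Y ∋ y ~ y′ → Rel_ x y → Rel_ x′ y′
      total      : ∀ {x} → x ∈ Mem X → ∃[ y ] y ∈ Mem Y × Rel_ x y
      functional : ∀ {x y y′} → x ∈ Mem X → y ∈ Mem Y → y′ ∈ Mem Y → Rel_ x y → Rel_ x y′ → Y ∋ y ~ y′

    Injective : Set ℓ
    Injective = ∀ {x x′ y} → x ∈ Mem X → x′ ∈ Mem X → y ∈ Mem Y → Rel_ x y → Rel_ x′ y → X ∋ x ~ x′

  open DMap

  restrict : (X : DSet a) {P : Pred (El a) ℓ} → Def a P → DSet a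
  restrict X {P} Pᴰ = record
    { Mem = λ x → x ∈ Mem X × P x ; _~_ = X ∋_~_
    ; memᴰ = memᴰ X ∧ᴰ Pᴰ ; ~ᴰ = ~ᴰ X
    ; ~-refl  = λ (p , _) → ~-refl X p
    ; ~-sym   = λ (p , _) (q , _) → ~-sym X p q
    ; ~-trans = λ (p , _) (q , _) (r , _) → ~-trans X p q r
    }

  fibre : {X : DSet a} {Y : DSet b} → DMap X Y → El b → DSet a
  fibre {X = X} F y = restrict X (fixᴰ (relᴰ F) y)

  private
    module Function {a b : Code} {X : DSet a} {Y : DSet b} (F : DMap X Y) where
      module X = Interpretation X
      module Y = Interpretation Y

      Maps : Vec ∣ 𝑴 ∣ (size a) → Vec ∣ 𝑴 ∣ (size b) → Set ℓ
      Maps v w = Holds (set (relᴰ F)) (v ++ w)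

      isRel : ∀ x y → Rel_ F x y ⇔ Maps X.⌜ x ⌝ Y.⌜ y ⌝
      isRel x y = Def.member (relᴰ F) (x , y)

      function : InterpretableFunction X.interp Y.interp
      function = record
        { graph      = set (relᴰ F)
        ; respects   = λ {v} {v′} {w} {w′} p p′ q q′ → resp (X.fromDom v p) (X.fromDom v′ p′) (Y.fromDom w q) (Y.fromDom w′ q′)
        ; total      = λ {v} p → tot (X.fromDom v p)
        ; functional = λ {v} {w} {w′} p q q′ → fun (X.fromDom v p) (Y.fromDom w q) (Y.fromDom w′ q′)
        }
        where
        resp : ∀ {v v′ w w′} → (∃[ x ] x ∈ Mem X × v ≡ X.⌜ x ⌝) → (∃[ x ] x ∈ Mem X × v′ ≡ X.⌜ x ⌝) →
               (∃[ y ] y ∈ Mem Y × w ≡ Y.⌜ y ⌝) → (∃[ y ] y ∈ Mem Y × w′ ≡ Y.⌜ y ⌝) →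
               Interpretable.Eq X.interp v v′ → Interpretable.Eq Y.interp w w′ →
               Maps v w → Maps v′ w′
        resp (x , p , ≡.refl) (x′ , p′ , ≡.refl) (y , q , ≡.refl) (y′ , q′ , ≡.refl) e f h =
          to (isRel x′ y′) (respects F p p′ q q′ (from (X.isEq x x′) e) (from (Y.isEq y y′) f) (from (isRel x y) h))
        tot : ∀ {v} → (∃[ x ] x ∈ Mem X × v ≡ X.⌜ x ⌝) →
              ∃[ w ] w ∈ Interpretable.Dom Y.interp × Maps v w
        tot (x , p , ≡.refl) = let y , q , h = total F p in Y.⌜ y ⌝ , Y.isDom q , to (isRel x y) h
        fun : ∀ {v w w′} → (∃[ x ] x ∈ Mem X × v ≡ X.⌜ x ⌝) →
              (∃[ y ] y ∈ Mem Y × w ≡ Y.⌜ y ⌝) → (∃[ y ] y ∈ Mem Y × w′ ≡ Y.⌜ y ⌝) →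
              Maps v w → Maps v w′ → Interpretable.Eq Y.interp w w′
        fun (x , p , ≡.refl) (y , q , ≡.refl) (y′ , q′ , ≡.refl) h h′ =
          to (Y.isEq y y′) (functional F p q q′ (from (isRel x y) h) (from (isRel x y′) h′))

      module _ {y : El b} {Z : Interpretable 𝑴 (size a)} (y∈Y : y ∈ Mem Y) (isFib : IsFibre function Y.⌜ y ⌝ Z) where
        private
          module V = Interpretation (fibre F y)
          open IsFibre isFib

          inZ : ∀ x → x ∈ Mem X → Rel_ F x y → X.⌜ x ⌝ ∈ Interpretable.Dom Z
          inZ x p h = from (member (X.isDom p)) (to (isRel x y) h)

          inFibre : ∀ x → X.⌜ x ⌝ ∈ Interpretable.Dom Z → x ∈ Mem X → x ∈ Mem (fibre F y)
          inFibre x p q = q , from (isRel x y) (to (member (X.isDom q)) p)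

          eqv : ∀ x x′ → x ∈ Mem (fibre F y) → x′ ∈ Mem (fibre F y) →
                Interpretable.Eq V.interp V.⌜ x ⌝ V.⌜ x′ ⌝ ⇔ Interpretable.Eq Z V.⌜ x ⌝ V.⌜ x′ ⌝
          eqv x x′ (p , h) (p′ , h′) = mk⇔
            (λ k → from (_⊑_.eq subset (inZ x p h) (inZ x′ p′ h′)) (to (X.isEq x x′) (from (V.isEq x x′) k)))
            (λ k → to (V.isEq x x′) (from (X.isEq x x′) (to (_⊑_.eq subset (inZ x p h) (inZ x′ p′ h′)) k)))

          fibre⊑Z : V.interp ⊑ Z
          fibre⊑Z = record
            { dom = λ {v} p → let x , (q , r) , e = V.fromDom v p in
                    ≡.subst (_∈ Interpretable.Dom Z) (≡.sym e) (inZ x q r)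
            ; eq  = λ {v} {w} p q → go (V.fromDom v p) (V.fromDom w q)
            }
            where
            go : ∀ {v w} → (∃[ x ] x ∈ Mem (fibre F y) × v ≡ V.⌜ x ⌝) → (∃[ x ] x ∈ Mem (fibre F y) × w ≡ V.⌜ x ⌝) →
                 Interpretable.Eq V.interp v w ⇔ Interpretable.Eq Z v w
            go (x , p , ≡.refl) (x′ , p′ , ≡.refl) = eqv x x′ p p′

          Z⊆fibre : ∀ v → v ∈ Interpretable.Dom Z → v ∈ Interpretable.Dom V.interp
          Z⊆fibre v p = let x , q , e = X.fromDom v (_⊑_.dom subset p) in
            ≡.subst (_∈ Interpretable.Dom V.interp) (≡.sym e)
              (V.isDom (inFibre x (≡.subst (_∈ Interpretable.Dom Z) e p) q))

        -- The fibration axioms quantify over every presentation `Z` of a fibre; this reduces them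
        -- to one canonical presentation.
        dim-fibre : dim M Z ≡ dimᴰ (fibre F y)
        dim-fibre = dim-ext fibre⊑Z λ {v} → Z⊆fibre v

  private
    _+0 : ∀ d → d +₋ 0 ≡ d
    ⊥₋ +0    = ≡.refl
    [ n ] +0 = ≡.cong [_] (ℕ.+-identityʳ n)

  module _ {X : DSet a} {Y : DSet b} (F : DMap X Y) (k : ℕ) where
    open Function F

    dimᴰ-upper : (∀ {y} → y ∈ Mem Y → [ k ] ≤₋ dimᴰ (fibre F y)) → dimᴰ Y +₋ k ≤₋ dimᴰ X
    dimᴰ-upper h = upper-fibration M X.interp Y.interp function k λ {w} q → go (Y.fromDom w q)
      where
      go : ∀ {w} → (∃[ y ] y ∈ Mem Y × w ≡ Y.⌜ y ⌝) → ∀ Z → IsFibre function w Z → [ k ] ≤₋ dim M Z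
      go (y , q , ≡.refl) Z isFib = ≡.subst ([ k ] ≤₋_) (≡.sym (dim-fibre q isFib)) (h q)

    dimᴰ-lower : (∀ {y} → y ∈ Mem Y → dimᴰ (fibre F y) ≤₋ [ k ]) → dimᴰ X ≤₋ dimᴰ Y +₋ k
    dimᴰ-lower h = lower-fibration M X.interp Y.interp function k λ {w} q → go (Y.fromDom w q)
      where
      go : ∀ {w} → (∃[ y ] y ∈ Mem Y × w ≡ Y.⌜ y ⌝) → ∀ Z → IsFibre function w Z → dim M Z ≤₋ [ k ]
      go (y , q , ≡.refl) Z isFib = ≡.subst (_≤₋ [ k ]) (≡.sym (dim-fibre q isFib)) (h q)

  dimᴰ-empty : (X : DSet a) → ¬ Inhabited X → dimᴰ X ≡ ⊥₋
  dimᴰ-empty X none = empty M (interp X) λ v p → let x , q , _ = fromDom X v p in contradiction (x , q) none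

  dimᴰ-finite : (X : DSet a) → Inhabited X → Finite X → dimᴰ X ≡ [ 0 ]
  dimᴰ-finite X (x , p) fin =
    from (algebraicity M (interp X)) ((⌜_⌝ X x , isDom X p) , from (IsFinite⇔Finite X) fin)

  -- Each fibre is empty or a single class, so lower fibration applies with `k = 0`.
  dimᴰ-injective : ∀ {X : DSet a} {Y : DSet b} (F : DMap X Y) → Injective F → dimᴰ X ≤₋ dimᴰ Y
  dimᴰ-injective {X = X} {Y} F inj = ≡.subst (dimᴰ X ≤₋_) (dimᴰ Y +0) (dimᴰ-lower F 0 bound)
    where
    bound : ∀ {y} → y ∈ Mem Y → dimᴰ (fibre F y) ≤₋ [ 0 ]
    bound {y} q with em {P = Inhabited (fibre F y)}
    ... | no none = ≡.subst (_≤₋ [ 0 ]) (≡.sym (dimᴰ-empty (fibre F y) none)) (⊥₋≤ _)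
    ... | yes (x , p , h) = ≡.subst (_≤₋ [ 0 ])
      (≡.sym (dimᴰ-finite (fibre F y) (x , p , h)
        (x ∷ [] , (p , h) ∷ [] , λ (p′ , h′) → here (inj p′ p q h′ h))))
      [ z≤n ]

  coerce : {X Y : DSet a} → Mem X ⊆ Mem Y →
           (∀ {x y} → x ∈ Mem X → y ∈ Mem X → X ∋ x ~ y → Y ∋ x ~ y) → DMap X Y
  coerce {X = X} {Y} X⊆Y X⇒Y = record
    { Rel_       = Y ∋_~_
    ; relᴰ       = ~ᴰ Y
    ; respects   = λ p p′ q q′ e f h →
        ~-trans Y (X⊆Y p′) (X⊆Y p) q′ (~-sym Y (X⊆Y p) (X⊆Y p′) (X⇒Y p p′ e)) (~-trans Y (X⊆Y p) q q′ h f)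
    ; total      = λ p → _ , X⊆Y p , ~-refl Y (X⊆Y p)
    ; functional = λ p q q′ h h′ → ~-trans Y q (X⊆Y p) q′ (~-sym Y (X⊆Y p) q h) h′
    }

  coerce-injective : {X Y : DSet a} (X⊆Y : Mem X ⊆ Mem Y)
                     (X⇒Y : ∀ {x y} → x ∈ Mem X → y ∈ Mem X → X ∋ x ~ y → Y ∋ x ~ y) →
                     (∀ {x y} → x ∈ Mem X → y ∈ Mem X → Y ∋ x ~ y → X ∋ x ~ y) →
                     Injective (coerce {X = X} {Y} X⊆Y X⇒Y)
  coerce-injective {Y = Y} X⊆Y _ Y⇒X p p′ q e f =
    Y⇒X p p′ (~-trans Y (X⊆Y p) q (X⊆Y p′) e (~-sym Y (X⊆Y p′) q f))

  -- The dimension, with the junk value 0 on the empty set.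
  toℕ : Dimension → ℕ
  toℕ ⊥₋    = 0
  toℕ [ n ] = n

  rank : DSet a → ℕ
  rank X = toℕ (dimᴰ X)

  private
    toℕ-mono : ∀ {d e} → d ≤₋ e → toℕ d ≤ toℕ e
    toℕ-mono (⊥₋≤ _) = z≤n
    toℕ-mono [ p ]   = p

    toℕ-+ : ∀ d k → toℕ (d +₋ k) ≤ toℕ d ℕ.+ k
    toℕ-+ ⊥₋    k = z≤n
    toℕ-+ [ n ] k = ℕ.≤-refl

    toℕ-max : ∀ d e → toℕ (max d e) ≡ toℕ d ⊔ toℕ e
    toℕ-max ⊥₋    ⊥₋    = ≡.refl
    toℕ-max ⊥₋    [ n ] = ≡.refl
    toℕ-max [ m ] ⊥₋    = ≡.sym (ℕ.⊔-identityʳ m)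
    toℕ-max [ m ] [ n ] = ≡.refl

    toℕ-≤ : ∀ {d k} → toℕ d ≤ k → d ≤₋ [ k ]
    toℕ-≤ {⊥₋}    p = ⊥₋≤ _
    toℕ-≤ {[ n ]} p = [ p ]

  rank-injective : {X : DSet a} {Y : DSet b} (F : DMap X Y) → Injective F → rank X ≤ rank Y
  rank-injective F inj = toℕ-mono (dimᴰ-injective F inj)

  -- The class of a point has dimension 0 and embeds in `X`, which excludes -∞.
  dimᴰ-inhabited : (X : DSet a) → Inhabited X → dimᴰ X ≡ [ rank X ]
  dimᴰ-inhabited X (x , p) = go (≡.subst (_≤₋ dimᴰ X) (dimᴰ-finite pt (x , p , ~-refl X p) finite)
                                  (dimᴰ-injective (coerce {X = pt} {X} proj₁ λ _ _ → id)
                                                  (coerce-injective {X = pt} {X} proj₁ (λ _ _ → id) λ _ _ → id)))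
    where
    pt : DSet _
    pt = restrict X (fixᴰ (~ᴰ X) x)
    finite : Finite pt
    finite = x ∷ [] , (p , ~-refl X p) ∷ [] , λ (_ , e) → here e
    go : ∀ {d} → [ 0 ] ≤₋ d → d ≡ [ toℕ d ]
    go [ _ ] = ≡.refl

  -- Inhabitedness guards against the junk value of `rank`: an empty fibre has rank 0 but dimension
  -- -∞, and for empty `Y` the bound fails as soon as `k` is positive.
  rank-upper : {X : DSet a} {Y : DSet b} (F : DMap X Y) (k : ℕ) → Inhabited Y →
               (∀ {y} → y ∈ Mem Y → Inhabited (fibre F y) × k ≤ rank (fibre F y)) →
               rank Y ℕ.+ k ≤ rank X
  rank-upper {X = X} {Y} F k inh h = toℕ-mono (≡.subst (λ d → d +₋ k ≤₋ dimᴰ X) (dimᴰ-inhabited Y inh)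
    (dimᴰ-upper F k λ q → let i , k≤ = h q in ≡.subst ([ k ] ≤₋_) (≡.sym (dimᴰ-inhabited (fibre F _) i)) [ k≤ ]))

  rank-lower : {X : DSet a} {Y : DSet b} (F : DMap X Y) (k : ℕ) →
               (∀ {y} → y ∈ Mem Y → rank (fibre F y) ≤ k) → rank X ≤ rank Y ℕ.+ k
  rank-lower {Y = Y} F k h = ℕ.≤-trans (toℕ-mono (dimᴰ-lower F k λ q → toℕ-≤ (h q))) (toℕ-+ (dimᴰ Y) k)

  rank≡0⇒Finite : (X : DSet a) → rank X ≡ 0 → Finite X
  rank≡0⇒Finite X e with em {P = Inhabited X}
  ... | no none = [] , [] , λ p → contradiction (_ , p) none
  ... | yes inh = to (IsFinite⇔Finite X) (proj₂ (to (algebraicity M (interp X))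
                    (≡.trans (dimᴰ-inhabited X inh) (≡.cong [_] e))))

  Finite⇒rank≡0 : (X : DSet a) → Finite X → rank X ≡ 0
  Finite⇒rank≡0 X fin with em {P = Inhabited X}
  ... | no none = ≡.cong toℕ (dimᴰ-empty X none)
  ... | yes inh = ≡.cong toℕ (dimᴰ-finite X inh fin)

  infinite⇒rank>0 : (X : DSet a) → ¬ Finite X → 0 < rank X
  infinite⇒rank>0 X inf = ℕ.n≢0⇒n>0 λ e → inf (rank≡0⇒Finite X e)

  rank-union : (X : DSet a) {P Q : Pred (El a) ℓ} (Pᴰ : Def a P) (Qᴰ : Def a Q) →
               (∀ {x} → x ∈ Mem X → P x ⊎ Q x) → rank X ≡ rank (restrict X Pᴰ) ⊔ rank (restrict X Qᴰ)
  rank-union X {P} {Q} Pᴰ Qᴰ cover = ≡.trans (≡.cong toℕ (union M _ _ _ isUnion)) (toℕ-max (dimᴰ (restrict X Pᴰ)) (dimᴰ (restrict X Qᴰ)))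
    where
    module X = Interpretation X
    inside : {R : Pred _ ℓ} (Rᴰ : Def _ R) → interp (restrict X Rᴰ) ⊑ X.interp
    inside Rᴰ = record
      { dom = λ {v} p → let x , (q , _) , e = R.fromDom v p in
                        ≡.subst (_∈ Interpretable.Dom X.interp) (≡.sym e) (X.isDom q)
      ; eq  = λ {v} {w} p q → go (R.fromDom v p) (R.fromDom w q)
      }
      where
      module R = Interpretation (restrict X Rᴰ)
      go : ∀ {v w} → (∃[ x ] x ∈ Mem (restrict X Rᴰ) × v ≡ R.⌜ x ⌝) →
           (∃[ x ] x ∈ Mem (restrict X Rᴰ) × w ≡ R.⌜ x ⌝) →
           Interpretable.Eq R.interp v w ⇔ Interpretable.Eq X.interp v w
      go (x , _ , ≡.refl) (y , _ , ≡.refl) =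
        mk⇔ (λ e → to (X.isEq _ _) (from (R.isEq _ _) e)) (λ e → to (R.isEq _ _) (from (X.isEq _ _) e))
    isUnion : IsUnion (interp (restrict X Pᴰ)) (interp (restrict X Qᴰ)) X.interp
    isUnion = record
      { left  = inside Pᴰ
      ; right = inside Qᴰ
      ; cover = λ {v} p → split v (X.fromDom v p)
      }
      where
      split : ∀ v → (∃[ x ] x ∈ Mem X × v ≡ X.⌜ x ⌝) →
              v ∈ Interpretable.Dom (interp (restrict X Pᴰ)) ⊎ v ∈ Interpretable.Dom (interp (restrict X Qᴰ))
      split _ (x , p , ≡.refl) =
        Sum.map (λ q → isDom (restrict X Pᴰ) (p , q)) (λ q → isDom (restrict X Qᴰ) (p , q)) (cover p)

  infixr 5 _⊠_

  _⊠_ : DSet a → DSet b → DSet (a ⊗ b)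
  X ⊠ Y = record
    { Mem     = λ (x , y) → x ∈ Mem X × y ∈ Mem Y
    ; _~_     = λ (x , y) (x′ , y′) → (X ∋ x ~ x′) × (Y ∋ y ~ y′)
    ; memᴰ    = projectᴰ (fstᴾ idᴾ) (memᴰ X) ∧ᴰ projectᴰ (sndᴾ idᴾ) (memᴰ Y)
    ; ~ᴰ      = projectᴰ ⟨ fstᴾ (fstᴾ idᴾ) , fstᴾ (sndᴾ idᴾ) ⟩ᴾ (~ᴰ X)
             ∧ᴰ projectᴰ ⟨ sndᴾ (fstᴾ idᴾ) , sndᴾ (sndᴾ idᴾ) ⟩ᴾ (~ᴰ Y)
    ; ~-refl  = λ (p , q) → ~-refl X p , ~-refl Y q
    ; ~-sym   = λ (p , q) (p′ , q′) (e , f) → ~-sym X p p′ e , ~-sym Y q q′ f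
    ; ~-trans = λ (p , q) (p′ , q′) (p″ , q″) (e , f) (e′ , f′) →
        ~-trans X p p′ p″ e e′ , ~-trans Y q q′ q″ f f′
    }

  module _ (X : DSet a) (Y : DSet b) where
    private
      first : DMap (X ⊠ Y) X
      first = record
        { Rel_       = λ (x , _) x′ → X ∋ x ~ x′
        ; relᴰ       = projectᴰ ⟨ fstᴾ (fstᴾ idᴾ) , sndᴾ idᴾ ⟩ᴾ (~ᴰ X)
        ; respects   = λ (p , _) (p′ , _) q q′ (e , _) f h →
            ~-trans X p′ p q′ (~-sym X p p′ e) (~-trans X p q q′ h f)
        ; total      = λ (p , _) → _ , p , ~-refl X p
        ; functional = λ (p , _) q q′ h h′ → ~-trans X q p q′ (~-sym X p q h) h′
        }

      second : ∀ {x} → x ∈ Mem X → DMap (fibre first x) Y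
      second p = record
        { Rel_       = λ (_ , y) y′ → Y ∋ y ~ y′
        ; relᴰ       = projectᴰ ⟨ sndᴾ (fstᴾ idᴾ) , sndᴾ idᴾ ⟩ᴾ (~ᴰ Y)
        ; respects   = λ ((_ , p) , _) ((_ , p′) , _) q q′ (_ , e) f h →
            ~-trans Y p′ p q′ (~-sym Y p p′ e) (~-trans Y p q q′ h f)
        ; total      = λ ((_ , p) , _) → _ , p , ~-refl Y p
        ; functional = λ ((_ , p) , _) q q′ h h′ → ~-trans Y q p q′ (~-sym Y p q h) h′
        }

      insert : ∀ {x} → x ∈ Mem X → DMap Y (fibre first x)
      insert {x} p = record
        { Rel_       = λ y (x′ , y′) → (X ∋ x′ ~ x) × (Y ∋ y ~ y′)
        ; relᴰ       = projectᴰ (fstᴾ (sndᴾ idᴾ)) (fixᴰ (~ᴰ X) x)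
                    ∧ᴰ projectᴰ ⟨ fstᴾ idᴾ , sndᴾ (sndᴾ idᴾ) ⟩ᴾ (~ᴰ Y)
        ; respects   = λ q q′ ((r , s) , _) ((r′ , s′) , _) e (f , g) (h , k) →
            ~-trans X r′ r p (~-sym X r r′ f) h ,
            ~-trans Y q′ q s′ (~-sym Y q q′ e) (~-trans Y q s s′ k g)
        ; total      = λ q → _ , ((p , q) , ~-refl X p) , (~-refl X p , ~-refl Y q)
        ; functional = λ q ((r , s) , _) ((r′ , s′) , _) (h , k) (h′ , k′) →
            ~-trans X r p r′ h (~-sym X r′ p h′) , ~-trans Y s q s′ (~-sym Y q s k) k′
        }

    rank-⊠-≤ : rank (X ⊠ Y) ≤ rank X ℕ.+ rank Y
    rank-⊠-≤ = rank-lower first (rank Y) λ p → rank-injective (second p)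
      λ ((q , r) , h) ((q′ , r′) , h′) s e e′ →
        ~-trans X q p q′ h (~-sym X q′ p h′) , ~-trans Y r s r′ e (~-sym Y r′ s e′)

    rank-⊠-≥ : Inhabited X → Inhabited Y → rank X ℕ.+ rank Y ≤ rank (X ⊠ Y)
    rank-⊠-≥ inh (y , q) = rank-upper first (rank Y) inh λ {x} p →
      ((x , y) , (p , q) , ~-refl X p) , rank-injective (insert p)
        λ q q′ ((r , s) , _) (h , k) (h′ , k′) → ~-trans Y q s q′ k (~-sym Y q′ s k′)

  module Quotients (s : Sort)
    (addᴳ : Graph (base s ⊗ base s) (base s) (λ z → AbelianGroup._∙_ (group s) (proj₁ z) (proj₂ z))) where
    private module G = AbelianGroup (group s)
    open G using (Carrier; _≈_; _∙_; _⁻¹; ε; _-_; ∙-cong; ∙-congˡ; ⁻¹-cong; identityˡ; inverseʳ)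
    open Subgroups em (group s)
    open AbelianGroupSolver (group s) using (solve; #_; _⊕_; _⊖_)

    addᵗ : Tm c (base s) → Tm c (base s) → Tm c (base s)
    addᵗ t u = mapᵗ addᴳ ⟨ t , u ⟩ᵗ

    -- Only the graph of addition is given, but `y` is the inverse of `x` exactly when `x ∙ y ≈ ε`.
    negᴳ : Graph (base s) (base s) _⁻¹
    negᴳ = Def-⇔
      (λ (y , x) → mk⇔ (λ e → G.sym (inverseʳ-unique x y e))
                       (λ e → G.trans (∙-congˡ (G.sym e)) (inverseʳ x)))
      (addᵗ (projection (sndᴾ idᴾ)) (projection (fstᴾ idᴾ)) ≈ᴰ constᵗ ε)
      where open AbelianGroupProperties (group s) using (inverseʳ-unique)

    subᵗ : Tm c (base s) → Tm c (base s) → Tm c (base s)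
    subᵗ t u = addᵗ t (mapᵗ negᴳ u)

    infixl 7 _/_

    record Subgroupᴰ : Set (Level.suc ℓ) where
      field
        Carrierˢ   : Pred Carrier ℓ
        isSubgroup : IsSubgroup (group s) Carrierˢ
        defˢ       : Def (base s) Carrierˢ

    open Subgroupᴰ

    Quot : {K : Pred Carrier ℓ} → Def (base s) K → Subgroupᴰ → DSet (base s)
    Quot {K} Kᴰ H = record
      { Mem     = K
      ; _~_     = λ x y → x - y ∈ Carrierˢ H
      ; memᴰ    = Kᴰ
      ; ~ᴰ      = atᴰ (defˢ H) (subᵗ (projection (fstᴾ idᴾ)) (projection (sndᴾ idᴾ)))
      ; ~-refl  = λ _ → -‿refl (isSubgroup H) G.refl
      ; ~-sym   = λ _ _ → -‿flip (isSubgroup H)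
      ; ~-trans = λ _ _ _ → -‿trans (isSubgroup H)
      }

    _/_ : Subgroupᴰ → Subgroupᴰ → DSet (base s)
    K / H = Quot (defˢ K) H

    trivial : Subgroupᴰ
    trivial = record
      { Carrierˢ   = _≈ ε
      ; isSubgroup = record
        { respects  = λ e p → G.trans (G.sym e) p
        ; ε-closed  = G.refl
        ; ∙-closed  = λ p q → G.trans (∙-cong p q) (identityˡ ε)
        ; ⁻¹-closed = λ p → G.trans (⁻¹-cong p) ε⁻¹≈ε
        }
      ; defˢ       = projection idᴾ ≈ᴰ constᵗ ε
      }
      where open AbelianGroupProperties (group s) using (ε⁻¹≈ε)

    module _ {B K C : Subgroupᴰ} (K⊆B : Carrierˢ K ⊆ Carrierˢ B) (C⊆K : Carrierˢ C ⊆ Carrierˢ K) where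
      private
        module B = IsSubgroup (isSubgroup B)
        module K = IsSubgroup (isSubgroup K)
        module C = IsSubgroup (isSubgroup C)

        modK : DMap (B / C) (B / K)
        modK = coerce id λ _ _ → C⊆K

        -- The graph of translation by `y` modulo `C`. Read in the two directions it maps K/C to the
        -- fibre of `modK` over `y` and back.
        offset : Carrier → Carrier → Carrier → Set ℓ
        offset y x k = (x - y) - k ∈ Carrierˢ C

        offset-respects : ∀ {y x x′ k k′} → x - x′ ∈ Carrierˢ C → k - k′ ∈ Carrierˢ C → offset y x k → offset y x′ k′
        offset-respects {y} {x} {x′} {k} {k′} e f h = C.respects
          (solve (y ∷ x ∷ x′ ∷ k ∷ k′ ∷ [])
            ((((# 1F ⊖ # 0F) ⊖ # 3F) ⊖ (# 1F ⊖ # 2F))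
               ⊕ (# 3F ⊖ # 4F))
            ((# 2F ⊖ # 0F) ⊖ # 4F) ≡.refl)
          (C.∙-closed (-‿closed (isSubgroup C) h e) f)

        offset-x : ∀ {y x x′ k} → offset y x k → offset y x′ k → x - x′ ∈ Carrierˢ C
        offset-x {y} {x} {x′} {k} h h′ = C.respects
          (solve (y ∷ x ∷ x′ ∷ k ∷ [])
            (((# 1F ⊖ # 0F) ⊖ # 3F) ⊖ ((# 2F ⊖ # 0F) ⊖ # 3F))
            (# 1F ⊖ # 2F) ≡.refl)
          (-‿closed (isSubgroup C) h h′)

        offset-k : ∀ {y x k k′} → offset y x k → offset y x k′ → k - k′ ∈ Carrierˢ C
        offset-k {y} {x} {k} {k′} h h′ = C.respects
          (solve (y ∷ x ∷ k ∷ k′ ∷ [])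
            (((# 1F ⊖ # 0F) ⊖ # 3F) ⊖ ((# 1F ⊖ # 0F) ⊖ # 2F))
            (# 2F ⊖ # 3F) ≡.refl)
          (-‿closed (isSubgroup C) h′ h)

        offsetᴰ : ∀ y (t u : Tm c (base s)) → Def c (λ ρ → offset y (val t ρ) (val u ρ))
        offsetᴰ y t u = atᴰ (defˢ C) (subᵗ (subᵗ t (constᵗ y)) u)

        translate : ∀ {y} → y ∈ Carrierˢ B → DMap (K / C) (fibre modK y)
        translate {y} y∈B = record
          { Rel_       = λ k x → offset y x k
          ; relᴰ       = offsetᴰ y (projection (sndᴾ idᴾ)) (projection (fstᴾ idᴾ))
          ; respects   = λ _ _ _ _ e f h → offset-respects f e h
          ; total      = λ {k} k∈K →
              let cancel = solve (y ∷ k ∷ []) (# 1F) ((# 1F ⊕ # 0F) ⊖ # 0F) ≡.refl in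
              k ∙ y , (B.∙-closed (K⊆B k∈K) y∈B , K.respects cancel k∈K) , -‿refl (isSubgroup C) (G.sym cancel)
          ; functional = λ _ _ _ → offset-x
          }

        untranslate : ∀ {y} → y ∈ Carrierˢ B → DMap (fibre modK y) (K / C)
        untranslate {y} y∈B = record
          { Rel_       = λ x k → offset y x k
          ; relᴰ       = offsetᴰ y (projection (fstᴾ idᴾ)) (projection (sndᴾ idᴾ))
          ; respects   = λ _ _ _ _ e f h → offset-respects e f h
          ; total      = λ {x} (_ , h) → x - y , h , -‿refl (isSubgroup C) G.refl
          ; functional = λ _ _ _ → offset-k
          }

      -- The fibres of B/C → B/K are cosets of K/C, so each contains a translated copy of it.
      rank-tower : rank (B / K) ℕ.+ rank (K / C) ≤ rank (B / C)
      rank-tower = rank-upper modK (rank (K / C)) (ε , B.ε-closed) λ {y} y∈B →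
        (y , y∈B , -‿refl (isSubgroup K) G.refl) ,
        rank-injective (translate y∈B) λ _ _ _ → offset-k

      rank-finiteIndex : FiniteMod (Carrierˢ B) (Carrierˢ K) → rank (B / C) ≤ rank (K / C)
      rank-finiteIndex fin = ≡.subst (λ n → rank (B / C) ≤ n ℕ.+ rank (K / C)) (Finite⇒rank≡0 (B / K) fin)
        (rank-lower modK (rank (K / C)) λ y∈B → rank-injective (untranslate y∈B) λ _ _ _ → offset-x)

      -- An embedding of B/C in K/C leaves nothing but rank 0 for B/K in `rank-tower`. This is where
      -- injectivity of an operator turns into surjectivity up to finite index.
      injective⇒finiteIndex : (F : DMap (B / C) (K / C)) → Injective F → FiniteMod (Carrierˢ B) (Carrierˢ K)
      injective⇒finiteIndex F inj = rank≡0⇒Finite (B / K)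
        (ℕ.n≤0⇒n≡0 (ℕ.+-cancelʳ-≤ (rank (K / C)) _ _ (ℕ.≤-trans rank-tower (rank-injective F inj))))

    -- `Y` keeps the rank of `Z`, whereas `N` has smaller rank because its index is infinite. As the
    -- rank of a union is the maximum, the part of `Y` outside `N` carries the full rank.
    rank-complement :
      (Z Y N : Subgroupᴰ) → Carrierˢ Y ⊆ Carrierˢ Z → Carrierˢ N ⊆ Carrierˢ Z →
      FiniteMod (Carrierˢ Z) (Carrierˢ Y) → ¬ FiniteMod (Carrierˢ Z) (Carrierˢ N) →
      rank (Z / trivial) ≤ rank (restrict (Y / trivial) (¬ᴰ (defˢ N)))
    rank-complement Z Y N Y⊆Z N⊆Z fin inf =
      [ (λ e → ≡.subst (rank (Z / trivial) ≤_) e Z≤⊔)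
          , (λ e → contradiction (≡.subst (rank (Z / trivial) ≤_) e Z≤⊔) (ℕ.<⇒≱ (ℕ.≤-<-trans Y∩N≤N N<Z)))
          ]′ (ℕ.⊔-sel (rank Y∖N) (rank Y∩N))
      where
      Y∖N Y∩N : DSet (base s)
      Y∖N = restrict (Y / trivial) (¬ᴰ (defˢ N))
      Y∩N = restrict (Y / trivial) (defˢ N)
      trivial⊆ : (H : Subgroupᴰ) → Carrierˢ trivial ⊆ Carrierˢ H
      trivial⊆ H e = IsSubgroup.respects (isSubgroup H) (G.sym e) (IsSubgroup.ε-closed (isSubgroup H))
      cover : ∀ {x} → x ∈ Carrierˢ Y → (¬ (x ∈ Carrierˢ N)) ⊎ x ∈ Carrierˢ N
      cover {x} _ with em {P = x ∈ Carrierˢ N}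
      ... | yes p = inj₂ p
      ... | no ¬p = inj₁ ¬p
      Z≤⊔ : rank (Z / trivial) ≤ rank Y∖N ⊔ rank Y∩N
      Z≤⊔ = ℕ.≤-trans (rank-finiteIndex {Z} {Y} {trivial} Y⊆Z (trivial⊆ Y) fin)
              (ℕ.≤-reflexive (rank-union (Y / trivial) (¬ᴰ (defˢ N)) (defˢ N) cover))
      Y∩N≤N : rank Y∩N ≤ rank (N / trivial)
      Y∩N≤N = rank-injective (coerce {X = Y∩N} {N / trivial} proj₂ λ _ _ → id)
                (coerce-injective {X = Y∩N} {N / trivial} proj₂ (λ _ _ → id) λ _ _ → id)
      N<Z : rank (N / trivial) < rank (Z / trivial)
      N<Z = ℕ.≤-trans (ℕ.+-monoˡ-≤ (rank (N / trivial)) (infinite⇒rank>0 (Z / N) inf))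
              (rank-tower {Z} {N} {trivial} N⊆Z (trivial⊆ N))

-- Additive maps and quotient groups

module Additive {ℓ : Level} (G H : AbelianGroup ℓ ℓ) where
  private
    module G = AbelianGroup G
    module H = AbelianGroup H

  record IsAdditive (θ : G.Carrier → H.Carrier) : Set ℓ where
    field
      ⟦⟧-cong : ∀ {x y} → x G.≈ y → θ x H.≈ θ y
      +-homo  : ∀ x y → θ (x G.∙ y) H.≈ θ x H.∙ θ y

    0-homo : θ G.ε H.≈ H.ε
    0-homo = identityˡ-unique (θ G.ε) (θ G.ε)
      (H.trans (H.sym (+-homo G.ε G.ε)) (⟦⟧-cong (G.identityˡ G.ε)))
      where open AbelianGroupProperties H using (identityˡ-unique)

    neg-homo : ∀ x → θ (x G.⁻¹) H.≈ θ x H.⁻¹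
    neg-homo x = inverseˡ-unique (θ (x G.⁻¹)) (θ x)
      (H.trans (H.sym (+-homo (x G.⁻¹) x)) (H.trans (⟦⟧-cong (G.inverseˡ x)) 0-homo))
      where open AbelianGroupProperties H using (inverseˡ-unique)

    sub-homo : ∀ x y → θ (x G.- y) H.≈ θ x H.- θ y
    sub-homo x y = H.trans (+-homo x (y G.⁻¹)) (H.∙-congˡ (neg-homo y))

    preimage-isSubgroup : ∀ {K : Pred H.Carrier ℓ} → IsSubgroup H K → IsSubgroup G (λ x → θ x ∈ K)
    preimage-isSubgroup K = record
      { respects  = λ e → K.respects (⟦⟧-cong e)
      ; ε-closed  = K.respects (H.sym 0-homo) K.ε-closed
      ; ∙-closed  = λ p q → K.respects (H.sym (+-homo _ _)) (K.∙-closed p q)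
      ; ⁻¹-closed = λ p → K.respects (H.sym (neg-homo _)) (K.⁻¹-closed p)
      }
      where module K = IsSubgroup K

module Quotient {ℓ : Level} (G : AbelianGroup ℓ ℓ) {H : Pred (AbelianGroup.Carrier G) ℓ} (H≤G : IsSubgroup G H) where
  open AbelianGroup G
  open IsSubgroup H≤G
  open AbelianGroupSolver G

  infix 4 _≡ᴴ_
  _≡ᴴ_ : Rel Carrier ℓ
  x ≡ᴴ y = x - y ∈ H

  ≈⇒≡ᴴ : ∀ {x y} → x ≈ y → x ≡ᴴ y
  ≈⇒≡ᴴ {x} {y} e = respects (trans (sym (inverseʳ y)) (∙-congʳ (sym e))) ε-closed

  quotient : AbelianGroup ℓ ℓ
  quotient = record
    { Carrier = Carrier ; _≈_ = _≡ᴴ_ ; _∙_ = _∙_ ; ε = ε ; _⁻¹ = _⁻¹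
    ; isAbelianGroup = record
      { isGroup = record
        { isMonoid = record
          { isSemigroup = record
            { isMagma = record
              { isEquivalence = record
                { refl  = ≈⇒≡ᴴ refl
                ; sym   = λ {x} {y} p → respects
                    (solve (x ∷ y ∷ []) (⊝ (# 0F ⊖ # 1F)) (# 1F ⊖ # 0F) ≡.refl) (⁻¹-closed p)
                ; trans = λ {x} {y} {z} p q → respects
                    (solve (x ∷ y ∷ z ∷ []) ((# 0F ⊖ # 1F) ⊕ (# 1F ⊖ # 2F)) (# 0F ⊖ # 2F) ≡.refl)
                    (∙-closed p q)
                }
              ; ∙-cong = λ {x} {y} {u} {v} p q → respects
                  (solve (x ∷ y ∷ u ∷ v ∷ [])
                    ((# 0F ⊖ # 1F) ⊕ (# 2F ⊖ # 3F)) ((# 0F ⊕ # 2F) ⊖ (# 1F ⊕ # 3F)) ≡.refl)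
                  (∙-closed p q)
              }
            ; assoc = λ x y z → ≈⇒≡ᴴ (assoc x y z)
            }
          ; identity = (λ x → ≈⇒≡ᴴ (identityˡ x)) , (λ x → ≈⇒≡ᴴ (identityʳ x))
          }
        ; inverse = (λ x → ≈⇒≡ᴴ (inverseˡ x)) , (λ x → ≈⇒≡ᴴ (inverseʳ x))
        ; ⁻¹-cong = λ {x} {y} p → respects
            (solve (x ∷ y ∷ []) (⊝ (# 0F ⊖ # 1F)) (⊝ # 0F ⊖ ⊝ # 1F) ≡.refl) (⁻¹-closed p)
        }
      ; comm = λ x y → ≈⇒≡ᴴ (comm x y)
      }
    }

-- Properties that hold on a subgroup of finite index

module AlmostEverywhere {ℓ : Level} (em : ∀ {p} → ExcludedMiddle p) (G : AbelianGroup ℓ ℓ) where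
  open AbelianGroup G
  open Subgroups em G
  open FiniteCovers em

  FiniteMod-trans : ∀ {k} {K : Pred Carrier k} {H J : Pred Carrier ℓ} → IsSubgroup G J →
                    FiniteMod K H → FiniteMod H J → FiniteMod K J
  FiniteMod-trans {H = H} {J} J≤G (xs , xs∈K , cover) fin =
    FiniteUpTo-refine (λ x z → x - z ∈ H) xs xs∈K cover λ {z} _ →
      FiniteUpTo-transfer (λ x y → x - z ≡ y) fin (λ (_ , h) → _ , h , ≡.refl)
        λ { {x} {x′} _ _ _ _ _ ≡.refl ≡.refl h h′ → IsSubgroup.respects J≤G
            (solve (x ∷ x′ ∷ z ∷ []) ((# 0F ⊖ # 2F) ⊖ (# 1F ⊖ # 2F)) (# 0F ⊖ # 1F) ≡.refl)
            (-‿trans J≤G h (-‿flip J≤G h′)) }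
    where open AbelianGroupSolver G

  -- `FiniteIndex` admits arbitrary sets and is not closed under intersection: even and odd integers
  -- both satisfy it. A subgroup inside `P` restores this closure. It need not be definable, as
  -- domains of partial homomorphisms are not.
  Almost : ∀ {p} → Pred Carrier p → Set (Level.suc ℓ Level.⊔ p)
  Almost P = Σ[ D ∈ Pred Carrier ℓ ] IsSubgroup G D × FiniteIndex G D × D ⊆ P

  almost : ∀ {D : Pred Carrier ℓ} → IsSubgroup G D → FiniteIndex G D → Almost D
  almost D≤G fin = _ , D≤G , fin , id

  Almost-map : ∀ {p q} {P : Pred Carrier p} {Q : Pred Carrier q} → P ⊆ Q → Almost P → Almost Q
  Almost-map P⊆Q (D , D≤G , fin , D⊆P) = D , D≤G , fin , λ x∈D → P⊆Q (D⊆P x∈D)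

  Almost-∩ : ∀ {p q} {P : Pred Carrier p} {Q : Pred Carrier q} → Almost P → Almost Q → Almost (λ x → x ∈ P × x ∈ Q)
  Almost-∩ (D , D≤G , fin , D⊆P) (E , E≤G , fin′ , E⊆Q) =
    D ∩ E , ∩-isSubgroup D≤G E≤G , FiniteMod-∩ D≤G E≤G fin fin′ , λ (p , q) → D⊆P p , E⊆Q q

  Almost⇒FiniteIndex : ∀ {H : Pred Carrier ℓ} → Almost H → FiniteIndex G H
  Almost⇒FiniteIndex {H} (D , _ , fin , D⊆H) = FiniteMod-mono {H = D} {H} D⊆H fin

  Almost-preimage : ∀ {p} {P : Pred Carrier p} {θ : Carrier → Carrier} → Additive.IsAdditive G G θ →
                    Almost P → Almost (λ x → θ x ∈ P)
  Almost-preimage {θ = θ} add (D , D≤G , fin , D⊆P) =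
    (λ x → θ x ∈ D) , preimage-isSubgroup D≤G ,
    Preimages.FiniteMod-preimage em G G {K = U} {U} {λ x → θ x ∈ D} {D} D≤G θ (λ _ → _)
      (λ {x} {y} _ _ → IsSubgroup.respects D≤G (sym (sub-homo x y))) fin ,
    D⊆P
    where open Additive.IsAdditive add

data Sorts : Set where
  𝕃 𝔸 : Sorts

module LinearAction {ℓ : Level} (𝔤 : LieRing ℓ) (A : LieModule 𝔤) where
  private
    module L = LieRing 𝔤
    module A = LieModule A
    module L₊ = AbelianGroup L.additiveGroup
    module A₊ = AbelianGroup A.additiveGroup
  open L using (⁅_,_⁆)
  open A using (_·_)
  open Additive using (IsAdditive)

  ·-additiveʳ : ∀ x → IsAdditive A.additiveGroup A.additiveGroup (x ·_)
  ·-additiveʳ x = record { ⟦⟧-cong = A.·-cong L₊.refl ; +-homo = A.·-distˡ x }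

  ·-additiveˡ : ∀ a → IsAdditive L.additiveGroup A.additiveGroup (_· a)
  ·-additiveˡ a = record { ⟦⟧-cong = λ e → A.·-cong e A₊.refl ; +-homo = λ x y → A.·-distʳ x y a }

  ad-additive : ∀ x → IsAdditive L.additiveGroup L.additiveGroup ⁅ x ,_⁆
  ad-additive x = record { ⟦⟧-cong = L.⁅⁆-cong L₊.refl ; +-homo = L.⁅⁆-linearʳ x }

  ad-additiveˡ : ∀ y → IsAdditive L.additiveGroup L.additiveGroup ⁅_, y ⁆
  ad-additiveˡ y = record { ⟦⟧-cong = λ e → L.⁅⁆-cong e L₊.refl ; +-homo = λ x x′ → L.⁅⁆-linearˡ x x′ y }

-- Homomorphisms defined almost everywhere, modulo a subgroup

module AlmostHoms {ℓ : Level} (em : ∀ {p} → ExcludedMiddle p) (G H : AbelianGroup ℓ ℓ)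
                  {C : Pred (AbelianGroup.Carrier H) ℓ} (C≤H : IsSubgroup H C) where
  private
    module G = AbelianGroup G
    module H = AbelianGroup H
    module C = IsSubgroup C≤H
    module SG = Subgroups em G
    module SH = Subgroups em H
  open Quotient H C≤H using (quotient; _≡ᴴ_; ≈⇒≡ᴴ)
  private module Q = AbelianGroup quotient
  open AlmostEverywhere em G

  -- f is total, with junk values outside D.
  record AlmostHom (f : G.Carrier → H.Carrier) : Set (Level.suc ℓ) where
    field
      D      : Pred G.Carrier ℓ
      D≤G    : IsSubgroup G D
      finite : FiniteIndex G D
      cong   : ∀ {x y} → x ∈ D → y ∈ D → x G.≈ y → f x ≡ᴴ f y
      homo   : ∀ {x y} → x ∈ D → y ∈ D → f (x G.∙ y) ≡ᴴ f x H.∙ f y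

    private
      module D = IsSubgroup D≤G
      open AbelianGroupProperties quotient using (identityˡ-unique; inverseˡ-unique)

    everywhere : Almost D
    everywhere = almost D≤G finite

    ε-homo : f G.ε ≡ᴴ H.ε
    ε-homo = identityˡ-unique (f G.ε) (f G.ε)
      (Q.trans (Q.sym (homo D.ε-closed D.ε-closed))
               (cong (D.∙-closed D.ε-closed D.ε-closed) D.ε-closed (G.identityˡ G.ε)))

    ⁻¹-homo : ∀ {x} → x ∈ D → f (x G.⁻¹) ≡ᴴ f x H.⁻¹
    ⁻¹-homo {x} p = inverseˡ-unique (f (x G.⁻¹)) (f x)
      (Q.trans (Q.sym (homo (D.⁻¹-closed p) p))
        (Q.trans (cong (D.∙-closed (D.⁻¹-closed p) p) D.ε-closed (G.inverseˡ x)) ε-homo))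

    -‿homo : ∀ {x y} → x ∈ D → y ∈ D → f (x G.- y) ≡ᴴ f x H.- f y
    -‿homo {x} {y} p q = Q.trans (homo p (D.⁻¹-closed q)) (Q.∙-cong (Q.refl {f x}) (⁻¹-homo q))

    restrict : ∀ {E} → IsSubgroup G E → FiniteIndex G E → AlmostHom f
    restrict {E} E≤G fin = record
      { D      = D ∩ E
      ; D≤G    = SG.∩-isSubgroup D≤G E≤G
      ; finite = SG.FiniteMod-∩ D≤G E≤G finite fin
      ; cong   = λ (p , _) (q , _) → cong p q
      ; homo   = λ (p , _) (q , _) → homo p q
      }

  ∈⇒≡ε : ∀ {a} → a ∈ C → a ≡ᴴ H.ε
  ∈⇒≡ε {a} p = C.respects (solve (a ∷ []) (# 0F) (# 0F ⊖ 𝟘) ≡.refl) p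
    where open AbelianGroupSolver H

  ≡ε⇒∈ : ∀ {a} → a ≡ᴴ H.ε → a ∈ C
  ≡ε⇒∈ {a} p = C.respects (solve (a ∷ []) (# 0F ⊖ 𝟘) (# 0F) ≡.refl) p
    where open AbelianGroupSolver H

  kernel-isSubgroup : ∀ {f} (hom : AlmostHom f) → IsSubgroup G (λ x → x ∈ AlmostHom.D hom × f x ∈ C)
  kernel-isSubgroup {f} hom = record
    { respects  = λ {x} {y} e (p , q) → let p′ = KD.respects e p in
                  p′ , SH.-‿member C≤H {f y} {f x} (Q.sym {f x} {f y} (K.cong p p′ e)) q
    ; ε-closed  = KD.ε-closed , ≡ε⇒∈ K.ε-homo
    ; ∙-closed  = λ {x} {y} (p , q) (p′ , q′) →
                  KD.∙-closed p p′ , SH.-‿member C≤H (K.homo p p′) (C.∙-closed q q′)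
    ; ⁻¹-closed = λ {x} (p , q) → KD.⁻¹-closed p , SH.-‿member C≤H (K.⁻¹-homo p) (C.⁻¹-closed q)
    }
    where
    module K = AlmostHom hom
    module KD = IsSubgroup K.D≤G

  -- A homomorphism with finite image has a kernel of finite index. Every finite discrepancy met
  -- later is removed in this way, by shrinking the domain.
  vanishes : ∀ {F : Pred H.Carrier ℓ} {f} → AlmostHom f → Almost (λ x → f x ∈ F) → SH.FiniteMod F C →
             Almost (λ x → f x ∈ C)
  vanishes {F} {f} hom (E , E≤G , E-fin , E⊆F) fin =
    (λ x → x ∈ K.D × f x ∈ C) , kernel , FiniteMod-trans kernel K.finite kernel-fin , proj₂
    where
    module K = AlmostHom (AlmostHom.restrict hom E≤G E-fin)
    module KD = IsSubgroup K.D≤G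
    kernel : IsSubgroup G (λ x → x ∈ K.D × f x ∈ C)
    kernel = kernel-isSubgroup (AlmostHom.restrict hom E≤G E-fin)
    kernel-fin : SG.FiniteMod K.D (λ x → x ∈ K.D × f x ∈ C)
    kernel-fin = Preimages.FiniteMod-preimage em G H {K = K.D} {F} {λ x → x ∈ K.D × f x ∈ C} {C} C≤H f
      (λ (_ , p) → E⊆F p)
      (λ p q r → KD.∙-closed p (KD.⁻¹-closed q) , SH.-‿member C≤H (K.-‿homo p q) r) fin

  additive⇒AlmostHom : ∀ {θ} → Additive.IsAdditive G H θ → AlmostHom θ
  additive⇒AlmostHom add = record
    { D      = λ _ → Unit.⊤
    ; D≤G    = _
    ; finite = G.ε ∷ [] , _ ∷ [] , λ _ → here _
    ; cong   = λ _ _ e → ≈⇒≡ᴴ (⟦⟧-cong e)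
    ; homo   = λ {x} {y} _ _ → ≈⇒≡ᴴ (+-homo x y)
    }
    where open Additive.IsAdditive add

  AlmostHom-sub : ∀ {f g} → AlmostHom f → AlmostHom g → AlmostHom (λ x → f x H.- g x)
  AlmostHom-sub {f} {g} F G = record
    { D      = λ x → x ∈ F′.D × x ∈ G′.D
    ; D≤G    = SG.∩-isSubgroup F′.D≤G G′.D≤G
    ; finite = SG.FiniteMod-∩ F′.D≤G G′.D≤G F′.finite G′.finite
    ; cong   = λ {x} {y} (p , q) (p′ , q′) e →
        Q.∙-cong {f x} {f y} (F′.cong p p′ e) (Q.⁻¹-cong {g x} {g y} (G′.cong q q′ e))
    ; homo   = λ {x} {y} (p , q) (p′ , q′) →
        Q.trans (Q.∙-cong (F′.homo p p′) (Q.⁻¹-cong (G′.homo q q′)))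
          (≈⇒≡ᴴ (solve (f x ∷ f y ∷ g x ∷ g y ∷ [])
            ((# 0F ⊕ # 1F) ⊖ (# 2F ⊕ # 3F)) ((# 0F ⊖ # 2F) ⊕ (# 1F ⊖ # 3F)) ≡.refl))
    }
    where
    module F′ = AlmostHom F
    module G′ = AlmostHom G
    open AbelianGroupSolver H

  AlmostHom-∘ : ∀ {f} {θ : G.Carrier → G.Carrier} → AlmostHom f → Additive.IsAdditive G G θ → AlmostHom (λ x → f (θ x))
  AlmostHom-∘ {f} {θ} F add = record
    { D      = λ x → θ x ∈ F.D
    ; D≤G    = preimage-isSubgroup F.D≤G
    ; finite = Almost⇒FiniteIndex (Almost-preimage add F.everywhere)
    ; cong   = λ p q e → F.cong p q (⟦⟧-cong e)
    ; homo   = λ {x} {y} p q → let pq = IsSubgroup.∙-closed F.D≤G p q in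
        Q.trans (F.cong (IsSubgroup.respects F.D≤G (G.sym (+-homo x y)) pq) pq (+-homo x y)) (F.homo p q)
    }
    where
    module F = AlmostHom F
    open Additive.IsAdditive add

  additive-∘ : ∀ {f} {ψ : H.Carrier → H.Carrier} → AlmostHom f → Additive.IsAdditive H H ψ →
               (∀ {a} → a ∈ C → ψ a ∈ C) → AlmostHom (λ x → ψ (f x))
  additive-∘ {f} {ψ} F add stable = record
    { D      = F.D
    ; D≤G    = F.D≤G
    ; finite = F.finite
    ; cong   = λ p q e → ψ-cong (F.cong p q e)
    ; homo   = λ p q → Q.trans (ψ-cong (F.homo p q)) (≈⇒≡ᴴ (+-homo _ _))
    }
    where
    module F = AlmostHom F
    open Additive.IsAdditive add
    ψ-cong : ∀ {a b} → a ≡ᴴ b → ψ a ≡ᴴ ψ b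
    ψ-cong {a} {b} e = C.respects (sub-homo a b) (stable e)

-- Sections of the module and their almost cohomology

module Setting
  {ℓ : Level} {𝓛 : Signature ℓ} {T : Theory 𝓛} (em : ∀ {p} → ExcludedMiddle p) (FD : FiniteDimensional T)
  (M : Model T) (𝔤 : LieRing ℓ) (A : LieModule 𝔤) (Δ : DefinableIn (Model.structure M) 𝔤 A)
  where

  module L = LieRing 𝔤
  module A = LieModule A
  L₊ = L.additiveGroup
  A₊ = A.additiveGroup
  module L₊ = AbelianGroup L₊
  module A₊ = AbelianGroup A₊
  open L public using (⁅_,_⁆) renaming (Carrier to Lᶜ; _≈_ to _≈ᴸ_; _+_ to _+ᴸ_; _-_ to _-ᴸ_; -_ to -ᴸ_)
  open A public using (_·_; _≈_; _+_; _-_; -_; 0#) renaming (Carrier to Aᶜ)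
  open LinearAction 𝔤 A public
  private module Δ = DefinableIn Δ

  group : Sorts → AbelianGroup ℓ ℓ
  group 𝕃 = L₊
  group 𝔸 = A₊

  arity : Sorts → ℕ
  arity 𝕃 = Δ.arityᴸ
  arity 𝔸 = Δ.arityᴬ

  coord : ∀ s → Injection (AbelianGroup.setoid (group s)) (≡.setoid (Vec ∣ Model.structure M ∣ (arity s)))
  coord 𝕃 = Δ.coordᴸ
  coord 𝔸 = Δ.coordᴬ

  image : ∀ s → IsDefinable (Model.structure M) (λ v → ∃[ x ] v ≡ Injection.to (coord s) x)
  image 𝕃 = Δ.imageᴸ
  image 𝔸 = Δ.imageᴬ

  open Coordinates (Model.structure M) Sorts group arity coord image public
  open Dimensions em FD M Sorts group arity coord image public

  𝐋 𝐀 : Code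
  𝐋 = base 𝕃
  𝐀 = base 𝔸

  addᴸ : Graph (𝐋 ⊗ 𝐋) 𝐋 (λ z → proj₁ z +ᴸ proj₂ z)
  addᴸ = opᴳ {𝐋} {𝐋} {𝐋} _+ᴸ_ L₊.∙-cong Δ.sumᴸ

  addᴬ : Graph (𝐀 ⊗ 𝐀) 𝐀 (λ z → proj₁ z + proj₂ z)
  addᴬ = opᴳ {𝐀} {𝐀} {𝐀} _+_ A₊.∙-cong Δ.sumᴬ

  module 𝐋 = Quotients 𝕃 addᴸ
  module 𝐀 = Quotients 𝔸 addᴬ

  private
    variable
      Γ : Code

  bracketᵗ : Tm Γ 𝐋 → Tm Γ 𝐋 → Tm Γ 𝐋
  bracketᵗ t u = mapᵗ (opᴳ {𝐋} {𝐋} {𝐋} ⁅_,_⁆ L.⁅⁆-cong Δ.bracket) ⟨ t , u ⟩ᵗ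

  actᵗ : Tm Γ 𝐋 → Tm Γ 𝐀 → Tm Γ 𝐀
  actᵗ t u = mapᵗ (opᴳ {𝐋} {𝐀} {𝐀} _·_ A.·-cong Δ.action) ⟨ t , u ⟩ᵗ

  module SL = Subgroups em L₊
  module SA = Subgroups em A₊
  open AlmostEverywhere em L₊ public
  open 𝐋.Subgroupᴰ public using () renaming (Carrierˢ to ∣_∣ᴸ; isSubgroup to ≤ᴸ; defˢ to defᴸ)
  open 𝐀.Subgroupᴰ public using () renaming (Carrierˢ to ∣_∣ᴬ; isSubgroup to ≤ᴬ; defˢ to defᴬ)

  FI : Pred Lᶜ ℓ → Set ℓ
  FI = FiniteIndex L₊

  v₀ : ∀ {a} → Tm (a ⊗ Γ) a
  v₀ = projection (fstᴾ idᴾ)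

  -- Stabilisers are the case `X = Y`; the annihilator of the section B/C is the case `X = B`,
  -- `Y = C`.
  Transporter : 𝐀.Subgroupᴰ → 𝐀.Subgroupᴰ → 𝐋.Subgroupᴰ
  Transporter X Y = record
    { Carrierˢ   = λ x → ∀ b → b ∈ ∣ X ∣ᴬ → x · b ∈ ∣ Y ∣ᴬ
    ; isSubgroup = record
      { respects  = λ e h b p → respects (A.·-cong e A₊.refl) (h b p)
      ; ε-closed  = λ b _ → respects (A₊.sym (0-homo (·-additiveˡ b))) ε-closed
      ; ∙-closed  = λ h k b p → respects (A₊.sym (+-homo (·-additiveˡ b) _ _)) (∙-closed (h b p) (k b p))
      ; ⁻¹-closed = λ h b p → respects (A₊.sym (neg-homo (·-additiveˡ b) _)) (⁻¹-closed (h b p))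
      }
    ; defˢ       = ∀ᴰ (projectᴰ (fstᴾ idᴾ) (defᴬ X) ⇒ᴰ atᴰ (defᴬ Y) (actᵗ (projection (sndᴾ idᴾ)) v₀))
    }
    where
    open IsSubgroup (≤ᴬ Y)
    open Additive.IsAdditive

  Stabiliser : 𝐀.Subgroupᴰ → 𝐋.Subgroupᴰ
  Stabiliser X = Transporter X X

  bracket-act : ∀ x y a → x · y · a ≈ y · x · a + ⁅ x , y ⁆ · a
  bracket-act x y a = A₊.trans
    (solve (x · y · a ∷ y · x · a ∷ []) (# 0F) (# 1F ⊕ (# 0F ⊖ # 1F)) ≡.refl)
    (A₊.∙-congˡ (A₊.sym (A.·-⁅⁆ x y a)))
    where open AbelianGroupSolver A₊

  -- B and C are stable only under subrings of finite index: this admits the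
  -- kernels of operators commuting with almost all of 𝔤.
  record Section : Set (Level.suc ℓ) where
    field
      B C     : 𝐀.Subgroupᴰ
      C⊆B     : ∣ C ∣ᴬ ⊆ ∣ B ∣ᴬ
      stableB : FI ∣ Stabiliser B ∣ᴸ
      stableC : FI ∣ Stabiliser C ∣ᴸ

  module SectionTheory (S : Section) where
    open Section S public
    open Quotient A₊ (≤ᴬ C) public using (_≡ᴴ_; ≈⇒≡ᴴ) renaming (quotient to A/C)
    module Q = AbelianGroup A/C
    module C = IsSubgroup (≤ᴬ C)
    module B = IsSubgroup (≤ᴬ B)
    open AlmostHoms em L₊ A₊ (≤ᴬ C) public
    open AlmostHom public using (D; D≤G; everywhere)

    𝔥 : Pred Lᶜ ℓ
    𝔥 x = x ∈ ∣ Stabiliser B ∣ᴸ × x ∈ ∣ Stabiliser C ∣ᴸ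

    almost-𝔥 : Almost 𝔥
    almost-𝔥 = Almost-∩ (almost (≤ᴸ (Stabiliser B)) stableB) (almost (≤ᴸ (Stabiliser C)) stableC)

    ·-cong-mod : ∀ {x a b} → x ∈ 𝔥 → a ≡ᴴ b → x · a ≡ᴴ x · b
    ·-cong-mod {x} {a} {b} (_ , h) p = C.respects (sub-homo a b) (h _ p)
      where open Additive.IsAdditive (·-additiveʳ x)

    ·-sub : ∀ x a b → x · (a - b) ≡ᴴ x · a - x · b
    ·-sub x a b = ≈⇒≡ᴴ (Additive.IsAdditive.sub-homo (·-additiveʳ x) a b)

    ·-add : ∀ x a b → x · (a + b) ≡ᴴ x · a + x · b
    ·-add x a b = ≈⇒≡ᴴ (A.·-distˡ x a b)

    ·-neg : ∀ x a → x · (- a) ≡ᴴ - (x · a)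
    ·-neg x a = ≈⇒≡ᴴ (Additive.IsAdditive.neg-homo (·-additiveʳ x) a)

    ≡-∈ : ∀ {a b} → a ≡ᴴ b → b ∈ ∣ C ∣ᴬ → a ∈ ∣ C ∣ᴬ
    ≡-∈ {a} {b} p q = SA.-‿member (≤ᴬ C) p q

    Killing : Aᶜ → Pred Lᶜ ℓ
    Killing b x = x · b ∈ ∣ C ∣ᴬ

    killing-subgroup : ∀ b → IsSubgroup L₊ (Killing b)
    killing-subgroup b = Additive.IsAdditive.preimage-isSubgroup (·-additiveˡ b) (≤ᴬ C)

    H⁰ : Pred Aᶜ ℓ
    H⁰ b = b ∈ ∣ B ∣ᴬ × FI (Killing b)

    H⁰-finite : Set ℓ
    H⁰-finite = SA.FiniteMod H⁰ ∣ C ∣ᴬ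

    almost⇒H⁰ : ∀ {b} → b ∈ ∣ B ∣ᴬ → Almost (Killing b) → b ∈ H⁰
    almost⇒H⁰ {b} p h = p , Almost⇒FiniteIndex {Killing b} h

    H⁰⇒almost : ∀ {b} → b ∈ H⁰ → Almost (Killing b)
    H⁰⇒almost {b} (_ , h) = almost (killing-subgroup b) h

    -- One subgroup serves both as the domain and as the set of `x` at which the derivation rule
    -- holds for almost all `y`; values count modulo `C`.
    record AlmostDerivation (f : Lᶜ → Aᶜ) : Set (Level.suc ℓ) where
      field
        hom    : AlmostHom f
        into   : ∀ {x} → x ∈ D hom → f x ∈ ∣ B ∣ᴬ
        derive : ∀ {x} → x ∈ D hom → Almost (λ y → f ⁅ x , y ⁆ ≡ᴴ x · f y - y · f x)

      open AlmostHom hom public using () renaming (D to D′; D≤G to D′≤L)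

    open AlmostDerivation public using (hom; into; derive; D′; D′≤L)

    infix 4 _≃_

    _≃_ : Rel (Lᶜ → Aᶜ) (Level.suc ℓ)
    f ≃ g = ∃[ a ] a ∈ ∣ B ∣ᴬ × Almost (λ x → f x ≡ᴴ g x + x · a)

    H¹-finite : Set (Level.suc ℓ)
    H¹-finite = FiniteUpTo _≃_ AlmostDerivation

    inner : ∀ {a} → a ∈ ∣ B ∣ᴬ → AlmostDerivation (_· a)
    inner {a} p = record
      { hom    = AlmostHom.restrict (additive⇒AlmostHom (·-additiveˡ a)) (≤ᴸ (Stabiliser B)) stableB
      ; into   = λ (_ , h) → h a p
      ; derive = λ {x} _ → Almost-map (λ {y} _ → ≈⇒≡ᴴ (A.·-⁅⁆ x y a)) almost-𝔥
      }

    derivation-sub : ∀ {f g} → AlmostDerivation f → AlmostDerivation g → AlmostDerivation (λ x → f x - g x)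
    derivation-sub {f} {g} ∂ δ = record
      { hom    = AlmostHom-sub (hom ∂) (hom δ)
      ; into   = λ (p , q) → SA.-‿closed (≤ᴬ B) (into ∂ p) (into δ q)
      ; derive = λ {x} (p , q) → Almost-map (λ {y} (h , k) → begin
          f ⁅ x , y ⁆ - g ⁅ x , y ⁆
            ≈⟨ Q.∙-cong h (Q.⁻¹-cong k) ⟩
          (x · f y - y · f x) - (x · g y - y · g x)
            ≈⟨ ≈⇒≡ᴴ (solve (x · f y ∷ y · f x ∷ x · g y ∷ y · g x ∷ [])
                 ((# 0F ⊖ # 1F) ⊖ (# 2F ⊖ # 3F)) ((# 0F ⊖ # 2F) ⊖ (# 1F ⊖ # 3F)) ≡.refl) ⟩
          (x · f y - x · g y) - (y · f x - y · g x)
            ≈⟨ Q.∙-cong (·-sub x (f y) (g y)) (Q.⁻¹-cong (·-sub y (f x) (g x))) ⟨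
          x · (f y - g y) - y · (f x - g x) ∎) (Almost-∩ (derive ∂ p) (derive δ q))
      }
      where
      open AbelianGroupSolver A₊
      open SetoidReasoning Q.setoid

    -- Maps into the finite group B/C vanish almost everywhere, so the zero map, written as the
    -- inner derivation of `0#`, represents every class.
    finite⇒H¹-finite : SA.FiniteMod ∣ B ∣ᴬ ∣ C ∣ᴬ → H¹-finite
    finite⇒H¹-finite fin = (_· 0#) ∷ [] , inner B.ε-closed ∷ [] , λ {f} ∂ →
      here (0# , B.ε-closed , Almost-map (λ {x} p → Q.trans (∈⇒≡ε p)
          (Q.sym (≈⇒≡ᴴ (A₊.trans (A₊.∙-cong (0-homo (·-additiveʳ x)) (0-homo (·-additiveʳ x))) (A₊.identityˡ 0#)))))
        (vanishes (hom ∂) (Almost-map (into ∂) (everywhere (hom ∂))) fin))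
      where open Additive.IsAdditive

-- The exact sequence of a section C ≤ K ≤ B

module Extension
  {ℓ : Level} {𝓛 : Signature ℓ} {T : Theory 𝓛} (em : ∀ {p} → ExcludedMiddle p) (FD : FiniteDimensional T)
  (M : Model T) (𝔤 : LieRing ℓ) (A : LieModule 𝔤) (Δ : DefinableIn (Model.structure M) 𝔤 A)
  where

  open Setting em FD M 𝔤 A Δ
  open FiniteCovers em
  open AbelianGroupSolver A₊ using (solve; #_; 𝟘; _⊕_; _⊖_)

  module _ (S : Section) (K : 𝐀.Subgroupᴰ)
           (C⊆K : ∣ Section.C S ∣ᴬ ⊆ ∣ K ∣ᴬ) (K⊆B : ∣ K ∣ᴬ ⊆ ∣ Section.B S ∣ᴬ)
           (stableK : FI ∣ Stabiliser K ∣ᴸ) where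

    sub quo : Section
    sub = record { Section S using (C; stableC) ; B = K ; C⊆B = C⊆K ; stableB = stableK }
    quo = record { Section S using (B; stableB) ; C = K ; C⊆B = K⊆B ; stableC = stableK }

    private
      module S = SectionTheory S
      module Sub = SectionTheory sub
      module Quo = SectionTheory quo
    open S using (_≡ᴴ_; ≈⇒≡ᴴ; module C; ·-sub; ·-add)
    private
      module Q = S.Q
      module K = IsSubgroup (≤ᴬ K)
    open SetoidReasoning Q.setoid

    H⁰-finite-sub : S.H⁰-finite → Sub.H⁰-finite
    H⁰-finite-sub = SA.FiniteMod-sub {K = Sub.H⁰} {S.H⁰} (≤ᴬ S.C) λ (p , h) → K⊆B p , h

    private
      -- The connecting map from H⁰(B/K) to H¹(K/C): almost all `x` send `b` into `K`, and
      -- `x ↦ x · b` is cut down to those.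
      inner-sub : ∀ {b} → b ∈ Quo.H⁰ → Sub.AlmostDerivation (_· b)
      inner-sub {b} (_ , fin) = record
        { hom    = Sub.AlmostHom.restrict (Sub.additive⇒AlmostHom (·-additiveˡ b)) (Quo.killing-subgroup b) fin
        ; into   = λ (_ , p) → p
        ; derive = λ {x} _ → Almost-map (λ {y} _ → ≈⇒≡ᴴ (A.·-⁅⁆ x y b)) S.almost-𝔥
        }

      toQuo : ∀ {f} → S.AlmostDerivation f → Quo.AlmostDerivation f
      toQuo ∂ = record
        { hom    = record
          { D = S.D′ ∂ ; D≤G = S.D′≤L ∂ ; finite = S.AlmostHom.finite (S.hom ∂)
          ; cong = λ p q e → C⊆K (S.AlmostHom.cong (S.hom ∂) p q e)
          ; homo = λ p q → C⊆K (S.AlmostHom.homo (S.hom ∂) p q)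
          }
        ; into   = S.into ∂
        ; derive = λ p → Almost-map C⊆K (S.derive ∂ p)
        }

    -- Exactness at H⁰(B/K): if `b` and `b₀` have the same image in H¹(K/C), their difference,
    -- corrected by an element of `K`, lies in H⁰(B/C). Hence each of the finitely many fibres of
    -- the connecting map is finite modulo `K`.
    H⁰-finite-quotient : Sub.H¹-finite → S.H⁰-finite → Quo.H⁰-finite
    H⁰-finite-quotient (fs , ∂s , cover) fin = FiniteUpTo-refine
      (λ b f → (_· b) Sub.≃ f) fs ∂s (λ h → cover (inner-sub h)) λ {f} _ → class f
      where
      class : ∀ f → SA.FiniteMod (λ b → b ∈ Quo.H⁰ × ((_· b) Sub.≃ f)) ∣ K ∣ᴬ
      class f with em {P = ∃[ b ] b ∈ Quo.H⁰ × ((_· b) Sub.≃ f)}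
      ... | no none = [] , [] , λ p → contradiction (_ , p) none
      ... | yes (b₀ , (b₀∈B , _) , a₀ , a₀∈K , h₀) =
        FiniteUpTo-transfer (λ b c → ∃[ a ] a ∈ ∣ K ∣ᴬ × (b - b₀) - a ≈ c) fin total separate
        where
        total : ∀ {b} → b ∈ Quo.H⁰ × ((_· b) Sub.≃ f) → ∃[ c ] c ∈ S.H⁰ × ∃[ a ] a ∈ ∣ K ∣ᴬ × (b - b₀) - a ≈ c
        total {b} ((b∈B , _) , a , a∈K , h) =
          -- Almost everywhere `x · b` is `f x + x · a` and `x · b₀` is `f x + x · a₀`, so
          -- subtracting `a - a₀` cancels all that remains.
          (b - b₀) - (a - a₀) ,
          S.almost⇒H⁰ (SA.-‿closed (≤ᴬ S.B) (SA.-‿closed (≤ᴬ S.B) b∈B b₀∈B) (K⊆B (SA.-‿closed (≤ᴬ K) a∈K a₀∈K)))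
            (Almost-map (λ {x} (p , q) → S.≡ε⇒∈ (begin
                x · ((b - b₀) - (a - a₀))                ≈⟨ ·-sub x (b - b₀) (a - a₀) ⟩
                x · (b - b₀) - x · (a - a₀)              ≈⟨ Q.∙-cong (·-sub x b b₀) (Q.⁻¹-cong (·-sub x a a₀)) ⟩
                (x · b - x · b₀) - (x · a - x · a₀)      ≈⟨ Q.∙-cong (Q.∙-cong p (Q.⁻¹-cong q)) Q.refl ⟩
                ((f x + x · a) - (f x + x · a₀)) - (x · a - x · a₀)
                  ≈⟨ ≈⇒≡ᴴ (solve (f x ∷ x · a ∷ x · a₀ ∷ [])
                       (((# 0F ⊕ # 1F) ⊖ (# 0F ⊕ # 2F)) ⊖ (# 1F ⊖ # 2F)) 𝟘 ≡.refl) ⟩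
                0# ∎))
              (Almost-∩ h h₀)) ,
          a - a₀ , SA.-‿closed (≤ᴬ K) a∈K a₀∈K , A₊.refl
        separate : ∀ {b b′ c c′ z} → b ∈ Quo.H⁰ × ((_· b) Sub.≃ f) → b′ ∈ Quo.H⁰ × ((_· b′) Sub.≃ f) →
          c ∈ S.H⁰ → c′ ∈ S.H⁰ → z ∈ S.H⁰ →
          (∃[ a ] a ∈ ∣ K ∣ᴬ × (b - b₀) - a ≈ c) → (∃[ a ] a ∈ ∣ K ∣ᴬ × (b′ - b₀) - a ≈ c′) →
          c - z ∈ ∣ S.C ∣ᴬ → c′ - z ∈ ∣ S.C ∣ᴬ → b - b′ ∈ ∣ K ∣ᴬ
        separate {b} {b′} _ _ _ _ _ (a , a∈K , e) (a′ , a′∈K , e′) p p′ = K.respects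
          (A₊.trans (A₊.∙-congʳ (A₊.∙-cong (A₊.sym e) (A₊.⁻¹-cong (A₊.sym e′))))
            (solve (b ∷ b′ ∷ b₀ ∷ a ∷ a′ ∷ [])
              ((((# 0F ⊖ # 2F) ⊖ # 3F) ⊖ ((# 1F ⊖ # 2F) ⊖ # 4F)) ⊕ (# 3F ⊖ # 4F)) (# 0F ⊖ # 1F) ≡.refl))
          (K.∙-closed (C⊆K (SA.-‿trans (≤ᴬ S.C) p (SA.-‿flip (≤ᴬ S.C) p′))) (SA.-‿closed (≤ᴬ K) a∈K a′∈K))

    -- Exactness at H¹(B/C): almost derivations with the same image in H¹(B/K) differ by an inner
    -- one and one with values in `K`. `Near` records this decomposition relative to a fixed `f₀`.
    H¹-finite-extension : Quo.H¹-finite → Sub.H¹-finite → S.H¹-finite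
    H¹-finite-extension (gs , ∂s , cover) fin = FiniteUpTo-refine
      (λ f g → f Quo.≃ g) gs ∂s (λ ∂ → cover (toQuo ∂)) λ {g} _ → class g
      where
      Near : (Lᶜ → Aᶜ) → (Lᶜ → Aᶜ) → (Lᶜ → Aᶜ) → Set (Level.suc ℓ)
      Near f₀ f h = ∃[ a ] a ∈ ∣ S.B ∣ᴬ × Almost (λ x → f x ≡ᴴ (f₀ x + x · a) + h x)
      class : ∀ g → FiniteUpTo S._≃_ (λ f → S.AlmostDerivation f × f Quo.≃ g)
      class g with em {P = ∃[ f ] S.AlmostDerivation f × f Quo.≃ g}
      ... | no none = [] , [] , λ p → contradiction (_ , p) none
      ... | yes (f₀ , ∂₀ , a₀ , a₀∈B , h₀) = FiniteUpTo-transfer (Near f₀) fin total separate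
        where
        total : ∀ {f} → S.AlmostDerivation f × f Quo.≃ g → ∃[ h ] Sub.AlmostDerivation h × Near f₀ f h
        total {f} (∂ , a , a∈B , h) = k ,
          -- The values lie in `K` only almost everywhere, so the domain shrinks to the subgroup on
          -- which they do.
          record { hom = S.AlmostHom.restrict (S.hom δ) E≤L E-fin
                 ; into = λ (_ , p) → E⊆ p
                 ; derive = λ (p , _) → S.derive δ p } ,
          a - a₀ , a-a₀∈B ,
          Almost-map (λ {x} _ → ≈⇒≡ᴴ (solve (f x ∷ f₀ x ∷ x · (a - a₀) ∷ [])
            (# 0F) ((# 1F ⊕ # 2F) ⊕ ((# 0F ⊖ # 1F) ⊖ # 2F)) ≡.refl)) S.almost-𝔥
          where
          a-a₀∈B = SA.-‿closed (≤ᴬ S.B) a∈B a₀∈B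
          k : Lᶜ → Aᶜ
          k x = (f x - f₀ x) - x · (a - a₀)
          δ : S.AlmostDerivation k
          δ = S.derivation-sub (S.derivation-sub ∂ ∂₀) (S.inner a-a₀∈B)
          inK : Almost (λ x → k x ∈ ∣ K ∣ᴬ)
          inK = Almost-map (λ {x} (p , q) → K.respects
            (A₊.trans
              (solve (f x ∷ f₀ x ∷ x · a ∷ x · a₀ ∷ g x ∷ [])
                ((# 0F ⊖ (# 4F ⊕ # 2F)) ⊖ (# 1F ⊖ (# 4F ⊕ # 3F))) ((# 0F ⊖ # 1F) ⊖ (# 2F ⊖ # 3F)) ≡.refl)
              (A₊.∙-congˡ (A₊.⁻¹-cong (A₊.sym (Additive.IsAdditive.sub-homo (·-additiveʳ x) a a₀)))))
            (SA.-‿closed (≤ᴬ K) p q)) (Almost-∩ h h₀)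
          E≤L = proj₁ (proj₂ inK)
          E-fin = proj₁ (proj₂ (proj₂ inK))
          E⊆ = proj₂ (proj₂ (proj₂ inK))
        separate : ∀ {f f′ k k′ z} → S.AlmostDerivation f × f Quo.≃ g → S.AlmostDerivation f′ × f′ Quo.≃ g →
          Sub.AlmostDerivation k → Sub.AlmostDerivation k′ → Sub.AlmostDerivation z →
          Near f₀ f k → Near f₀ f′ k′ → k Sub.≃ z → k′ Sub.≃ z → f S.≃ f′
        separate {f} {f′} {k} {k′} {z} _ _ _ _ _ (a , a∈B , h) (a′ , a′∈B , h′) (b , b∈K , j) (b′ , b′∈K , j′) =
          (a - a′) + (b - b′) ,
          S.B.∙-closed (SA.-‿closed (≤ᴬ S.B) a∈B a′∈B) (SA.-‿closed (≤ᴬ S.B) (K⊆B b∈K) (K⊆B b′∈K)) ,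
          Almost-map (λ {x} ((p , p′) , (q , q′)) → begin
            f x                                        ≈⟨ p ⟩
            (f₀ x + x · a) + k x                       ≈⟨ Q.∙-cong Q.refl q ⟩
            (f₀ x + x · a) + (z x + x · b)
              ≈⟨ ≈⇒≡ᴴ (solve (f₀ x ∷ x · a ∷ x · a′ ∷ z x ∷ x · b ∷ x · b′ ∷ [])
                   ((# 0F ⊕ # 1F) ⊕ (# 3F ⊕ # 4F))
                   (((# 0F ⊕ # 2F) ⊕ (# 3F ⊕ # 5F)) ⊕ ((# 1F ⊖ # 2F) ⊕ (# 4F ⊖ # 5F))) ≡.refl) ⟩
            ((f₀ x + x · a′) + (z x + x · b′)) + ((x · a - x · a′) + (x · b - x · b′))
              ≈⟨ Q.∙-cong (Q.trans (Q.∙-cong Q.refl (Q.sym q′)) (Q.sym p′))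
                   (Q.sym (Q.trans (·-add x (a - a′) (b - b′)) (Q.∙-cong (·-sub x a a′) (·-sub x b b′)))) ⟩
            f′ x + x · ((a - a′) + (b - b′)) ∎)
          (Almost-∩ (Almost-∩ h h′) (Almost-∩ j j′))

-- Factoring out H⁰

module Reduction
  {ℓ : Level} {𝓛 : Signature ℓ} {T : Theory 𝓛} (em : ∀ {p} → ExcludedMiddle p) (FD : FiniteDimensional T)
  (M : Model T) (𝔤 : LieRing ℓ) (A : LieModule 𝔤) (Δ : DefinableIn (Model.structure M) 𝔤 A)
  where

  open Setting em FD M 𝔤 A Δ
  open FiniteCovers em
  open AbelianGroupSolver A₊ using (solve; #_; _⊕_; _⊖_)

  Anyᴰ : ∀ {a} {P : El a → El a → Set ℓ} (rs : List (El a)) → (∀ r → Def a (λ b → P b r)) →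
         Def a (λ b → Any (P b) rs)
  Anyᴰ []       D = Def-⇔ (λ _ → mk⇔ (λ ()) (λ ())) ⊥ᴰ
  Anyᴰ (r ∷ rs) D = Def-⇔ (λ _ → mk⇔ Any.fromSum Any.toSum) (D r ∨ᴰ Anyᴰ rs D)

  module _ (S : Section) (fin : SectionTheory.H⁰-finite S) where
    private module S = SectionTheory S
    open S using (_≡ᴴ_; module C)
    private
      module Q = S.Q
      open Additive.IsAdditive

    C⊆H⁰ : ∣ S.C ∣ᴬ ⊆ S.H⁰
    C⊆H⁰ {c} p = S.almost⇒H⁰ (S.C⊆B p) (Almost-map (λ (_ , h) → h c p) S.almost-𝔥)

    H⁰-isSubgroup : IsSubgroup A₊ S.H⁰
    H⁰-isSubgroup = record
      { respects  = λ e (p , h) → S.B.respects e p ,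
          SL.FiniteMod-mono {H = S.Killing _} {S.Killing _} (λ q → C.respects (A.·-cong L₊.refl e) q) h
      ; ε-closed  = C⊆H⁰ C.ε-closed
      ; ∙-closed  = λ {a} {b} p q → S.almost⇒H⁰ (S.B.∙-closed (proj₁ p) (proj₁ q))
          (Almost-map (λ {x} (h , k) → C.respects (A₊.sym (+-homo (·-additiveʳ x) a b)) (C.∙-closed h k))
            (Almost-∩ (S.H⁰⇒almost p) (S.H⁰⇒almost q)))
      ; ⁻¹-closed = λ {a} p → S.almost⇒H⁰ (S.B.⁻¹-closed (proj₁ p))
          (Almost-map (λ {x} h → C.respects (A₊.sym (neg-homo (·-additiveʳ x) a)) (C.⁻¹-closed h)) (S.H⁰⇒almost p))
      }

    private
      reps = proj₁ fin

    -- Having a kernel of finite index is not a first-order condition on `b`. `H⁰` is definable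
    -- nevertheless, as a finite union of cosets of `C`.
    F : 𝐀.Subgroupᴰ
    F = record
      { Carrierˢ   = S.H⁰
      ; isSubgroup = H⁰-isSubgroup
      ; defˢ       = Def-⇔ (λ b → mk⇔ (member reps (proj₁ (proj₂ fin))) (proj₂ (proj₂ fin)))
          (Anyᴰ reps λ r → atᴰ (defᴬ S.C) (𝐀.subᵗ (projection idᴾ) (constᵗ r)))
      }
      where
      member : ∀ {b} rs → All S.H⁰ rs → Any (b ≡ᴴ_) rs → b ∈ S.H⁰
      member (r ∷ rs) (p ∷ ps) (here e)  = SA.-‿member H⁰-isSubgroup (C⊆H⁰ e) p
      member (r ∷ rs) (p ∷ ps) (there i) = member rs ps i

    -- For `g` in `𝔥`, the element `x · g · b` is the sum of `g · x · b` and `⁅ x , g ⁆ · b`. The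
    -- first lies in `C` for almost all `x`, and so does the second, because bracketing with `g`
    -- pulls finite index back to finite index.
    F-stable : FI ∣ Stabiliser F ∣ᴸ
    F-stable = Almost⇒FiniteIndex {∣ Stabiliser F ∣ᴸ} (Almost-map stable S.almost-𝔥)
      where
      stable : ∀ {g} → g ∈ S.𝔥 → g ∈ ∣ Stabiliser F ∣ᴸ
      stable {g} (gB , gC) b p = S.almost⇒H⁰ (gB b (proj₁ p))
        (Almost-map (λ {x} (h , k) → C.respects (A₊.sym (bracket-act x g b)) (C.∙-closed (gC _ h) k))
          (Almost-∩ (S.H⁰⇒almost p) (Almost-preimage (ad-additiveˡ g) (S.H⁰⇒almost p))))

    reduced : Section
    reduced = record { Section S using (B; stableB) ; C = F ; C⊆B = proj₁ ; stableC = F-stable }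

    private module R = SectionTheory reduced

    -- A single reduction suffices: if `x · b` lies in `F` for almost all `x`, it lies in `C` for
    -- almost all `x`, as `F` is finite modulo `C`.
    reduced-H⁰ : R.H⁰ ⊆ ∣ F ∣ᴬ
    reduced-H⁰ {b} p = S.almost⇒H⁰ (proj₁ p)
      (S.vanishes (S.additive⇒AlmostHom (·-additiveˡ b)) (R.H⁰⇒almost p) fin)

    -- If `f` and `f′` agree modulo `F` up to an inner derivation, the remaining difference is
    -- almost everywhere a homomorphism into the finite F/C, so it vanishes modulo `C` on a smaller
    -- domain.
    H¹-finite-reduced : R.H¹-finite → S.H¹-finite
    H¹-finite-reduced fin¹ = FiniteUpTo-transfer (λ f g → f ≡ g) fin¹
      (λ ∂ → _ , toR ∂ , ≡.refl) λ where ∂ ∂′ _ _ _ ≡.refl ≡.refl → separate ∂ ∂′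
      where
      toR : ∀ {f} → S.AlmostDerivation f → R.AlmostDerivation f
      toR ∂ = record
        { hom    = record
          { D = S.D′ ∂ ; D≤G = S.D′≤L ∂ ; finite = S.AlmostHom.finite (S.hom ∂)
          ; cong = λ p q e → C⊆H⁰ (S.AlmostHom.cong (S.hom ∂) p q e)
          ; homo = λ p q → C⊆H⁰ (S.AlmostHom.homo (S.hom ∂) p q)
          }
        ; into   = S.into ∂
        ; derive = λ p → Almost-map C⊆H⁰ (S.derive ∂ p)
        }
      separate : ∀ {f f′ g} → S.AlmostDerivation f → S.AlmostDerivation f′ → f R.≃ g → f′ R.≃ g → f S.≃ f′
      separate {f} {f′} {g} ∂ ∂′ (a , a∈B , h) (a′ , a′∈B , h′) = a - a′ , a-a′∈B ,
        Almost-map (λ {x} p → C.respects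
          (solve (f x ∷ f′ x ∷ x · (a - a′) ∷ []) ((# 0F ⊖ # 1F) ⊖ # 2F) (# 0F ⊖ (# 1F ⊕ # 2F)) ≡.refl) p)
        (S.vanishes
          (S.AlmostHom-sub (S.AlmostHom-sub (S.hom ∂) (S.hom ∂′)) (S.additive⇒AlmostHom (·-additiveˡ (a - a′))))
          (Almost-map (λ {x} (p , p′) → IsSubgroup.respects H⁰-isSubgroup
            (A₊.trans
              (solve (f x ∷ f′ x ∷ x · a ∷ x · a′ ∷ g x ∷ [])
                ((# 0F ⊖ (# 4F ⊕ # 2F)) ⊖ (# 1F ⊖ (# 4F ⊕ # 3F))) ((# 0F ⊖ # 1F) ⊖ (# 2F ⊖ # 3F)) ≡.refl)
              (A₊.∙-congˡ (A₊.⁻¹-cong (A₊.sym (sub-homo (·-additiveʳ x) a a′)))))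
            (SA.-‿closed H⁰-isSubgroup p p′)) (Almost-∩ h h′))
          fin)
        where
        a-a′∈B = SA.-‿closed (≤ᴬ S.B) a∈B a′∈B

-- The central series, counted from the bottom

module NilpotentLieRing {ℓ : Level} {𝔤 : LieRing ℓ} (nil : Nilpotent 𝔤) where
  open LieRing 𝔤
  open Nilpotent nil

  -- The terms of the chain, counted from the bottom.
  Depth : ℕ → Pred Carrier ℓ
  Depth k x = ∃[ i ] Fin.toℕ i ℕ.+ k ≡ length × x ∈ chain i

  Depth-top : ∀ x → x ∈ Depth length
  Depth-top x = zero , ≡.refl , top x

  Depth-zero : ∀ {x} → x ∈ Depth 0 → x ≈ 0#
  Depth-zero {x} (i , e , p) = bottom (≡.subst (λ j → x ∈ chain j)
    (Fin.toℕ-injective (≡.trans (≡.trans (≡.sym (ℕ.+-identityʳ _)) e) (≡.sym (Fin.toℕ-fromℕ length)))) p)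

  Depth-⁅⁆ : ∀ {k x} → x ∈ Depth (ℕ.suc k) → ∀ y → ⁅ x , y ⁆ ∈ Depth k
  Depth-⁅⁆ {k} {x} (i , e , p) y = suc j ,
    ≡.trans (≡.cong (λ n → ℕ.suc n ℕ.+ k) (Fin.toℕ-fromℕ< i<length)) (≡.trans (≡.sym (ℕ.+-suc (Fin.toℕ i) k)) e) ,
    respects (AbelianGroup.sym additiveGroup (antisym x y))
      (⁻¹-closed (central j y (≡.subst (λ j → x ∈ chain j) (≡.sym j≡i) p)))
    where
    i<length : Fin.toℕ i < length
    i<length = ℕ.m+n≤o⇒m≤o _ (ℕ.≤-reflexive (≡.trans (≡.sym (ℕ.+-suc (Fin.toℕ i) k)) e))
    j = fromℕ< i<length
    j≡i : inject₁ j ≡ i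
    j≡i = Fin.toℕ-injective (≡.trans (Fin.toℕ-inject₁ j) (Fin.toℕ-fromℕ< i<length))
    open IsSubgroup (IsIdeal.isSubgroup (ideal (suc j)))

-- Almost central operators on an irreducible section

module Irreducible
  {ℓ : Level} {𝓛 : Signature ℓ} {T : Theory 𝓛} (em : ∀ {p} → ExcludedMiddle p) (FD : FiniteDimensional T)
  (M : Model T) (𝔤 : LieRing ℓ) (A : LieModule 𝔤) (Δ : DefinableIn (Model.structure M) 𝔤 A)
  (nil : Nilpotent 𝔤)
  where

  open Setting em FD M 𝔤 A Δ
  open FiniteCovers em
  open NilpotentLieRing nil
  open Additive.IsAdditive

  IsIrreducible : Section → Set (Level.suc ℓ)
  IsIrreducible S = ∀ K → ∣ C ∣ᴬ ⊆ ∣ K ∣ᴬ → ∣ K ∣ᴬ ⊆ ∣ B ∣ᴬ → FI ∣ Stabiliser K ∣ᴸ →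
    SA.FiniteMod ∣ K ∣ᴬ ∣ C ∣ᴬ ⊎ SA.FiniteMod ∣ B ∣ᴬ ∣ K ∣ᴬ
    where open Section S

  FiniteMod-refl : (H : 𝐋.Subgroupᴰ) → SL.FiniteMod ∣ H ∣ᴸ ∣ H ∣ᴸ
  FiniteMod-refl H = L₊.ε ∷ [] , ε-closed ∷ [] ,
    λ p → here (SL.-‿closed (≤ᴸ H) p ε-closed)
    where open IsSubgroup (≤ᴸ H)

  module _ (S : Section) (irreducible : IsIrreducible S)
           (H⁰⊆C : SectionTheory.H⁰ S ⊆ ∣ Section.C S ∣ᴬ) where
    open SectionTheory S
    open SetoidReasoning Q.setoid

    𝔥ˢ : 𝐋.Subgroupᴰ
    𝔥ˢ = record
      { Carrierˢ   = 𝔥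
      ; isSubgroup = SL.∩-isSubgroup (≤ᴸ (Stabiliser B)) (≤ᴸ (Stabiliser C))
      ; defˢ       = defᴸ (Stabiliser B) ∧ᴰ defᴸ (Stabiliser C)
      }

    𝔥-finite : FI 𝔥
    𝔥-finite = SL.FiniteMod-∩ (≤ᴸ (Stabiliser B)) (≤ᴸ (Stabiliser C)) stableB stableC

    Ann : 𝐋.Subgroupᴰ
    Ann = Transporter B C

    module Ann = IsSubgroup (≤ᴸ Ann)

    Ann⊆𝔥 : ∣ Ann ∣ᴸ ⊆ 𝔥
    Ann⊆𝔥 h = (λ b p → C⊆B (h b p)) , (λ c p → h c (C⊆B p))

    bracket-stable : ∀ {x y} {X : 𝐀.Subgroupᴰ} → x ∈ ∣ Stabiliser X ∣ᴸ → y ∈ ∣ Stabiliser X ∣ᴸ → ⁅ x , y ⁆ ∈ ∣ Stabiliser X ∣ᴸ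
    bracket-stable {x} {y} {X} p q b r = IsSubgroup.respects (≤ᴬ X) (A₊.sym (A.·-⁅⁆ x y b))
      (SA.-‿closed (≤ᴬ X) (p _ (q b r)) (q _ (p b r)))

    𝔥-⁅⁆ : ∀ {x y} → x ∈ 𝔥 → y ∈ 𝔥 → ⁅ x , y ⁆ ∈ 𝔥
    𝔥-⁅⁆ (p , q) (p′ , q′) = bracket-stable {X = B} p p′ , bracket-stable {X = C} q q′

    Ann-⁅⁆ : ∀ {x y} → x ∈ ∣ Ann ∣ᴸ → y ∈ 𝔥 → ⁅ x , y ⁆ ∈ ∣ Ann ∣ᴸ
    Ann-⁅⁆ {x} {y} h (p , q) b r = C.respects (A₊.sym (A.·-⁅⁆ x y b))
      (SA.-‿closed (≤ᴬ C) (h _ (p b r)) (q _ (h b r)))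

    Ann-sym : ∀ {x y} → ⁅ x , y ⁆ ∈ ∣ Ann ∣ᴸ → ⁅ y , x ⁆ ∈ ∣ Ann ∣ᴸ
    Ann-sym {x} {y} h = Ann.respects (L₊.sym (L.antisym y x)) (Ann.⁻¹-closed h)

    -- Antisymmetry gives only that twice `⁅ x , x ⁆` is zero; but this bracket acts as the
    -- commutator of `x` with itself.
    ⁅x,x⁆∈Ann : ∀ x → ⁅ x , x ⁆ ∈ ∣ Ann ∣ᴸ
    ⁅x,x⁆∈Ann x b _ = C.respects (A₊.sym (A₊.trans (A.·-⁅⁆ x x b) (A₊.inverseʳ _))) C.ε-closed

    commute : ∀ {x y b} → ⁅ x , y ⁆ ∈ ∣ Ann ∣ᴸ → b ∈ ∣ B ∣ᴬ → x · y · b ≡ᴴ y · x · b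
    commute {x} {y} {b} h p = Q.trans (≈⇒≡ᴴ (bracket-act x y b))
      (Q.trans (Q.∙-cong Q.refl (∈⇒≡ε (h b p))) (Q.identityʳ _))

    -- The upper central series of `𝔥` modulo `Ann`, that is, of the Lie ring of operators induced
    -- on B/C. Its terms are definable, which is not known of the given chain of ideals.
    UpperCentral : ℕ → 𝐋.Subgroupᴰ
    UpperCentral ℕ.zero    = Ann
    UpperCentral (ℕ.suc k) = record
      { Carrierˢ   = λ x → x ∈ 𝔥 × (∀ y → y ∈ 𝔥 → ⁅ x , y ⁆ ∈ ∣ U′ ∣ᴸ)
      ; isSubgroup = record
        { respects  = λ e (p , h) → 𝔥′.respects e p , λ y q → respects (⟦⟧-cong (ad-additiveˡ y) e) (h y q)
        ; ε-closed  = 𝔥′.ε-closed , λ y q → respects (L₊.sym (0-homo (ad-additiveˡ y))) ε-closed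
        ; ∙-closed  = λ (p , h) (p′ , h′) → 𝔥′.∙-closed p p′ ,
            λ y q → respects (L₊.sym (+-homo (ad-additiveˡ y) _ _)) (∙-closed (h y q) (h′ y q))
        ; ⁻¹-closed = λ (p , h) → 𝔥′.⁻¹-closed p ,
            λ y q → respects (L₊.sym (neg-homo (ad-additiveˡ y) _)) (⁻¹-closed (h y q))
        }
      ; defˢ       = defᴸ 𝔥ˢ ∧ᴰ ∀ᴰ (projectᴰ (fstᴾ idᴾ) (defᴸ 𝔥ˢ) ⇒ᴰ
                       atᴰ (defᴸ U′) (bracketᵗ (projection (sndᴾ idᴾ)) v₀))
      }
      where
      U′ = UpperCentral k
      module 𝔥′ = IsSubgroup (≤ᴸ 𝔥ˢ)
      open IsSubgroup (≤ᴸ U′)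

    Ann⊆UpperCentral : ∀ k → ∣ Ann ∣ᴸ ⊆ ∣ UpperCentral k ∣ᴸ
    Ann⊆UpperCentral ℕ.zero    p = p
    Ann⊆UpperCentral (ℕ.suc k) p = Ann⊆𝔥 p , λ y q → Ann⊆UpperCentral k (Ann-⁅⁆ p q)

    -- The upper central series dominates every central series counted from the bottom, so it
    -- reaches all of `𝔥` at the length of the chain.
    Depth⊆UpperCentral : ∀ k {x} → x ∈ Depth k → x ∈ 𝔥 → x ∈ ∣ UpperCentral k ∣ᴸ
    Depth⊆UpperCentral ℕ.zero    p q = Ann.respects (L₊.sym (Depth-zero p)) Ann.ε-closed
    Depth⊆UpperCentral (ℕ.suc k) p q = q , λ y r → Depth⊆UpperCentral k (Depth-⁅⁆ p y) (𝔥-⁅⁆ q r)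

    record AlmostCentral : Set (Level.suc ℓ) where
      field
        Z              : 𝐋.Subgroupᴰ
        Z⊆𝔥            : ∣ Z ∣ᴸ ⊆ 𝔥
        Ann⊆Z          : ∣ Ann ∣ᴸ ⊆ ∣ Z ∣ᴸ
        almost-central : ∀ {z} → z ∈ ∣ Z ∣ᴸ → Almost (λ y → ⁅ z , y ⁆ ∈ ∣ Ann ∣ᴸ)
        Z/Ann-infinite : ¬ SL.FiniteMod ∣ Z ∣ᴸ ∣ Ann ∣ᴸ

    -- Were `Ann` of finite index in `𝔥`, all of `B` would lie in H⁰, hence in `C`. So the upper
    -- central series passes from finite to infinite modulo `Ann` at some step; bracketing with an
    -- element of the later term maps `𝔥` into the finite earlier one, so `vanishes` applies.
    almostCentral : ¬ SA.FiniteMod ∣ B ∣ᴬ ∣ C ∣ᴬ → AlmostCentral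
    almostCentral infinite = central (first-failure (λ k → SL.FiniteMod ∣ UpperCentral k ∣ᴸ ∣ Ann ∣ᴸ)
      (FiniteMod-refl Ann) (Nilpotent.length nil) λ fin → Ann-infiniteIndex
        (SL.FiniteMod-sub (≤ᴸ Ann) (λ p → Depth⊆UpperCentral (Nilpotent.length nil) (Depth-top _) p) fin))
      where
      Ann-infiniteIndex : ¬ SL.FiniteMod 𝔥 ∣ Ann ∣ᴸ
      Ann-infiniteIndex fin = infinite (0# ∷ [] , B.ε-closed ∷ [] , λ {b} p → here
        (Q.trans (∈⇒≡ε (H⁰⊆C (almost⇒H⁰ p (Almost-map (λ h → h b p)
          (almost (≤ᴸ Ann) (FiniteMod-trans (≤ᴸ Ann) 𝔥-finite fin)))))) Q.refl))
      central : ∃[ k ] SL.FiniteMod ∣ UpperCentral k ∣ᴸ ∣ Ann ∣ᴸ × ¬ SL.FiniteMod ∣ UpperCentral (ℕ.suc k) ∣ᴸ ∣ Ann ∣ᴸ →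
                AlmostCentral
      central (k , fin , inf) = record
        { Z              = UpperCentral (ℕ.suc k)
        ; Z⊆𝔥            = proj₁
        ; Ann⊆Z          = Ann⊆UpperCentral (ℕ.suc k)
        ; almost-central = λ {z} p → AnnHoms.vanishes (AnnHoms.additive⇒AlmostHom (ad-additive z))
            (Almost-map (λ {y} → proj₂ p y) almost-𝔥) fin
        ; Z/Ann-infinite = inf
        }
        where module AnnHoms = AlmostHoms em L₊ L₊ (≤ᴸ Ann)

    module Fractions (𝒵 : AlmostCentral) where
      open AlmostCentral 𝒵

      -- Otherwise `Ann` would contain the trace on `Z` of a subgroup of finite index, contradicting
      -- `Z/Ann-infinite`.
      escape : ∀ {p} {P : Pred Lᶜ p} → Almost P → ∃[ x ] x ∈ ∣ Z ∣ᴸ × ¬ (x ∈ ∣ Ann ∣ᴸ) × x ∈ P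
      escape {P = P} (D , D≤L , fin , D⊆P) = classical λ none → Z/Ann-infinite
        (SL.FiniteMod-mono {H = λ x → x ∈ D × x ∈ ∣ Z ∣ᴸ} {∣ Ann ∣ᴸ}
          (λ {x} (p , q) → classical λ ¬r → none (x , q , ¬r , D⊆P p))
          (SL.FiniteMod-∩ D≤L (≤ᴸ Z) (SL.FiniteMod-sub {K′ = U} D≤L _ fin) (FiniteMod-refl Z)))

      Regular : Pred Lᶜ ℓ
      Regular x = x ∈ ∣ Z ∣ᴸ × ¬ (x ∈ ∣ Ann ∣ᴸ)

      -- A Schur lemma up to finite index: the kernel `K` of `z` is stable under almost all of `𝔥`,
      -- since `z` commutes with almost all of it on B/C. By irreducibility `K` is small or large.
      regular-injective : ∀ {z b} → Regular z → b ∈ ∣ B ∣ᴬ → z · b ∈ ∣ C ∣ᴬ → b ∈ ∣ C ∣ᴬ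
      regular-injective {z} {b} (z∈Z , z∉Ann) b∈B zb∈C =
        [ small , (λ fin → contradiction (large fin) z∉Ann) ]′
          (irreducible K (λ {c} p → C⊆B p , proj₂ (Z⊆𝔥 z∈Z) c p) proj₁ K-stable)
        where
        K : 𝐀.Subgroupᴰ
        K = record
          { Carrierˢ   = λ b → b ∈ ∣ B ∣ᴬ × z · b ∈ ∣ C ∣ᴬ
          ; isSubgroup = SA.∩-isSubgroup (≤ᴬ B) (preimage-isSubgroup (·-additiveʳ z) (≤ᴬ C))
          ; defˢ       = defᴬ B ∧ᴰ atᴰ (defᴬ C) (actᵗ (constᵗ z) (projection idᴾ))
          }
        K-stable : FI ∣ Stabiliser K ∣ᴸ
        K-stable = Almost⇒FiniteIndex {∣ Stabiliser K ∣ᴸ} (Almost-map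
          (λ { {y} ((yB , yC) , h) b (p , q) → yB b p , ≡-∈ (commute h p) (yC _ q) })
          (Almost-∩ almost-𝔥 (almost-central z∈Z)))
        -- Almost all `y` send `b` into `K`, and hence into `C`, `K` being finite modulo `C`; so `b`
        -- lies in H⁰.
        small : SA.FiniteMod ∣ K ∣ᴬ ∣ C ∣ᴬ → b ∈ ∣ C ∣ᴬ
        small fin = H⁰⊆C (almost⇒H⁰ b∈B (vanishes (additive⇒AlmostHom (·-additiveˡ b))
          (Almost-map (λ { {y} ((yB , yC) , h) → yB b b∈B , ≡-∈ (commute h b∈B) (yC _ zb∈C) })
            (Almost-∩ almost-𝔥 (almost-central z∈Z))) fin))
        -- Almost all `y` send `b` into `K`, so `y · z · b`, which is `z · y · b` modulo `C`, lies
        -- in `C`; thus `z · b` lies in H⁰ for every `b`.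
        large : SA.FiniteMod ∣ B ∣ᴬ ∣ K ∣ᴬ → z ∈ ∣ Ann ∣ᴸ
        large fin b p = H⁰⊆C (almost⇒H⁰ (proj₁ (Z⊆𝔥 z∈Z) b p) (Almost-map
          (λ ((_ , q) , h) → ≡-∈ (Q.sym (commute h p)) q)
          (Almost-∩ (KHoms.vanishes (KHoms.additive⇒AlmostHom (·-additiveˡ b)) (Almost-map (λ (yB , _) → yB b p) almost-𝔥) fin)
                    (almost-central z∈Z))))
          where module KHoms = AlmostHoms em L₊ A₊ (≤ᴬ K)

      regular-cancel : ∀ {z b b′} → Regular z → b ∈ ∣ B ∣ᴬ → b′ ∈ ∣ B ∣ᴬ → z · b ≡ᴴ z · b′ → b ≡ᴴ b′
      regular-cancel {z} {b} {b′} r p q e = regular-injective r (SA.-‿closed (≤ᴬ B) p q)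
        (C.respects (A₊.sym (sub-homo (·-additiveʳ z) b b′)) e)

      Multiples : ∀ {z} → z ∈ 𝔥 → 𝐀.Subgroupᴰ
      Multiples {z} (zB , zC) = record
        { Carrierˢ   = λ b → b ∈ ∣ B ∣ᴬ × ∃[ y ] y ∈ ∣ B ∣ᴬ × b ≡ᴴ z · y
        ; isSubgroup = record
          { respects  = λ e (p , y , q , h) → B.respects e p , y , q , Q.trans (≈⇒≡ᴴ (A₊.sym e)) h
          ; ε-closed  = B.ε-closed , 0# , B.ε-closed , ≈⇒≡ᴴ (A₊.sym (0-homo (·-additiveʳ z)))
          ; ∙-closed  = λ (p , y , q , h) (p′ , y′ , q′ , h′) → B.∙-closed p p′ , y + y′ , B.∙-closed q q′ ,
              Q.trans (Q.∙-cong h h′) (Q.sym (·-add z y y′))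
          ; ⁻¹-closed = λ (p , y , q , h) → B.⁻¹-closed p , - y , B.⁻¹-closed q ,
              Q.trans (Q.⁻¹-cong h) (Q.sym (·-neg z y))
          }
        ; defˢ       = defᴬ B ∧ᴰ ∃ᴰ (projectᴰ (fstᴾ idᴾ) (defᴬ B) ∧ᴰ
            atᴰ (defᴬ C) (𝐀.subᵗ (projection (sndᴾ idᴾ)) (actᵗ (constᵗ z) v₀)))
        }

      module _ {z : Lᶜ} (r : Regular z) where
        private
          z∈𝔥 : z ∈ 𝔥
          z∈𝔥 = Z⊆𝔥 (proj₁ r)

          zB : 𝐀.Subgroupᴰ
          zB = Multiples z∈𝔥

          multiply : DMap (B 𝐀./ C) (zB 𝐀./ C)
          multiply = record
            { Rel_       = λ b k → z · b ≡ᴴ k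
            ; relᴰ       = atᴰ (defᴬ C) (𝐀.subᵗ (actᵗ (constᵗ z) (projection (fstᴾ idᴾ))) (projection (sndᴾ idᴾ)))
            ; respects   = λ _ _ _ _ e f h → Q.trans (·-cong-mod z∈𝔥 (Q.sym e)) (Q.trans h f)
            ; total      = λ {b} p → z · b , (proj₁ z∈𝔥 b p , b , p , Q.refl) , Q.refl
            ; functional = λ _ _ _ h h′ → Q.trans (Q.sym h) h′
            }

          multiply-injective : DMap.Injective multiply
          multiply-injective p p′ _ h h′ = regular-cancel r p p′ (Q.trans h (Q.sym h′))

          C⊆zB : ∣ C ∣ᴬ ⊆ ∣ zB ∣ᴬ
          C⊆zB {c} p = C⊆B p , 0# , B.ε-closed , Q.trans (∈⇒≡ε p) (≈⇒≡ᴴ (A₊.sym (0-homo (·-additiveʳ z))))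

        -- `multiply` embeds B/C in its own subgroup zB/C, which by dimension forces finite index.
        Multiples-finite : SA.FiniteMod ∣ B ∣ᴬ ∣ zB ∣ᴬ
        Multiples-finite = 𝐀.injective⇒finiteIndex {B} {zB} {C} proj₁ C⊆zB multiply multiply-injective

-- Fractions modulo inner derivations

module FractionSet
  {ℓ : Level} {𝓛 : Signature ℓ} {T : Theory 𝓛} (em : ∀ {p} → ExcludedMiddle p) (FD : FiniteDimensional T)
  (M : Model T) (𝔤 : LieRing ℓ) (A : LieModule 𝔤) (Δ : DefinableIn (Model.structure M) 𝔤 A)
  (nil : Nilpotent 𝔤)
  where

  open Setting em FD M 𝔤 A Δ
  open FiniteCovers em
  open NilpotentLieRing nil
  open Irreducible em FD M 𝔤 A Δ nil using (IsIrreducible; AlmostCentral; module AlmostCentral)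
  open Additive.IsAdditive

  module _ (S : Section) (irreducible : IsIrreducible S)
           (H⁰⊆C : SectionTheory.H⁰ S ⊆ ∣ Section.C S ∣ᴬ)
           (𝒵 : AlmostCentral S irreducible H⁰⊆C) where
    open SectionTheory S
    open AlmostCentral 𝒵
    open SetoidReasoning Q.setoid
    open AbelianGroupSolver A₊ using (solve; #_; 𝟘; _⊕_; _⊖_; ⊝_)

    private
      module I = Irreducible em FD M 𝔤 A Δ nil
      Ann = I.Ann S irreducible H⁰⊆C
      module Ann = IsSubgroup (≤ᴸ Ann)
      module Fr = I.Fractions S irreducible H⁰⊆C 𝒵
    open Fr using (Regular; escape; regular-cancel; Multiples; Multiples-finite)

    private
      commute : ∀ {x y b} → ⁅ x , y ⁆ ∈ ∣ Ann ∣ᴸ → b ∈ ∣ B ∣ᴬ → x · y · b ≡ᴴ y · x · b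
      commute = I.commute S irreducible H⁰⊆C

      Ann-sym : ∀ {x y} → ⁅ x , y ⁆ ∈ ∣ Ann ∣ᴸ → ⁅ y , x ⁆ ∈ ∣ Ann ∣ᴸ
      Ann-sym = I.Ann-sym S irreducible H⁰⊆C

      Ann-refl : ∀ x → ⁅ x , x ⁆ ∈ ∣ Ann ∣ᴸ
      Ann-refl = I.⁅x,x⁆∈Ann S irreducible H⁰⊆C

    -- The fractions b/g and y/x agree.
    Agree : Lᶜ → Lᶜ → Aᶜ → Aᶜ → Set ℓ
    Agree x g b y = ⁅ x , g ⁆ ∈ ∣ Ann ∣ᴸ × y ∈ ∣ B ∣ᴬ × x · b ≡ᴴ g · y

    -- The fractions b/g and b′/g′ differ by a.
    Shift : Lᶜ × Aᶜ → Lᶜ × Aᶜ → Lᶜ → Aᶜ → Set ℓ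
    Shift (g , b) (g′ , b′) x a = ∃[ y ] ∃[ y′ ] Agree x g b y × Agree x g′ b′ y′ × y ≡ᴴ y′ + x · a

    infix 4 _≅_

    -- Equality up to an inner derivation, tested at one regular multiplier so as to be first-order;
    -- `shift-transfer` carries the test to other multipliers.
    _≅_ : Rel (Lᶜ × Aᶜ) ℓ
    e ≅ e′ = ∃[ x ] ∃[ a ] Regular x × a ∈ ∣ B ∣ᴬ × Shift e e′ x a

    IsFraction : Pred (Lᶜ × Aᶜ) ℓ
    IsFraction (g , b) = Regular g × b ∈ ∣ B ∣ᴬ

    -- The fraction can be written over `x` once `x · b` is a multiple of `g`. The multiples of `g`
    -- have finite index in `B`, so this holds for almost all `x` by `vanishes`.
    almost-agree : ∀ {g b} → IsFraction (g , b) → Almost (λ x → ∃[ y ] Agree x g b y)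
    almost-agree {g} {b} (r , p) = Almost-map
      (λ (h , _ , y , q , e) → y , Ann-sym h , q , e)
      (Almost-∩ (almost-central (proj₁ r))
        (Homs.vanishes (Homs.additive⇒AlmostHom (·-additiveˡ b))
          (Almost-map (λ (xB , _) → xB b p) almost-𝔥) (Multiples-finite r)))
      where module Homs = AlmostHoms em L₊ A₊ (≤ᴬ (Multiples (Z⊆𝔥 (proj₁ r))))

    -- Multiplied by `g`, both sides become `x · x₁ · b` modulo `C`, and `g` can be cancelled.
    cross : ∀ {x x₁ g b y y₁} → IsFraction (g , b) → x ∈ 𝔥 → x₁ ∈ 𝔥 → ⁅ x , x₁ ⁆ ∈ ∣ Ann ∣ᴸ →
            Agree x g b y → Agree x₁ g b y₁ → x₁ · y ≡ᴴ x · y₁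
    cross {x} {x₁} {g} {b} {y} {y₁} (r , b∈B) p p₁ c (cg , y∈B , e) (cg₁ , y₁∈B , e₁) =
      regular-cancel r (proj₁ p₁ y y∈B) (proj₁ p y₁ y₁∈B) (begin
        g · x₁ · y   ≈⟨ commute cg₁ y∈B ⟨
        x₁ · g · y   ≈⟨ ·-cong-mod p₁ e ⟨
        x₁ · x · b   ≈⟨ commute c b∈B ⟨
        x · x₁ · b   ≈⟨ ·-cong-mod p e₁ ⟩
        x · g · y₁   ≈⟨ commute cg y₁∈B ⟩
        g · x · y₁   ∎)

    -- Multiplied by the regular `x₁`, the claim turns through `cross` into `x` applied to the given
    -- relation at `x₁`.
    shift-transfer : ∀ {e e′ x x₁ a y y′} → IsFraction e → IsFraction e′ → Regular x₁ → x ∈ 𝔥 →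
      ⁅ x , x₁ ⁆ ∈ ∣ Ann ∣ᴸ → a ∈ ∣ B ∣ᴬ → Shift e e′ x₁ a →
      Agree x (proj₁ e) (proj₂ e) y → Agree x (proj₁ e′) (proj₂ e′) y′ → y ≡ᴴ y′ + x · a
    shift-transfer {x = x} {x₁} {a} {y} {y′} p p′ r₁ x∈𝔥 c a∈B (y₁ , y₁′ , h₁ , h₁′ , e₁) h h′ =
      regular-cancel r₁ (proj₁ (proj₂ h)) (B.∙-closed (proj₁ (proj₂ h′)) (proj₁ x∈𝔥 a a∈B)) (begin
        x₁ · y                   ≈⟨ cross p x∈𝔥 x₁∈𝔥 c h h₁ ⟩
        x · y₁                   ≈⟨ ·-cong-mod x∈𝔥 e₁ ⟩
        x · (y₁′ + x₁ · a)       ≈⟨ ·-add x y₁′ (x₁ · a) ⟩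
        x · y₁′ + x · x₁ · a     ≈⟨ Q.∙-cong (Q.sym (cross p′ x∈𝔥 x₁∈𝔥 c h′ h₁′)) (commute c a∈B) ⟩
        x₁ · y′ + x₁ · x · a     ≈⟨ ·-add x₁ y′ (x · a) ⟨
        x₁ · (y′ + x · a)        ∎)
      where x₁∈𝔥 = Z⊆𝔥 (proj₁ r₁)

    ≅-fromEq : ∀ {g g′ b b′} → IsFraction (g , b) → IsFraction (g′ , b′) → g ≈ᴸ g′ → b ≡ᴴ b′ → (g , b) ≅ (g′ , b′)
    ≅-fromEq {g} {g′} {b} {b′} (r , p) (_ , p′) e f = g , 0# , r , B.ε-closed , b , b′ ,
      (Ann-refl g , p , Q.refl) ,
      (Ann.respects (L.⁅⁆-cong L₊.refl e) (Ann-refl g) , p′ , ≈⇒≡ᴴ (A.·-cong e A₊.refl)) ,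
      Q.trans f (≈⇒≡ᴴ (A₊.sym (A₊.trans (A₊.∙-congˡ (0-homo (·-additiveʳ g))) (A₊.identityʳ b′))))

    ≅-sym : ∀ {e e′} → e ≅ e′ → e′ ≅ e
    ≅-sym (x , a , r , p , y , y′ , h , h′ , e) = x , - a , r , B.⁻¹-closed p , y′ , y , h′ , h , (begin
      y′                       ≈⟨ ≈⇒≡ᴴ (solve (y′ ∷ x · a ∷ []) (# 0F) ((# 0F ⊕ # 1F) ⊕ ⊝ # 1F) ≡.refl) ⟩
      (y′ + x · a) + - (x · a) ≈⟨ Q.∙-cong (Q.sym e) (Q.sym (·-neg x a)) ⟩
      y + x · (- a)            ∎)

    -- The two shifts come with different multipliers. Both are moved to a common regular `x` over
    -- which all three fractions can be written, and there they add up.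
    ≅-trans : ∀ {e e′ e″} → IsFraction e → IsFraction e′ → IsFraction e″ → e ≅ e′ → e′ ≅ e″ → e ≅ e″
    ≅-trans p p′ p″ (x₁ , a₁ , r₁ , q₁ , s₁) (x₂ , a₂ , r₂ , q₂ , s₂) =
      let x , x∈Z , x∉Ann , (((y , h) , (y′ , h′)) , (y″ , h″)) , (c₁ , c₂) = escape
            (Almost-∩ (Almost-∩ (Almost-∩ (almost-agree p) (almost-agree p′)) (almost-agree p″))
                      (Almost-∩ (almost-central (proj₁ r₁)) (almost-central (proj₁ r₂))))
          e₁ = shift-transfer p p′ r₁ (Z⊆𝔥 x∈Z) (Ann-sym c₁) q₁ s₁ h h′
          e₂ = shift-transfer p′ p″ r₂ (Z⊆𝔥 x∈Z) (Ann-sym c₂) q₂ s₂ h′ h″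
      in x , a₁ + a₂ , (x∈Z , x∉Ann) , B.∙-closed q₁ q₂ , y , y″ , h , h″ , combine e₁ e₂
      where
      combine : ∀ {x y y′ y″} → y ≡ᴴ y′ + x · a₁ → y′ ≡ᴴ y″ + x · a₂ → y ≡ᴴ y″ + x · (a₁ + a₂)
      combine {x} {y} {y′} {y″} e f = begin
        y                              ≈⟨ e ⟩
        y′ + x · a₁                    ≈⟨ Q.∙-cong f Q.refl ⟩
        (y″ + x · a₂) + x · a₁         ≈⟨ ≈⇒≡ᴴ (solve (y″ ∷ x · a₂ ∷ x · a₁ ∷ [])
                                            ((# 0F ⊕ # 1F) ⊕ # 2F) (# 0F ⊕ (# 2F ⊕ # 1F)) ≡.refl) ⟩
        y″ + (x · a₁ + x · a₂)         ≈⟨ Q.∙-cong Q.refl (·-add x a₁ a₂) ⟨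
        y″ + x · (a₁ + a₂)             ∎

    private
      variable
        Γ : Code

      agreeᴰ : (x g : Tm Γ 𝐋) (b y : Tm Γ 𝐀) → Def Γ (λ ρ → Agree (val x ρ) (val g ρ) (val b ρ) (val y ρ))
      agreeᴰ x g b y = atᴰ (defᴸ Ann) (bracketᵗ x g) ∧ᴰ atᴰ (defᴬ B) y
                    ∧ᴰ atᴰ (defᴬ C) (𝐀.subᵗ (actᵗ x b) (actᵗ g y))

      ≅ᴰ : Def ((𝐋 ⊗ 𝐀) ⊗ (𝐋 ⊗ 𝐀)) (λ (e , e′) → e ≅ e′)
      -- In the innermost context `y′`, `y`, `a`, `x` stand, in this order, before the two
      -- fractions.
      ≅ᴰ = ∃ᴰ (∃ᴰ ((atᴰ (defᴸ Z) x ∧ᴰ ¬ᴰ (atᴰ (defᴸ Ann) x)) ∧ᴰ atᴰ (defᴬ B) v₀ ∧ᴰ ∃ᴰ (∃ᴰ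
        ( agreeᴰ (weaken (weaken x)) (weaken (weaken g)) (weaken (weaken b)) (weaken v₀)
        ∧ᴰ agreeᴰ (weaken (weaken x)) (weaken (weaken g′)) (weaken (weaken b′)) v₀
        ∧ᴰ atᴰ (defᴬ C) (𝐀.subᵗ (weaken v₀) (𝐀.addᵗ v₀ (actᵗ (weaken (weaken x)) (weaken (weaken v₀)))))))))
        where
        Δ₂ = 𝐀 ⊗ 𝐋 ⊗ (𝐋 ⊗ 𝐀) ⊗ (𝐋 ⊗ 𝐀)
        x g g′ : Tm Δ₂ 𝐋
        x  = weaken v₀
        g  = weaken (weaken (projection (fstᴾ (fstᴾ idᴾ))))
        g′ = weaken (weaken (projection (fstᴾ (sndᴾ idᴾ))))
        b b′ : Tm Δ₂ 𝐀
        b  = weaken (weaken (projection (sndᴾ (fstᴾ idᴾ))))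
        b′ = weaken (weaken (projection (sndᴾ (sndᴾ idᴾ))))

    -- The pairs of `FractionsUpToInner` before identification: `g` up to equality and `b` modulo
    -- `C`.
    Numerators : DSet (𝐋 ⊗ 𝐀)
    Numerators = restrict (Z 𝐋./ 𝐋.trivial) (¬ᴰ (defᴸ Ann)) ⊠ (B 𝐀./ C)

    FractionsUpToInner : DSet (𝐋 ⊗ 𝐀)
    FractionsUpToInner = record
      { Mem     = IsFraction
      ; _~_     = _≅_
      ; memᴰ    = DSet.memᴰ Numerators
      ; ~ᴰ      = ≅ᴰ
      ; ~-refl  = λ p → ≅-fromEq p p L₊.refl Q.refl
      ; ~-sym   = λ _ _ → ≅-sym
      ; ~-trans = ≅-trans
      }

    private
      sub≈0⇒≈ : ∀ {x y} → x -ᴸ y ≈ᴸ L₊.ε → x ≈ᴸ y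
      sub≈0⇒≈ = AbelianGroupProperties.x∙y⁻¹≈ε⇒x≈y L₊ _ _

      ≈⇒sub≈0 : ∀ {x y} → x ≈ᴸ y → x -ᴸ y ≈ᴸ L₊.ε
      ≈⇒sub≈0 e = AbelianGroupProperties.x≈y⇒x∙y⁻¹≈ε L₊ e

      classOf : DMap Numerators FractionsUpToInner
      classOf = coerce id λ p q (e , f) → ≅-fromEq p q (sub≈0⇒≈ e) f

    module _ {g : Lᶜ} {b : Aᶜ} (p : IsFraction (g , b)) where
      private
        g∈𝔥 = Z⊆𝔥 (proj₁ (proj₁ p))

        -- The denominators in `Z` over which b/g can be written. The subgroup supplied by
        -- `almost-agree` need not be definable; this one contains its trace on `Z`, is definable,
        -- and so has a rank.
        Admissible : 𝐋.Subgroupᴰ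
        Admissible = record
          { Carrierˢ   = λ x → x ∈ ∣ Z ∣ᴸ × ∃[ y ] Agree x g b y
          ; isSubgroup = record
            { respects  = λ e (q , y , h , r , f) → Zˢ.respects e q , y , Ann.respects (L.⁅⁆-cong e L₊.refl) h , r ,
                Q.trans (≈⇒≡ᴴ (A.·-cong (L₊.sym e) A₊.refl)) f
            ; ε-closed  = Zˢ.ε-closed , 0# , Ann.respects (L₊.sym (0-homo (ad-additiveˡ g))) Ann.ε-closed , B.ε-closed ,
                ≈⇒≡ᴴ (A₊.trans (0-homo (·-additiveˡ b)) (A₊.sym (0-homo (·-additiveʳ g))))
            ; ∙-closed  = λ (q , y , h , r , f) (q′ , y′ , h′ , r′ , f′) → Zˢ.∙-closed q q′ , y + y′ ,
                Ann.respects (L₊.sym (+-homo (ad-additiveˡ g) _ _)) (Ann.∙-closed h h′) , B.∙-closed r r′ ,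
                Q.trans (≈⇒≡ᴴ (+-homo (·-additiveˡ b) _ _)) (Q.trans (Q.∙-cong f f′) (Q.sym (·-add g y y′)))
            ; ⁻¹-closed = λ (q , y , h , r , f) → Zˢ.⁻¹-closed q , - y ,
                Ann.respects (L₊.sym (neg-homo (ad-additiveˡ g) _)) (Ann.⁻¹-closed h) , B.⁻¹-closed r ,
                Q.trans (≈⇒≡ᴴ (neg-homo (·-additiveˡ b) _)) (Q.trans (Q.⁻¹-cong f) (Q.sym (·-neg g y)))
            }
          ; defˢ       = defᴸ Z ∧ᴰ ∃ᴰ (agreeᴰ (projection (sndᴾ idᴾ)) (constᵗ g) (constᵗ b) v₀)
          }
          where module Zˢ = IsSubgroup (≤ᴸ Z)

        Admissible-finite : SL.FiniteMod ∣ Z ∣ᴸ ∣ Admissible ∣ᴸ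
        Admissible-finite =
          let D , D≤L , fin , D⊆ = almost-agree p in
          SL.FiniteMod-mono {H = λ x → x ∈ D × x ∈ ∣ Z ∣ᴸ} {∣ Admissible ∣ᴸ} (λ (q , r) → r , D⊆ q)
            (SL.FiniteMod-∩ D≤L (≤ᴸ Z) (SL.FiniteMod-sub {K′ = U} D≤L _ fin) (I.FiniteMod-refl Z))

        Multipliers : DSet 𝐋
        Multipliers = restrict (Admissible 𝐋./ 𝐋.trivial) (¬ᴰ (defᴸ Ann))

        Shifts : DSet (𝐋 ⊗ 𝐀)
        Shifts = Multipliers ⊠ (B 𝐀./ C)

        Class : DSet (𝐋 ⊗ 𝐀)
        Class = fibre classOf (g , b)

        -- The multiplier x and the shift a yield the fraction (y − x·a)/x, where b/g = y/x.
        ShiftedBy : Lᶜ × Aᶜ → Lᶜ × Aᶜ → Set ℓ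
        ShiftedBy (x , a) (x′ , b′) = x -ᴸ x′ ≈ᴸ L₊.ε × ∃[ y ] Agree x g b y × b′ ≡ᴴ y - x · a

        ShiftedByᴰ : Def ((𝐋 ⊗ 𝐀) ⊗ (𝐋 ⊗ 𝐀)) (λ (w , w′) → ShiftedBy w w′)
        ShiftedByᴰ = atᴰ (defᴸ 𝐋.trivial) (𝐋.subᵗ (projection (fstᴾ (fstᴾ idᴾ))) (projection (fstᴾ (sndᴾ idᴾ))))
          ∧ᴰ ∃ᴰ (agreeᴰ x (constᵗ g) (constᵗ b) v₀ ∧ᴰ atᴰ (defᴬ C) (𝐀.subᵗ b′ (𝐀.subᵗ v₀ (actᵗ x a))))
          where
          x : Tm (𝐀 ⊗ (𝐋 ⊗ 𝐀) ⊗ (𝐋 ⊗ 𝐀)) 𝐋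
          x = weaken (projection (fstᴾ (fstᴾ idᴾ)))
          a b′ : Tm (𝐀 ⊗ (𝐋 ⊗ 𝐀) ⊗ (𝐋 ⊗ 𝐀)) 𝐀
          a = weaken (projection (sndᴾ (fstᴾ idᴾ)))
          b′ = weaken (projection (sndᴾ (sndᴾ idᴾ)))

        agree-unique : ∀ {x x′ y y′} → x ≈ᴸ x′ → Agree x g b y → Agree x′ g b y′ → y ≡ᴴ y′
        agree-unique e (_ , q , f) (_ , q′ , f′) = regular-cancel (proj₁ p) q q′
          (Q.trans (Q.sym f) (Q.trans (≈⇒≡ᴴ (A.·-cong e A₊.refl)) f′))

        -- As b/g equals y/x, the fraction assigned to `(x , a)` differs from b/g by `- a` and hence
        -- stays in its class.
        shift : DMap Shifts Class
        shift = record
          { Rel_       = ShiftedBy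
          ; relᴰ       = ShiftedByᴰ
          ; respects   = λ { {x , a} {x₁ , a₁} {x′ , b′} {x₁′ , b₁′} _ (((x₁∈Z , _) , _) , _) _ _ (e , f) (e′ , f′) (d , y , h , k) →
              ≈⇒sub≈0 (L₊.trans (L₊.sym (sub≈0⇒≈ e)) (L₊.trans (sub≈0⇒≈ d) (sub≈0⇒≈ e′))) , y ,
              ( Ann.respects (L.⁅⁆-cong (sub≈0⇒≈ e) L₊.refl) (proj₁ h) , proj₁ (proj₂ h)
              , Q.trans (≈⇒≡ᴴ (A.·-cong (L₊.sym (sub≈0⇒≈ e)) A₊.refl)) (proj₂ (proj₂ h))) ,
              Q.trans (Q.sym f′) (Q.trans k (Q.∙-cong Q.refl (Q.⁻¹-cong
                (Q.trans (≈⇒≡ᴴ (A.·-cong (sub≈0⇒≈ e) A₊.refl)) (·-cong-mod (Z⊆𝔥 x₁∈Z) f))))) }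
          ; total      = λ { {x , a} (((x∈Z , y , h) , x∉Ann) , a∈B) →
              let xa∈B = proj₁ (Z⊆𝔥 x∈Z) a a∈B
                  b′∈B = SA.-‿closed (≤ᴬ B) (proj₁ (proj₂ h)) xa∈B
              in (x , y - x · a) ,
                 ( ((x∈Z , x∉Ann) , b′∈B)
                 , (x , - a , (x∈Z , x∉Ann) , B.⁻¹-closed a∈B , y - x · a , y ,
                    (Ann-refl x , b′∈B , Q.refl) , h , Q.∙-cong Q.refl (Q.sym (·-neg x a)))) ,
                 (≈⇒sub≈0 L₊.refl , y , h , Q.refl) }
          ; functional = λ { _ _ _ (d , y , h , k) (d′ , y′ , h′ , k′) →
              ≈⇒sub≈0 (L₊.trans (L₊.sym (sub≈0⇒≈ d)) (sub≈0⇒≈ d′)) ,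
              Q.trans k (Q.trans (Q.∙-cong (agree-unique L₊.refl h h′) Q.refl) (Q.sym k′)) }
          }

        -- The denominator returns `x`, which determines `y` modulo `C` and then `x · a`; the
        -- regular `x` can be cancelled.
        shift-injective : DMap.Injective shift
        shift-injective {x , a} {x′ , a′} (((x∈Z , _) , x∉Ann) , a∈B) (_ , a′∈B) _ (d , y , h , k) (d′ , y′ , h′ , k′) =
          ≈⇒sub≈0 x≈x′ , regular-cancel (x∈Z , x∉Ann) a∈B a′∈B (begin
            x · a               ≈⟨ ≈⇒≡ᴴ (solve (x · a ∷ y ∷ []) (# 0F) (# 1F ⊖ (# 1F ⊖ # 0F)) ≡.refl) ⟩
            y - (y - x · a)     ≈⟨ Q.∙-cong (agree-unique x≈x′ h h′) (Q.⁻¹-cong (Q.trans (Q.sym k) k′)) ⟩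
            y′ - (y′ - x′ · a′) ≈⟨ ≈⇒≡ᴴ (solve (x′ · a′ ∷ y′ ∷ []) (# 1F ⊖ (# 1F ⊖ # 0F)) (# 0F) ≡.refl) ⟩
            x′ · a′             ≈⟨ ≈⇒≡ᴴ (A.·-cong (L₊.sym x≈x′) A₊.refl) ⟩
            x · a′              ∎)
          where
          x≈x′ = L₊.trans (sub≈0⇒≈ d) (L₊.sym (sub≈0⇒≈ d′))

        multipliers-inhabited : DSet.Inhabited Multipliers
        multipliers-inhabited = let x , q , r , h = escape (almost-agree p) in x , (q , h) , r

      -- The multipliers contribute at least the rank of `Z` by `rank-complement`, the shifts that
      -- of B/C.
      rank-class : rank (Z 𝐋./ 𝐋.trivial) ℕ.+ rank (B 𝐀./ C) ≤ rank Class
      rank-class = ℕ.≤-trans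
        (ℕ.+-monoˡ-≤ (rank (B 𝐀./ C)) (𝐋.rank-complement Z Admissible Ann proj₁ Ann⊆Z Admissible-finite Z/Ann-infinite))
        (ℕ.≤-trans (rank-⊠-≥ Multipliers (B 𝐀./ C) multipliers-inhabited (0# , B.ε-closed))
                   (rank-injective shift shift-injective))

      class-inhabited : DSet.Inhabited Class
      class-inhabited = (g , b) , p , ≅-fromEq p p L₊.refl Q.refl

    -- The fibres of `classOf` have rank at least `k`, while `Numerators` has rank at most `k`;
    -- upper fibration leaves 0 for the set of classes.
    fractions-finite : DSet.Finite FractionsUpToInner
    fractions-finite = rank≡0⇒Finite FractionsUpToInner (ℕ.n≤0⇒n≡0 (ℕ.+-cancelʳ-≤ k _ _ (ℕ.≤-trans below above)))
      where
      k = rank (Z 𝐋./ 𝐋.trivial) ℕ.+ rank (B 𝐀./ C)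
      inhabited : DSet.Inhabited FractionsUpToInner
      inhabited = let z , q , r , _ = escape almost-𝔥 in (z , 0#) , (q , r) , B.ε-closed
      below : rank FractionsUpToInner ℕ.+ k ≤ rank Numerators
      below = rank-upper classOf k inhabited λ p → class-inhabited p , rank-class p
      above : rank Numerators ≤ k
      above = ℕ.≤-trans (rank-⊠-≤ _ _) (ℕ.+-monoˡ-≤ (rank (B 𝐀./ C))
        (rank-injective (coerce {X = restrict (Z 𝐋./ 𝐋.trivial) (¬ᴰ (defᴸ Ann))} {Z 𝐋./ 𝐋.trivial} proj₁ λ _ _ → id)
          (coerce-injective {X = restrict (Z 𝐋./ 𝐋.trivial) (¬ᴰ (defᴸ Ann))} {Z 𝐋./ 𝐋.trivial} proj₁ (λ _ _ → id) λ _ _ → id)))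

    module _ {f : Lᶜ → Aᶜ} (∂ : AlmostDerivation f) where
      private
        almost-D : Almost (D′ ∂)
        almost-D = everywhere (hom ∂)

      -- Induction along the central series: in `f ⁅ u , x ⁆ ≡ᴴ u · f x - x · f u` the left side
      -- vanishes because `⁅ u , x ⁆` is again in `Ann` and one step deeper, and `u · f x` because
      -- `u` is in `Ann`. So almost all `x` kill `f u`, and H⁰ lies in `C`.
      vanishes-on-Ann : ∀ k {u} → u ∈ Depth k → u ∈ ∣ Ann ∣ᴸ → u ∈ D′ ∂ → f u ∈ ∣ C ∣ᴬ
      vanishes-on-Ann ℕ.zero p _ q = ≡ε⇒∈ (Q.trans
        (AlmostHom.cong (hom ∂) q (IsSubgroup.ε-closed (D′≤L ∂)) (Depth-zero p)) (AlmostHom.ε-homo (hom ∂)))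
      vanishes-on-Ann (ℕ.suc k) {u} p h q = H⁰⊆C (almost⇒H⁰ (into ∂ q) (Almost-map
        (λ {x} (((d , x∈D) , [u,x]∈D) , x∈𝔥) → ≡ε⇒∈ (begin
          x · f u
            ≈⟨ ≈⇒≡ᴴ (solve (u · f x ∷ x · f u ∷ []) (# 1F) (# 0F ⊖ (# 0F ⊖ # 1F)) ≡.refl) ⟩
          u · f x - (u · f x - x · f u)
            ≈⟨ Q.∙-cong (∈⇒≡ε (h (f x) (into ∂ x∈D))) (Q.⁻¹-cong (Q.trans (Q.sym d)
                 (∈⇒≡ε (vanishes-on-Ann k (Depth-⁅⁆ p x) (I.Ann-⁅⁆ S irreducible H⁰⊆C h x∈𝔥) [u,x]∈D)))) ⟩
          0# - 0#
            ≈⟨ Q.inverseʳ 0# ⟩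
          0# ∎))
        (Almost-∩ (Almost-∩ (Almost-∩ (derive ∂ q) almost-D) (Almost-preimage (ad-additive u) almost-D)) almost-𝔥)))

      -- On almost all x the derivation is x ↦ g⁻¹·x·f(g).
      almost-fraction : ∀ {g} → Regular g → g ∈ D′ ∂ → Almost (λ x → Agree x g (f g) (f x))
      almost-fraction {g} r q = Almost-map
        (λ {x} (((d , x∈D) , [g,x]∈D) , c) → Ann-sym c , into ∂ x∈D , (begin
          x · f g
            ≈⟨ ≈⇒≡ᴴ (solve (g · f x ∷ x · f g ∷ []) (# 1F) (# 0F ⊖ (# 0F ⊖ # 1F)) ≡.refl) ⟩
          g · f x - (g · f x - x · f g)
            ≈⟨ Q.∙-cong Q.refl (Q.⁻¹-cong (Q.trans (Q.sym d)
                 (∈⇒≡ε (vanishes-on-Ann (Nilpotent.length nil) (Depth-top _) c [g,x]∈D)))) ⟩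
          g · f x - 0#
            ≈⟨ ≈⇒≡ᴴ (solve (g · f x ∷ []) (# 0F ⊖ 𝟘) (# 0F) ≡.refl) ⟩
          g · f x ∎))
        (Almost-∩ (Almost-∩ (Almost-∩ (derive ∂ q) almost-D) (Almost-preimage (ad-additive g) almost-D))
                  (almost-central (proj₁ r)))

    -- The denominator `g` is picked by `escape` inside the domain of each `f`. If the fractions of
    -- `f` and `f′` are identified, `shift-transfer` at almost every `x` shows that `f` and `f′`
    -- differ by an inner derivation.
    irreducible⇒H¹-finite : H¹-finite
    irreducible⇒H¹-finite = FiniteUpTo-transfer (λ f e → Almost (λ x → Agree x (proj₁ e) (proj₂ e) (f x)))
      fractions-finite total separate
      where
      total : ∀ {f} → AlmostDerivation f →
              ∃[ e ] IsFraction e × Almost (λ x → Agree x (proj₁ e) (proj₂ e) (f x))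
      total {f} ∂ = let g , q , r , d = escape (everywhere (hom ∂)) in
        (g , f g) , ((q , r) , into ∂ d) , almost-fraction ∂ (q , r) d
      separate : ∀ {f f′ e e′ z} → AlmostDerivation f → AlmostDerivation f′ →
        IsFraction e → IsFraction e′ → IsFraction z →
        Almost (λ x → Agree x (proj₁ e) (proj₂ e) (f x)) → Almost (λ x → Agree x (proj₁ e′) (proj₂ e′) (f′ x)) →
        e ≅ z → e′ ≅ z → f ≃ f′
      separate {f} {f′} _ _ p p′ p″ h h′ e e′ =
        let x₁ , a , r , q , s = ≅-trans p p″ p′ e (≅-sym e′) in
        a , q , Almost-map
          (λ (((k , k′) , x∈𝔥) , c) → shift-transfer p p′ r x∈𝔥 (Ann-sym c) q s k k′)
          (Almost-∩ (Almost-∩ (Almost-∩ h h′) almost-𝔥) (almost-central (proj₁ r)))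

-- Induction on the rank of a section

module Induction
  {ℓ : Level} {𝓛 : Signature ℓ} {T : Theory 𝓛} (em : ∀ {p} → ExcludedMiddle p) (FD : FiniteDimensional T)
  (M : Model T) (𝔤 : LieRing ℓ) (A : LieModule 𝔤) (Δ : DefinableIn (Model.structure M) 𝔤 A)
  (nil : Nilpotent 𝔤)
  where

  open Setting em FD M 𝔤 A Δ
  open FiniteCovers em
  open Extension em FD M 𝔤 A Δ
  open Reduction em FD M 𝔤 A Δ
  open Irreducible em FD M 𝔤 A Δ nil using (IsIrreducible; almostCentral)
  open FractionSet em FD M 𝔤 A Δ nil using (irreducible⇒H¹-finite)

  Splitting : Section → Set (Level.suc ℓ)
  Splitting S = Σ[ K ∈ 𝐀.Subgroupᴰ ] ∣ C ∣ᴬ ⊆ ∣ K ∣ᴬ × ∣ K ∣ᴬ ⊆ ∣ B ∣ᴬ × FI ∣ Stabiliser K ∣ᴸ ×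
    ¬ SA.FiniteMod ∣ K ∣ᴬ ∣ C ∣ᴬ × ¬ SA.FiniteMod ∣ B ∣ᴬ ∣ K ∣ᴬ
    where open Section S

  -- Reduction preserves unsplittability: a subgroup between `F` and `B` also lies between `C` and
  -- `B`, and finite modulo `C` implies finite modulo `F`. The reduced section remains infinite
  -- because F/C is finite.
  unsplit⇒H¹-finite : ∀ S → ¬ SA.FiniteMod ∣ Section.B S ∣ᴬ ∣ Section.C S ∣ᴬ → ¬ Splitting S →
                      SectionTheory.H⁰-finite S → SectionTheory.H¹-finite S
  unsplit⇒H¹-finite S infinite unsplit fin = H¹-finite-reduced S fin
    (irreducible⇒H¹-finite (reduced S fin) irreducible (reduced-H⁰ S fin)
      (almostCentral (reduced S fin) irreducible (reduced-H⁰ S fin)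
        λ fin′ → infinite (AlmostEverywhere.FiniteMod-trans em A₊ (≤ᴬ C) fin′ fin)))
    where
    open Section S
    irreducible : IsIrreducible (reduced S fin)
    irreducible K F⊆K K⊆B stable = by-cases
      (λ K/C → inj₁ (SA.FiniteMod-mono {H = ∣ C ∣ᴬ} {∣ F S fin ∣ᴬ} (C⊆H⁰ S fin) K/C))
      (λ ¬K/C → inj₂ (classical λ ¬B/K →
        unsplit (K , (λ p → F⊆K (C⊆H⁰ S fin p)) , K⊆B , stable , ¬K/C , ¬B/K)))

  -- Both parts of a splitting are infinite, hence of positive rank, so `rank-tower` makes each
  -- smaller than B/C. The lower part K/C is settled before B/K, since finiteness of H⁰(B/K) relies
  -- on that of H¹(K/C).
  H⁰-finite⇒H¹-finite : ∀ n S → rank (Section.B S 𝐀./ Section.C S) < n →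
                        SectionTheory.H⁰-finite S → SectionTheory.H¹-finite S
  H⁰-finite⇒H¹-finite (ℕ.suc n) S (s≤s r≤n) fin = by-cases (SectionTheory.finite⇒H¹-finite S) λ infinite →
    by-cases (split infinite) (λ unsplit → unsplit⇒H¹-finite S infinite unsplit fin)
    where
    open Section S
    split : ¬ SA.FiniteMod ∣ B ∣ᴬ ∣ C ∣ᴬ → Splitting S → SectionTheory.H¹-finite S
    split _ (K , C⊆K , K⊆B , stable , ¬K/C , ¬B/K) =
      H¹-finite-extension S K C⊆K K⊆B stable
        (H⁰-finite⇒H¹-finite n (quo S K C⊆K K⊆B stable) (ℕ.<-≤-trans B/K< r≤n)
          (H⁰-finite-quotient S K C⊆K K⊆B stable sub-finite fin))
        sub-finite
      where
      tower = 𝐀.rank-tower {B} {K} {C} K⊆B C⊆K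
      B/K< : rank (B 𝐀./ K) < rank (B 𝐀./ C)
      B/K< = ℕ.<-≤-trans (ℕ.m<m+n (rank (B 𝐀./ K)) (infinite⇒rank>0 (K 𝐀./ C) ¬K/C)) tower
      K/C< : rank (K 𝐀./ C) < rank (B 𝐀./ C)
      K/C< = ℕ.<-≤-trans (ℕ.m<n+m (rank (K 𝐀./ C)) (infinite⇒rank>0 (B 𝐀./ K) ¬B/K)) tower
      sub-finite = H⁰-finite⇒H¹-finite n (sub S K C⊆K K⊆B stable) (ℕ.<-≤-trans K/C< r≤n)
        (H⁰-finite-sub S K C⊆K K⊆B stable fin)

-- From the section A/0 back to the almost cohomology of A

module Comparison
  {ℓ : Level} {𝓛 : Signature ℓ} {T : Theory 𝓛} (em : ∀ {p} → ExcludedMiddle p) (FD : FiniteDimensional T)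
  (M : Model T) (𝔤 : LieRing ℓ) (A : LieModule 𝔤) (Δ : DefinableIn (Model.structure M) 𝔤 A)
  where

  open Setting em FD M 𝔤 A Δ
  open FiniteCovers em
  open AbelianGroupSolver A₊ using (solve; #_; 𝟘; _⊕_; _⊖_)
  private module H = AlmostCohomology 𝔤 A
  open H using (SubgroupHom)
  open H.SubgroupHom
  open Additive.IsAdditive

  whole : 𝐀.Subgroupᴰ
  whole = record
    { Carrierˢ   = λ _ → Unit.⊤
    ; isSubgroup = _
    ; defˢ       = Def-⇔ (λ _ → mk⇔ _ λ _ → A₊.refl) (projection idᴾ ≈ᴰ projection idᴾ)
    }

  full : Section
  full = record
    { B       = whole
    ; C       = 𝐀.trivial
    ; C⊆B     = _
    ; stableB = L₊.ε ∷ [] , _ ∷ [] , λ _ → here _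
    ; stableC = L₊.ε ∷ [] , _ ∷ [] , λ {x} _ → here λ b e →
        A₊.trans (A.·-cong L₊.refl e) (0-homo (·-additiveʳ _))
    }

  open SectionTheory full

  private
    ≡⇒≈ : ∀ {a b} → a ≡ᴴ b → a ≈ b
    ≡⇒≈ = AbelianGroupProperties.x∙y⁻¹≈ε⇒x≈y A₊ _ _

  H̃⁰-Finite⇒H⁰-finite : H.H̃⁰-Finite → H⁰-finite
  H̃⁰-Finite⇒H⁰-finite fin = FiniteUpTo-transfer _≡_ fin
    (λ (_ , h) → _ , kernel-finite h , ≡.refl)
    λ where _ _ _ _ _ ≡.refl ≡.refl e e′ → ≈⇒≡ᴴ (A₊.trans e (A₊.sym e′))
    where
    kernel-finite : ∀ {b} → FI (Killing b) → b ∈ H.H̃⁰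
    kernel-finite {b} h = FiniteUpTo-transfer (λ a x → a ≈ x · b - 0#) h
      (λ (x , _ , e) → x , _ , e)
      λ {_} {_} {x} {x′} {z} _ _ _ _ _ e e′ k k′ →
        let eq = λ {x} k → ≡⇒≈ {x · b} {z · b}
                   (A₊.trans (A₊.sym (sub-homo (·-additiveˡ b) x z)) k) in
        A₊.trans e (A₊.trans (A₊.∙-congʳ (A₊.trans (eq k) (A₊.sym (eq k′)))) (A₊.sym e′))

  -- Excluded middle decides membership in the domain; `0#` is a junk value outside it.
  extend : SubgroupHom → Lᶜ → Aᶜ
  extend f x = by-cases (at f x) (λ _ → 0#)

  extend-at : ∀ f {x} (p : x ∈ Dom f) → extend f x ≈ at f x p
  extend-at f {x} p with em {P = x ∈ Dom f}
  ... | yes q = cong f q p L₊.refl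
  ... | no ¬p = contradiction p ¬p

  module _ (f : SubgroupHom) (almostDerivation : H.IsAlmostDerivation f) where
    private
      F : Lᶜ → Aᶜ
      F = extend f

      module Dom = IsSubgroup (isSubgroup f)

      F-hom : AlmostHom F
      F-hom = record
        { D      = Dom f
        ; D≤G    = isSubgroup f
        ; finite = proj₁ almostDerivation
        ; cong   = λ p q e → ≈⇒≡ᴴ (A₊.trans (extend-at f p) (A₊.trans (cong f p q e) (A₊.sym (extend-at f q))))
        ; homo   = λ p q → ≈⇒≡ᴴ (A₊.trans (extend-at f (Dom.∙-closed p q))
            (A₊.trans (homo f p q (Dom.∙-closed p q)) (A₊.∙-cong (A₊.sym (extend-at f p)) (A₊.sym (extend-at f q)))))
        }

      -- The failure of the derivation rule. It is additive in each argument where defined, so the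
      -- places where it vanishes form subgroups.
      defect : Lᶜ → Lᶜ → Aᶜ
      defect x y = F ⁅ x , y ⁆ - (x · F y - y · F x)

      stable : ∀ x {a} → a ∈ ∣ C ∣ᴬ → x · a ∈ ∣ C ∣ᴬ
      stable x e = A₊.trans (A.·-cong L₊.refl e) (0-homo (·-additiveʳ x))

      defectʳ : ∀ x → AlmostHom (defect x)
      defectʳ x = AlmostHom-sub (AlmostHom-∘ F-hom (ad-additive x))
        (AlmostHom-sub (additive-∘ F-hom (·-additiveʳ x) (stable x)) (additive⇒AlmostHom (·-additiveˡ (F x))))

      defectˡ : ∀ y → AlmostHom (λ x → defect x y)
      defectˡ y = AlmostHom-sub (AlmostHom-∘ F-hom (ad-additiveˡ y))
        (AlmostHom-sub (additive⇒AlmostHom (·-additiveˡ (F y))) (additive-∘ F-hom (·-additiveʳ y) (stable y)))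

      Derives : Lᶜ → Pred Lᶜ ℓ
      Derives x y = y ∈ D (defectʳ x) × defect x y ∈ ∣ C ∣ᴬ

      derives-almost : ∀ {x} → FI (Derives x) → Almost (Derives x)
      derives-almost {x} = almost (kernel-isSubgroup (defectʳ x))

      DF : Pred Lᶜ ℓ
      DF x = x ∈ Dom f × FI (Derives x)

      -- The definition of almost derivation asks only for finite index, whereas a domain must be a
      -- subgroup. Additivity of `defect` in its first argument, for fixed `y`, provides the
      -- closure.
      DF-isSubgroup : IsSubgroup L₊ DF
      DF-isSubgroup = record
        { respects  = λ {x} {x′} e (p , h) → Dom.respects e p ,
            Almost⇒FiniteIndex {Derives x′} (Almost-map
              (λ {y} ((q , r , _) , k) → let q′ = Dom.respects (⟦⟧-cong (ad-additiveˡ y) e) q in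
                (q′ , r , _) , ≡-∈ (AlmostHom.cong (defectˡ y) (q′ , _ , Dom.respects e p) (q , _ , p) (L₊.sym e)) k)
              (derives-almost h))
        ; ε-closed  = Dom.ε-closed , Almost⇒FiniteIndex {Derives L₊.ε} (Almost-map
            (λ {y} q → (Dom.respects (L₊.sym (0-homo (ad-additiveˡ y))) Dom.ε-closed , q , _) ,
                       ≡ε⇒∈ (AlmostHom.ε-homo (defectˡ y)))
            (everywhere F-hom))
        ; ∙-closed  = λ {x} {x′} (p , h) (p′ , h′) → Dom.∙-closed p p′ ,
            Almost⇒FiniteIndex {Derives (x +ᴸ x′)} (Almost-map
              (λ {y} (((q , r , _) , k) , ((q′ , _ , _) , k′)) →
                (Dom.respects (L₊.sym (+-homo (ad-additiveˡ y) x x′)) (Dom.∙-closed q q′) , r , _) ,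
                ≡-∈ (AlmostHom.homo (defectˡ y) (q , _ , p) (q′ , _ , p′)) (C.∙-closed k k′))
              (Almost-∩ (derives-almost h) (derives-almost h′)))
        ; ⁻¹-closed = λ {x} (p , h) → Dom.⁻¹-closed p ,
            Almost⇒FiniteIndex {Derives (-ᴸ x)} (Almost-map
              (λ {y} ((q , r , _) , k) →
                (Dom.respects (L₊.sym (neg-homo (ad-additiveˡ y) x)) (Dom.⁻¹-closed q) , r , _) ,
                ≡-∈ (AlmostHom.⁻¹-homo (defectˡ y) (q , _ , p)) (C.⁻¹-closed k))
              (derives-almost h))
        }

      Dᶠ⊆DF : H.Dᶠ f ⊆ DF
      Dᶠ⊆DF {x} (p , h) = p , SL.FiniteMod-mono {H = H.Dᶠ[_] f p} {Derives x}
        (λ {y} (q , r , e) → (r , q , _) , ≈⇒≡ᴴ′ (A₊.trans (extend-at f r) (A₊.trans e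
          (A₊.∙-cong (A.·-cong L₊.refl (A₊.sym (extend-at f q)))
                     (A₊.⁻¹-cong (A.·-cong L₊.refl (A₊.sym (extend-at f p)))))))) h
        where
        ≈⇒≡ᴴ′ : ∀ {a b} → a ≈ b → a - b ≈ 0#
        ≈⇒≡ᴴ′ e = AbelianGroupProperties.x≈y⇒x∙y⁻¹≈ε A₊ e

    extend-almostDerivation : AlmostDerivation (extend f)
    extend-almostDerivation = record
      { hom    = record
        { D      = DF
        ; D≤G    = DF-isSubgroup
        ; finite = SL.FiniteMod-mono {H = H.Dᶠ f} {DF} Dᶠ⊆DF (proj₂ almostDerivation)
        ; cong   = λ (p , _) (q , _) → AlmostHom.cong F-hom p q
        ; homo   = λ (p , _) (q , _) → AlmostHom.homo F-hom p q
        }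
      ; into   = _
      ; derive = λ (_ , h) → Almost-map proj₂ (derives-almost h)
      }

  -- The difference minus `d (a - a′)` vanishes on the part of its domain in a subgroup `E` of
  -- finite index. It is therefore constant on cosets of `E` and has a finite image.
  ≃⇒≈¹ : ∀ f f′ {g} → extend f ≃ g → extend f′ ≃ g → f H.≈¹ f′
  ≃⇒≈¹ f f′ {g} (a , _ , h) (a′ , _ , h′) = a - a′ ,
    FiniteUpTo-transfer (λ c x → Σ[ p ∈ x ∈ Dom δ ] c ≈ at δ x p)
      (SL.FiniteMod-sub {K = Dom δ} {U} E≤L _ E-fin)
      (λ (x , p , e) → x , p , p , e)
      λ {_} {_} {x} {x′} _ _ _ _ _ (p , e) (p′ , e′) k k′ →
        A₊.trans e (A₊.trans (constant p p′ (SL.-‿trans E≤L k (SL.-‿flip E≤L k′))) (A₊.sym e′))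
    where
    δ = (f H.-ʰ f′) H.-ʰ H.d (a - a′)
    module Δ = IsSubgroup (isSubgroup δ)
    both = Almost-∩ h h′
    E = proj₁ both
    E≤L = proj₁ (proj₂ both)
    E-fin = proj₁ (proj₂ (proj₂ both))
    vanish : ∀ {x} (p : x ∈ Dom δ) → x ∈ E → at δ x p ≈ 0#
    vanish {x} ((p , p′) , _) k =
      let e , e′ = proj₂ (proj₂ (proj₂ both)) k in
      A₊.trans
        (A₊.∙-cong
          (A₊.∙-cong (A₊.trans (A₊.sym (extend-at f p)) (≡⇒≈ e))
                     (A₊.⁻¹-cong (A₊.trans (A₊.sym (extend-at f′ p′)) (≡⇒≈ e′))))
          (A₊.⁻¹-cong (sub-homo (·-additiveʳ x) a a′)))
        (solve (g x ∷ x · a ∷ x · a′ ∷ [])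
          (((# 0F ⊕ # 1F) ⊖ (# 0F ⊕ # 2F)) ⊖ (# 1F ⊖ # 2F)) 𝟘 ≡.refl)
    constant : ∀ {x x′} (p : x ∈ Dom δ) (p′ : x′ ∈ Dom δ) → x -ᴸ x′ ∈ E → at δ x p ≈ at δ x′ p′
    constant {x} {x′} p p′ k =
      let q = Δ.∙-closed p (Δ.⁻¹-closed p′)
          r = Δ.∙-closed q p′
      in A₊.trans (cong δ p r (L₊.sym (L₊.trans (L₊.assoc x (-ᴸ x′) x′)
             (L₊.trans (L₊.∙-congˡ (L₊.inverseˡ x′)) (L₊.identityʳ x)))))
           (A₊.trans (homo δ q p′ r) (A₊.trans (A₊.∙-congʳ (vanish q k)) (A₊.identityˡ _)))

  H¹-finite⇒H̃¹-Finite : H¹-finite → H.H̃¹-Finite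
  H¹-finite⇒H̃¹-Finite fin = FiniteUpTo-transfer (λ f g → g ≡ extend f) fin
    (λ {f} ∂ → extend f , extend-almostDerivation f ∂ , ≡.refl)
    λ { {f} {f′} _ _ _ _ _ ≡.refl ≡.refl h h′ → ≃⇒≈¹ f f′ h h′ }

theorem1p4 : (∀ {p} → ExcludedMiddle p) →
    ∀ {ℓ : Level} {𝓛 : Signature ℓ} {T : Theory 𝓛} → FiniteDimensional T →
    (M : Model T) (𝔤 : LieRing ℓ) (A : LieModule 𝔤) →
    DefinableIn (Model.structure M) 𝔤 A →
    Nilpotent 𝔤 →
    AlmostCohomology.H̃⁰-Finite 𝔤 A →
    AlmostCohomology.H̃¹-Finite 𝔤 A
theorem1p4 em FD M 𝔤 A Δ nil fin = H¹-finite⇒H̃¹-Finite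
  -- The strict bound is inferred as one more than the rank of A/0.
  (H⁰-finite⇒H¹-finite _ full ℕ.≤-refl (H̃⁰-Finite⇒H⁰-finite fin))
  where
  open Comparison em FD M 𝔤 A Δ
  open Induction em FD M 𝔤 A Δ nil
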